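{- Let $T$ be a computably enumerable sequential theory formulated in a finite language $\mathcal{L}$, and let $A$ be a collection of $\mathcal{L}$-sentences such that $A\subseteq\Sigma_n^{*}$ for some $n\in\omega$ and $T\cup A$ is consistent. Then $T\cup A$ is incomplete, i.e., there is an $\mathcal{L}$-sentence $\psi$ such that $T\cup A$ proves neither $\psi$ nor $\neg\psi$.
   Context: A theory $T$ is sequential if there is a formula $N(x)$, together with formulae providing interpretations of equality and of successor, addition and multiplication on the elements satisfying $N(x)$, such that $T$ proves the translations of the axioms of Robinson's arithmetic $\mathsf{Q}$ relativized to $N$; and additionally there is a formula $\beta(x,i,w)$ (intended meaning: $x$ is the $i$-th element of the sequence $w$) such that $T$ proves $\forall w,x,k\ \exists w'\ \forall i,y\ [ (N(k)\wedge i\le k)\rightarrow (\beta(y,i,w')\leftrightarrow [(i<k\wedge\beta(y,i,w))\vee(i=k\wedge y=x)])]$. The classes $\Sigma_n^{*},\Pi_n^{*}$ measure depth of quantifier alternation (not requiring prenex form): $\Sigma_0^{*}=\Pi_0^{*}$ consists of the quantifier-free formulae; $\Sigma_{n+1}^{*}$ is the smallest class containing $\Pi_n^{*}$ (hence $\Sigma_n^*$) and closed under $\wedge$, $\vee$, existential quantification, under forming $\neg\varphi$ for $\varphi\in\Pi_{n+1}^{*}$, and under forming $\varphi\to\psi$ for $\varphi\in\Pi_{n+1}^{*}$, $\psi\in\Sigma_{n+1}^{*}$; $\Pi_{n+1}^{*}$ is defined dually. -}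

module Defs where

open import Data.Nat using (ℕ; zero; suc; _+_; _*_; _∸_; _⊔_; _≤_)
open import Data.Fin using (Fin; toℕ)
open import Data.Vec using (Vec; []; _∷_)
open import Data.List using (List; []; _∷_)
open import Data.List.Relation.Unary.All using (All)
open import Data.List.Membership.Propositional using (_∈_)
open import Data.Product using (Σ; _×_; _,_; ∃)
open import Data.Sum using (_⊎_)
open import Relation.Nullary using (¬_)
open import Relation.Binary.PropositionalEquality using (_≡_)

-- Computability: primitive recursive functions and c.e. sets
-- (a set X ⊆ ℕ is c.e. iff X = { x | ∃ y. p(x,y) = 0 } for a
--  primitive recursive p  -- Kleene normal form)

data PR : ℕ → Set where
  zer  : PR 0
  succ : PR 1
  proj : ∀ {n} → Fin n → PR n
  comp : ∀ {m n} → PR m → Vec (PR n) m → PR n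
  prec : ∀ {n} → PR n → PR (suc (suc n)) → PR (suc n)

lookupV : ∀ {n} → Vec ℕ n → Fin n → ℕ
lookupV (x ∷ xs) Fin.zero    = x
lookupV (x ∷ xs) (Fin.suc i) = lookupV xs i

mutual
  evalPR : ∀ {n} → PR n → Vec ℕ n → ℕ
  evalPR zer        xs       = 0
  evalPR succ       (x ∷ []) = suc x
  evalPR (proj i)   xs       = lookupV xs i
  evalPR (comp f gs) xs      = evalPR f (evalPRs gs xs)
  evalPR (prec g h) (y ∷ xs) = evalRec g h y xs

  evalPRs : ∀ {m n} → Vec (PR n) m → Vec ℕ n → Vec ℕ m
  evalPRs []       xs = []
  evalPRs (g ∷ gs) xs = evalPR g xs ∷ evalPRs gs xs

  evalRec : ∀ {n} → PR n → PR (suc (suc n)) → ℕ → Vec ℕ n → ℕ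
  evalRec g h zero    xs = evalPR g xs
  evalRec g h (suc y) xs = evalPR h (y ∷ evalRec g h y xs ∷ xs)

CE : (ℕ → Set) → Set
CE X = Σ (PR 2) λ p → ∀ x → (X x → ∃ λ y → evalPR p (x ∷ y ∷ []) ≡ 0)
                           × ((∃ λ y → evalPR p (x ∷ y ∷ []) ≡ 0) → X x)

record Lang : Set where
  field
    nFun     : ℕ
    funArity : Fin nFun → ℕ
    nRel     : ℕ
    relArity : Fin nRel → ℕ
open Lang public

module _ (L : Lang) where

  data Term : Set where
    var : ℕ → Term
    fun : (f : Fin (nFun L)) → Vec Term (funArity L f) → Term

  infixr 6 _∧'_
  infixr 5 _∨'_
  infixr 4 _⇒'_
  infix  7 _≐_

  data Fm : Set where
    ⊥'    : Fm
    rel   : (r : Fin (nRel L)) → Vec Term (relArity L r) → Fm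
    _≐_   : Term → Term → Fm
    ¬'    : Fm → Fm
    _∧'_  : Fm → Fm → Fm
    _∨'_  : Fm → Fm → Fm
    _⇒'_  : Fm → Fm → Fm
    ∀'    : Fm → Fm
    ∃'    : Fm → Fm

module _ {L : Lang} where

  mutual
    substT : (ℕ → Term L) → Term L → Term L
    substT σ (var i)    = σ i
    substT σ (fun f ts) = fun f (substTs σ ts)

    substTs : ∀ {k} → (ℕ → Term L) → Vec (Term L) k → Vec (Term L) k
    substTs σ []       = []
    substTs σ (t ∷ ts) = substT σ t ∷ substTs σ ts

  ↑ : Term L → Term L
  ↑ = substT (λ i → var (suc i))

  liftσ : (ℕ → Term L) → ℕ → Term L
  liftσ σ zero    = var zero
  liftσ σ (suc i) = ↑ (σ i)

  substF : (ℕ → Term L) → Fm L → Fm L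
  substF σ ⊥'        = ⊥'
  substF σ (rel r ts) = rel r (substTs σ ts)
  substF σ (s ≐ t)   = substT σ s ≐ substT σ t
  substF σ (¬' φ)    = ¬' (substF σ φ)
  substF σ (φ ∧' ψ)  = substF σ φ ∧' substF σ ψ
  substF σ (φ ∨' ψ)  = substF σ φ ∨' substF σ ψ
  substF σ (φ ⇒' ψ)  = substF σ φ ⇒' substF σ ψ
  substF σ (∀' φ)    = ∀' (substF (liftσ σ) φ)
  substF σ (∃' φ)    = ∃' (substF (liftσ σ) φ)

  shiftF : Fm L → Fm L
  shiftF = substF (λ i → var (suc i))

  sub0 : Term L → ℕ → Term L
  sub0 t zero    = t
  sub0 t (suc i) = var i

  _[_] : Fm L → Term L → Fm L
  φ [ t ] = substF (sub0 t) φ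

  env : List (Term L) → ℕ → Term L
  env []       i       = var i
  env (t ∷ ts) zero    = t
  env (t ∷ ts) (suc i) = env ts i

  apply : Fm L → List (Term L) → Fm L
  apply φ ts = substF (env ts) φ

  -- free variables: bound = 1 + largest free variable index (0 if none)
  mutual
    fvT : Term L → ℕ
    fvT (var i)    = suc i
    fvT (fun f ts) = fvTs ts

    fvTs : ∀ {k} → Vec (Term L) k → ℕ
    fvTs []       = 0
    fvTs (t ∷ ts) = fvT t ⊔ fvTs ts

  fv : Fm L → ℕ
  fv ⊥'         = 0
  fv (rel r ts) = fvTs ts
  fv (s ≐ t)    = fvT s ⊔ fvT t
  fv (¬' φ)     = fv φ
  fv (φ ∧' ψ)   = fv φ ⊔ fv ψ
  fv (φ ∨' ψ)   = fv φ ⊔ fv ψ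
  fv (φ ⇒' ψ)   = fv φ ⊔ fv ψ
  fv (∀' φ)     = fv φ ∸ 1
  fv (∃' φ)     = fv φ ∸ 1

  FreeBelow : ℕ → Fm L → Set
  FreeBelow k φ = fv φ ≤ k

  Sentence : Fm L → Set
  Sentence φ = fv φ ≡ 0

  mapF : (Fm L → Fm L) → List (Fm L) → List (Fm L)
  mapF f []       = []
  mapF f (φ ∷ Γ)  = f φ ∷ mapF f Γ

  infix 2 _⊢_
  data _⊢_ : List (Fm L) → Fm L → Set where
    hyp  : ∀ {Γ φ} → φ ∈ Γ → Γ ⊢ φ
    ⊥E   : ∀ {Γ φ} → Γ ⊢ ⊥' → Γ ⊢ φ
    raa  : ∀ {Γ φ} → (¬' φ ∷ Γ) ⊢ ⊥' → Γ ⊢ φ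
    ¬I   : ∀ {Γ φ} → (φ ∷ Γ) ⊢ ⊥' → Γ ⊢ ¬' φ
    ¬E   : ∀ {Γ φ} → Γ ⊢ ¬' φ → Γ ⊢ φ → Γ ⊢ ⊥'
    ∧I   : ∀ {Γ φ ψ} → Γ ⊢ φ → Γ ⊢ ψ → Γ ⊢ φ ∧' ψ
    ∧E₁  : ∀ {Γ φ ψ} → Γ ⊢ φ ∧' ψ → Γ ⊢ φ
    ∧E₂  : ∀ {Γ φ ψ} → Γ ⊢ φ ∧' ψ → Γ ⊢ ψ
    ∨I₁  : ∀ {Γ φ ψ} → Γ ⊢ φ → Γ ⊢ φ ∨' ψ
    ∨I₂  : ∀ {Γ φ ψ} → Γ ⊢ ψ → Γ ⊢ φ ∨' ψ
    ∨E   : ∀ {Γ φ ψ χ} → Γ ⊢ φ ∨' ψ → (φ ∷ Γ) ⊢ χ → (ψ ∷ Γ) ⊢ χ → Γ ⊢ χ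
    ⇒I   : ∀ {Γ φ ψ} → (φ ∷ Γ) ⊢ ψ → Γ ⊢ φ ⇒' ψ
    ⇒E   : ∀ {Γ φ ψ} → Γ ⊢ φ ⇒' ψ → Γ ⊢ φ → Γ ⊢ ψ
    ∀I   : ∀ {Γ φ} → mapF shiftF Γ ⊢ φ → Γ ⊢ ∀' φ
    ∀E   : ∀ {Γ φ} (t : Term L) → Γ ⊢ ∀' φ → Γ ⊢ φ [ t ]
    ∃I   : ∀ {Γ φ} (t : Term L) → Γ ⊢ φ [ t ] → Γ ⊢ ∃' φ
    ∃E   : ∀ {Γ φ ψ} → Γ ⊢ ∃' φ → (φ ∷ mapF shiftF Γ) ⊢ shiftF ψ → Γ ⊢ ψ
    ≐refl : ∀ {Γ} (t : Term L) → Γ ⊢ t ≐ t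
    ≐E   : ∀ {Γ φ s t} → Γ ⊢ s ≐ t → Γ ⊢ φ [ s ] → Γ ⊢ φ [ t ]

  _⊩_ : (Fm L → Set) → Fm L → Set
  Th ⊩ φ = Σ (List (Fm L)) λ Γ → All Th Γ × (Γ ⊢ φ)

  _∪_ : (Fm L → Set) → (Fm L → Set) → Fm L → Set
  (T ∪ A) φ = T φ ⊎ A φ

  Consistent : (Fm L → Set) → Set
  Consistent Th = ¬ (Th ⊩ ⊥')

  Incomplete : (Fm L → Set) → Set
  Incomplete Th = Σ (Fm L) λ ψ → Sentence ψ × ¬ (Th ⊩ ψ) × ¬ (Th ⊩ ¬' ψ)

  pair : ℕ → ℕ → ℕ
  pair a b = tri (a + b) + b
    where
    tri : ℕ → ℕ
    tri zero    = 0
    tri (suc n) = suc n + tri n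

  mutual
    codeT : Term L → ℕ
    codeT (var i)    = pair 0 i
    codeT (fun f ts) = pair 1 (pair (toℕ f) (codeTs ts))

    codeTs : ∀ {k} → Vec (Term L) k → ℕ
    codeTs []       = 0
    codeTs (t ∷ ts) = suc (pair (codeT t) (codeTs ts))

  code : Fm L → ℕ
  code ⊥'         = pair 0 0
  code (rel r ts) = pair 1 (pair (toℕ r) (codeTs ts))
  code (s ≐ t)    = pair 2 (pair (codeT s) (codeT t))
  code (¬' φ)     = pair 3 (code φ)
  code (φ ∧' ψ)   = pair 4 (pair (code φ) (code ψ))
  code (φ ∨' ψ)   = pair 5 (pair (code φ) (code ψ))
  code (φ ⇒' ψ)   = pair 6 (pair (code φ) (code ψ))
  code (∀' φ)     = pair 7 (code φ)
  code (∃' φ)     = pair 8 (code φ)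

  CETheory : (Fm L → Set) → Set
  CETheory T = CE (λ n → Σ (Fm L) λ φ → T φ × code φ ≡ n)

  data QF : Fm L → Set where
    qf⊥  : QF ⊥'
    qfrel : ∀ r ts → QF (rel r ts)
    qfeq : ∀ s t → QF (s ≐ t)
    qf¬  : ∀ {φ} → QF φ → QF (¬' φ)
    qf∧  : ∀ {φ ψ} → QF φ → QF ψ → QF (φ ∧' ψ)
    qf∨  : ∀ {φ ψ} → QF φ → QF ψ → QF (φ ∨' ψ)
    qf⇒  : ∀ {φ ψ} → QF φ → QF ψ → QF (φ ⇒' ψ)

  mutual
    data Sig* : ℕ → Fm L → Set where
      qf   : ∀ {φ} → QF φ → Sig* 0 φ
      pi   : ∀ {n φ} → Pi* n φ → Sig* (suc n) φ
      and  : ∀ {n φ ψ} → Sig* (suc n) φ → Sig* (suc n) ψ → Sig* (suc n) (φ ∧' ψ)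
      or   : ∀ {n φ ψ} → Sig* (suc n) φ → Sig* (suc n) ψ → Sig* (suc n) (φ ∨' ψ)
      ex   : ∀ {n φ} → Sig* (suc n) φ → Sig* (suc n) (∃' φ)
      neg  : ∀ {n φ} → Pi* (suc n) φ → Sig* (suc n) (¬' φ)
      imp  : ∀ {n φ ψ} → Pi* (suc n) φ → Sig* (suc n) ψ → Sig* (suc n) (φ ⇒' ψ)

    data Pi* : ℕ → Fm L → Set where
      qf   : ∀ {φ} → QF φ → Pi* 0 φ
      sig  : ∀ {n φ} → Sig* n φ → Pi* (suc n) φ
      and  : ∀ {n φ ψ} → Pi* (suc n) φ → Pi* (suc n) ψ → Pi* (suc n) (φ ∧' ψ)
      or   : ∀ {n φ ψ} → Pi* (suc n) φ → Pi* (suc n) ψ → Pi* (suc n) (φ ∨' ψ)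
      all  : ∀ {n φ} → Pi* (suc n) φ → Pi* (suc n) (∀' φ)
      neg  : ∀ {n φ} → Sig* (suc n) φ → Pi* (suc n) (¬' φ)
      imp  : ∀ {n φ ψ} → Sig* (suc n) φ → Pi* (suc n) ψ → Pi* (suc n) (φ ⇒' ψ)

  -- Data of a (one-dimensional, parameter-free) interpretation of Q
  -- (in relational form) together with a sequence formula β.
  --   N(x0)            : domain
  --   Z(x0)            : x0 = 0
  --   E(x0,x1)         : x0 = x1        (interpreted equality)
  --   S(x0,x1)         : S x0 = x1
  --   A(x0,x1,x2)      : x0 + x1 = x2
  --   M(x0,x1,x2)      : x0 · x1 = x2
  --   B(x0,x1,x2)      : x0 is the x1-th element of the sequence x2
  record SeqData : Set where
    field
      N Z E S A M B : Fm L
      N-fv : FreeBelow 1 N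
      Z-fv : FreeBelow 1 Z
      E-fv : FreeBelow 2 E
      S-fv : FreeBelow 2 S
      A-fv : FreeBelow 3 A
      M-fv : FreeBelow 3 M
      B-fv : FreeBelow 3 B

  module SeqAx (D : SeqData) where
    open SeqData D

    v : ℕ → Term L
    v = var

    N[_] : Term L → Fm L
    N[ a ] = apply N (a ∷ [])
    Z[_] : Term L → Fm L
    Z[ a ] = apply Z (a ∷ [])
    E[_,_] S[_,_] : Term L → Term L → Fm L
    E[ a , b ] = apply E (a ∷ b ∷ [])
    S[ a , b ] = apply S (a ∷ b ∷ [])
    A[_,_,_] M[_,_,_] B[_,_,_] : Term L → Term L → Term L → Fm L
    A[ a , b , c ] = apply A (a ∷ b ∷ c ∷ [])
    M[ a , b , c ] = apply M (a ∷ b ∷ c ∷ [])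
    B[ a , b , c ] = apply B (a ∷ b ∷ c ∷ [])

    ∀N ∃N : Fm L → Fm L
    ∀N φ = ∀' (N[ v 0 ] ⇒' φ)
    ∃N φ = ∃' (N[ v 0 ] ∧' φ)

    _⇔'_ : Fm L → Fm L → Fm L
    φ ⇔' ψ = (φ ⇒' ψ) ∧' (ψ ⇒' φ)

    Le Lt : Term L → Term L → Fm L
    Le a b = ∃N A[ v 0 , ↑ a , ↑ b ]
    Lt a b = Le a b ∧' ¬' E[ a , b ]

    WellDef : List (Fm L)
    WellDef =
        ∀N E[ v 0 , v 0 ]
      ∷ ∀N (∀N (E[ v 1 , v 0 ] ⇒' E[ v 0 , v 1 ]))
      ∷ ∀N (∀N (∀N (E[ v 2 , v 1 ] ∧' E[ v 1 , v 0 ] ⇒' E[ v 2 , v 0 ])))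
      ∷ ∃N Z[ v 0 ]
      ∷ ∀N (∃N S[ v 1 , v 0 ])
      ∷ ∀N (∀N (∃N A[ v 2 , v 1 , v 0 ]))
      ∷ ∀N (∀N (∃N M[ v 2 , v 1 , v 0 ]))
      ∷ ∀N (∀N (Z[ v 1 ] ∧' Z[ v 0 ] ⇒' E[ v 1 , v 0 ]))
      ∷ ∀N (∀N (∀N (S[ v 2 , v 1 ] ∧' S[ v 2 , v 0 ] ⇒' E[ v 1 , v 0 ])))
      ∷ ∀N (∀N (∀N (∀N (A[ v 3 , v 2 , v 1 ] ∧' A[ v 3 , v 2 , v 0 ] ⇒' E[ v 1 , v 0 ]))))
      ∷ ∀N (∀N (∀N (∀N (M[ v 3 , v 2 , v 1 ] ∧' M[ v 3 , v 2 , v 0 ] ⇒' E[ v 1 , v 0 ]))))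
      ∷ ∀N (∀N (Z[ v 1 ] ∧' E[ v 1 , v 0 ] ⇒' Z[ v 0 ]))
      ∷ ∀N (∀N (∀N (∀N (S[ v 3 , v 2 ] ∧' E[ v 3 , v 1 ] ∧' E[ v 2 , v 0 ] ⇒' S[ v 1 , v 0 ]))))
      ∷ ∀N (∀N (∀N (∀N (∀N (∀N (A[ v 5 , v 4 , v 3 ] ∧' E[ v 5 , v 2 ] ∧' E[ v 4 , v 1 ] ∧' E[ v 3 , v 0 ]
                                 ⇒' A[ v 2 , v 1 , v 0 ]))))))
      ∷ ∀N (∀N (∀N (∀N (∀N (∀N (M[ v 5 , v 4 , v 3 ] ∧' E[ v 5 , v 2 ] ∧' E[ v 4 , v 1 ] ∧' E[ v 3 , v 0 ]
                                 ⇒' M[ v 2 , v 1 , v 0 ]))))))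
      ∷ []

    -- Translations of the axioms Q1–Q7 of Robinson's arithmetic
    QAxioms : List (Fm L)
    QAxioms =
        -- Q1: S x ≠ 0
        ∀N (∀N (∀N (S[ v 2 , v 1 ] ∧' Z[ v 0 ] ⇒' ¬' E[ v 1 , v 0 ])))
        -- Q2: S x = S y → x = y
      ∷ ∀N (∀N (∀N (∀N (S[ v 3 , v 1 ] ∧' S[ v 2 , v 0 ] ∧' E[ v 1 , v 0 ] ⇒' E[ v 3 , v 2 ]))))
        -- Q3: x = 0 ∨ ∃ y (x = S y)
      ∷ ∀N (Z[ v 0 ] ∨' ∃N S[ v 0 , v 1 ])
        -- Q4: x + 0 = x
      ∷ ∀N (∀N (∀N (Z[ v 1 ] ∧' A[ v 2 , v 1 , v 0 ] ⇒' E[ v 0 , v 2 ])))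
        -- Q5: x + S y = S (x + y)
      ∷ ∀N (∀N (∀N (∀N (∀N (S[ v 3 , v 2 ] ∧' A[ v 4 , v 2 , v 1 ] ∧' A[ v 4 , v 3 , v 0 ]
                              ⇒' S[ v 0 , v 1 ])))))
        -- Q6: x · 0 = 0
      ∷ ∀N (∀N (∀N (Z[ v 1 ] ∧' M[ v 2 , v 1 , v 0 ] ⇒' Z[ v 0 ])))
        -- Q7: x · S y = x · y + x
      ∷ ∀N (∀N (∀N (∀N (∀N (S[ v 3 , v 2 ] ∧' M[ v 4 , v 2 , v 1 ] ∧' M[ v 4 , v 3 , v 0 ]
                              ⇒' A[ v 0 , v 4 , v 1 ])))))
      ∷ []

    -- ∀w,x,k ∃w' ∀i,y [(N(k) ∧ i ≤ k) → (β(y,i,w') ↔ [(i<k ∧ β(y,i,w)) ∨ (i=k ∧ y=x)])]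
    -- de Bruijn inside the body: y=0, i=1, w'=2, k=3, x=4, w=5
    SeqAxiom : Fm L
    SeqAxiom =
      ∀' (∀' (∀' (∃' (∀' (∀'
        (N[ v 3 ] ∧' Le (v 1) (v 3)
          ⇒' (B[ v 0 , v 1 , v 2 ]
               ⇔' ((Lt (v 1) (v 3) ∧' B[ v 0 , v 1 , v 5 ])
                   ∨' (E[ v 1 , v 3 ] ∧' (v 0 ≐ v 4))))))))))

  Sequential : (Fm L → Set) → Set
  Sequential T = Σ SeqData λ D → let open SeqAx D in
      All (T ⊩_) WellDef × All (T ⊩_) QAxioms × (T ⊩ SeqAxiom)

{-# OPTIONS --safe #-}
-- Rosser's argument relative to a partial truth predicate.  In the presence of sequences, satisfaction
-- for formulas with a bounded number of quantifier alternations is definable: an assignment is a sequence,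
-- and a block of quantifiers asks for a sequence extending it.  This gives a formula Tr such that every
-- Σ*_n sentence σ is T-equivalent to Tr(c) for some numeral c.  Hence a sentence is provable from T ∪ A
-- iff T proves "Tr(c) implies it" for some c with Tr(c) provable from T ∪ A.  Call p = (c, i) a proof of φ
-- if i witnesses that T proves "Tr(c) implies φ" and Tr(c) holds.  The first condition is primitive recursive,
-- hence decided in T for standard p, although the second is not arithmetical.  So the Rosser sentence
-- "every proof of me is preceded by a proof of my negation" is neither provable nor refutable.
-- Syntactic derivability is arithmetized as a system of Horn clauses between codes, whose stages are
-- primitive recursive; primitive recursion is represented in T by the sequences of T itself.
module Submission where

open import Defs
open import Data.Bool using (Bool; true; false; if_then_else_)
open import Data.Nat using (ℕ; zero; suc; _+_; _*_; _∸_; _⊔_; _≤_; _<_; z≤n; s≤s; pred)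
open import Data.Nat.Properties
open import Data.Fin using (Fin; toℕ; #_; _↑ˡ_; _↑ʳ_) renaming (zero to fz; suc to fs)
open import Data.Fin.Properties using (toℕ-injective)
open import Data.Vec using (Vec; []; _∷_; lookup; toList; head; tail; tabulate) renaming (_++_ to _++ⱽ_; map to mapⱽ)
open import Data.Vec.Properties using (tabulate∘lookup; lookup∘tabulate; tabulate-cong; lookup-++ʳ; lookup-++ˡ)
open import Data.Vec.Relation.Binary.Pointwise.Inductive as PW using (Pointwise; []; _∷_)
open import Data.List using (List; []; _∷_; _++_; map; length; drop; allFin)
open import Data.List.Relation.Unary.Any using (here; there)
open import Data.List.Relation.Unary.All using (All; []; _∷_)
import Data.List.Relation.Unary.All as All
open import Data.List.Relation.Unary.All.Properties using (++⁺) renaming (map⁺ to All-map⁺)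
open import Data.List.Membership.Propositional using (_∈_)
open import Data.List.Membership.Propositional.Properties using (∈-map⁺; ∈-map⁻; ∈-++⁺ˡ; ∈-++⁺ʳ; ∈-lookup; ∈-allFin)
open import Data.Product using (Σ; _×_; _,_; proj₁; proj₂; ∃)
open import Data.Sum using (_⊎_; inj₁; inj₂)
open import Data.Unit using (⊤; tt)
open import Data.Empty using (⊥; ⊥-elim)
open import Function using (_∘_; id)
open import Relation.Nullary using (¬_; Dec; yes; no)
open import Relation.Binary.PropositionalEquality using (_≡_; refl; sym; trans; cong; cong₂; subst; subst₂)

-- `A` is not assumed computably enumerable, so Rosser's sentence cannot be written for `T ∪ A`
-- directly; `A` enters the sentence only through `Tr` applied to a code. Whether a code is true is
-- never decided. Only the primitive recursive half of being a proof is decided, in the metatheory,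
-- and the truth of the code is taken from the hypotheses inside the theory, so the argument stays
-- constructive.
--
-- The other obstacle is the weakness of the base theory. Q has no induction, interpreted equality
-- is not identity, and β is not assumed to respect it. All inductions therefore run outside the
-- theory, on standard numbers, primitive recursive terms or normal forms, and sequences are built
-- only to standard lengths. About arbitrary elements the proof uses their comparison with a
-- standard numeral, `le-below` and `le-total`.
--
-- Normal forms of a fixed level are closed under conjunction; this is how the finitely many axioms
-- of `A` in a derivation become a single sentence, hence a single code.

module _ {L : Lang} where

  Subst : Set
  Subst = ℕ → Term L

  shiftσ : Subst
  shiftσ i = var (suc i)

  -- Simultaneous substitution

  mutual
    substT-cong : ∀ {σ τ : Subst} t → (∀ i → i < fvT t → σ i ≡ τ i) → substT σ t ≡ substT τ t
    substT-cong (var i) e = e i ≤-refl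
    substT-cong (fun f ts) e = cong (fun f) (substTs-cong ts e)

    substTs-cong : ∀ {k} {σ τ : Subst} (ts : Vec (Term L) k) → (∀ i → i < fvTs ts → σ i ≡ τ i) → substTs σ ts ≡ substTs τ ts
    substTs-cong [] e = refl
    substTs-cong (t ∷ ts) e = cong₂ _∷_ (substT-cong t (λ i p → e i (≤-trans p (m≤m⊔n _ _))))
                                        (substTs-cong ts (λ i p → e i (≤-trans p (m≤n⊔m (fvT t) _))))

  liftσ-cong : ∀ {σ τ : Subst} n → (∀ i → i < n ∸ 1 → σ i ≡ τ i) → ∀ i → i < n → liftσ σ i ≡ liftσ τ i
  liftσ-cong n e zero p = refl
  liftσ-cong (suc n) e (suc i) (s≤s p) = cong ↑ (e i p)

  ⊔-l : ∀ {σ τ : Subst} a b → (∀ i → i < a ⊔ b → σ i ≡ τ i) → ∀ i → i < a → σ i ≡ τ i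
  ⊔-l a b e i p = e i (≤-trans p (m≤m⊔n a b))

  ⊔-r : ∀ {σ τ : Subst} a b → (∀ i → i < a ⊔ b → σ i ≡ τ i) → ∀ i → i < b → σ i ≡ τ i
  ⊔-r a b e i p = e i (≤-trans p (m≤n⊔m a b))

  substF-cong : ∀ {σ τ : Subst} φ → (∀ i → i < fv φ → σ i ≡ τ i) → substF σ φ ≡ substF τ φ
  substF-cong ⊥' e = refl
  substF-cong (rel r ts) e = cong (rel r) (substTs-cong ts e)
  substF-cong (s ≐ t) e = cong₂ _≐_ (substT-cong s (⊔-l (fvT s) _ e)) (substT-cong t (⊔-r (fvT s) _ e))
  substF-cong (¬' φ) e = cong ¬' (substF-cong φ e)
  substF-cong (φ ∧' ψ) e = cong₂ _∧'_ (substF-cong φ (⊔-l (fv φ) _ e)) (substF-cong ψ (⊔-r (fv φ) _ e))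
  substF-cong (φ ∨' ψ) e = cong₂ _∨'_ (substF-cong φ (⊔-l (fv φ) _ e)) (substF-cong ψ (⊔-r (fv φ) _ e))
  substF-cong (φ ⇒' ψ) e = cong₂ _⇒'_ (substF-cong φ (⊔-l (fv φ) _ e)) (substF-cong ψ (⊔-r (fv φ) _ e))
  substF-cong (∀' φ) e = cong ∀' (substF-cong φ (liftσ-cong (fv φ) e))
  substF-cong (∃' φ) e = cong ∃' (substF-cong φ (liftσ-cong (fv φ) e))

  substF-ext : ∀ {σ τ : Subst} φ → (∀ i → σ i ≡ τ i) → substF σ φ ≡ substF τ φ
  substF-ext φ e = substF-cong φ (λ i _ → e i)

  mutual
    substT-comp : ∀ (τ σ : Subst) t → substT τ (substT σ t) ≡ substT (substT τ ∘ σ) t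
    substT-comp τ σ (var i) = refl
    substT-comp τ σ (fun f ts) = cong (fun f) (substTs-comp τ σ ts)

    substTs-comp : ∀ {k} (τ σ : Subst) (ts : Vec (Term L) k) → substTs τ (substTs σ ts) ≡ substTs (substT τ ∘ σ) ts
    substTs-comp τ σ [] = refl
    substTs-comp τ σ (t ∷ ts) = cong₂ _∷_ (substT-comp τ σ t) (substTs-comp τ σ ts)

  ↑-lift : ∀ (τ : Subst) t → substT (liftσ τ) (↑ t) ≡ ↑ (substT τ t)
  ↑-lift τ t = trans (substT-comp (liftσ τ) shiftσ t) (sym (substT-comp shiftσ τ t))

  liftσ-comp : ∀ (τ σ : Subst) i → substT (liftσ τ) (liftσ σ i) ≡ liftσ (substT τ ∘ σ) i
  liftσ-comp τ σ zero = refl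
  liftσ-comp τ σ (suc i) = ↑-lift τ (σ i)

  substF-comp : ∀ (τ σ : Subst) φ → substF τ (substF σ φ) ≡ substF (substT τ ∘ σ) φ
  substF-comp τ σ ⊥' = refl
  substF-comp τ σ (rel r ts) = cong (rel r) (substTs-comp τ σ ts)
  substF-comp τ σ (s ≐ t) = cong₂ _≐_ (substT-comp τ σ s) (substT-comp τ σ t)
  substF-comp τ σ (¬' φ) = cong ¬' (substF-comp τ σ φ)
  substF-comp τ σ (φ ∧' ψ) = cong₂ _∧'_ (substF-comp τ σ φ) (substF-comp τ σ ψ)
  substF-comp τ σ (φ ∨' ψ) = cong₂ _∨'_ (substF-comp τ σ φ) (substF-comp τ σ ψ)
  substF-comp τ σ (φ ⇒' ψ) = cong₂ _⇒'_ (substF-comp τ σ φ) (substF-comp τ σ ψ)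
  substF-comp τ σ (∀' φ) = cong ∀' (trans (substF-comp (liftσ τ) (liftσ σ) φ) (substF-ext φ (liftσ-comp τ σ)))
  substF-comp τ σ (∃' φ) = cong ∃' (trans (substF-comp (liftσ τ) (liftσ σ) φ) (substF-ext φ (liftσ-comp τ σ)))

  mutual
    substT-id : ∀ (t : Term L) → substT var t ≡ t
    substT-id (var i) = refl
    substT-id (fun f ts) = cong (fun f) (substTs-id ts)

    substTs-id : ∀ {k} (ts : Vec (Term L) k) → substTs var ts ≡ ts
    substTs-id [] = refl
    substTs-id (t ∷ ts) = cong₂ _∷_ (substT-id t) (substTs-id ts)

  liftσ-var : ∀ i → liftσ {L} var i ≡ var i
  liftσ-var zero = refl
  liftσ-var (suc i) = refl

  substF-id : ∀ (φ : Fm L) → substF var φ ≡ φ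
  substF-id ⊥' = refl
  substF-id (rel r ts) = cong (rel r) (substTs-id ts)
  substF-id (s ≐ t) = cong₂ _≐_ (substT-id s) (substT-id t)
  substF-id (¬' φ) = cong ¬' (substF-id φ)
  substF-id (φ ∧' ψ) = cong₂ _∧'_ (substF-id φ) (substF-id ψ)
  substF-id (φ ∨' ψ) = cong₂ _∨'_ (substF-id φ) (substF-id ψ)
  substF-id (φ ⇒' ψ) = cong₂ _⇒'_ (substF-id φ) (substF-id ψ)
  substF-id (∀' φ) = cong ∀' (trans (substF-ext φ liftσ-var) (substF-id φ))
  substF-id (∃' φ) = cong ∃' (trans (substF-ext φ liftσ-var) (substF-id φ))

  sub0-↑ : ∀ (t s : Term L) → substT (sub0 t) (↑ s) ≡ s
  sub0-↑ t s = trans (substT-comp (sub0 t) shiftσ s) (substT-id s)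

  substTs-sub0-↑ : ∀ {k} (t : Term L) (ts : Vec (Term L) k) → substTs (sub0 t) (substTs shiftσ ts) ≡ ts
  substTs-sub0-↑ t ts = trans (substTs-comp (sub0 t) shiftσ ts) (substTs-id ts)

  substF-[] : ∀ (τ : Subst) φ t → substF τ (φ [ t ]) ≡ substF (liftσ τ) φ [ substT τ t ]
  substF-[] τ φ t = trans (substF-comp τ (sub0 t) φ)
                          (sym (trans (substF-comp (sub0 (substT τ t)) (liftσ τ) φ) (substF-ext φ e)))
    where
    e : ∀ i → substT (sub0 (substT τ t)) (liftσ τ i) ≡ substT τ (sub0 t i)
    e zero = refl
    e (suc i) = sub0-↑ (substT τ t) (τ i)

  substF-shift : ∀ (τ : Subst) φ → substF (liftσ τ) (shiftF φ) ≡ shiftF (substF τ φ)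
  substF-shift τ φ = trans (substF-comp (liftσ τ) shiftσ φ) (sym (substF-comp shiftσ τ φ))

  sentence-subst : ∀ {φ : Fm L} (τ : Subst) → Sentence φ → substF τ φ ≡ φ
  sentence-subst {φ} τ s = trans (substF-cong φ (λ i p → ⊥-elim (absurd (subst (i <_) s p)))) (substF-id φ)
    where
    absurd : ∀ {i} → i < 0 → ⊥
    absurd ()

  -- Structural rules

  infix 4 _⊆ᶜ_
  _⊆ᶜ_ : List (Fm L) → List (Fm L) → Set
  Γ ⊆ᶜ Δ = ∀ {φ} → φ ∈ Γ → φ ∈ Δ

  ⊆ᶜ-cons : ∀ {Γ Δ} {φ : Fm L} → Γ ⊆ᶜ Δ → (φ ∷ Γ) ⊆ᶜ (φ ∷ Δ)
  ⊆ᶜ-cons s (here e) = here e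
  ⊆ᶜ-cons s (there p) = there (s p)

  ∈-mapF : ∀ (f : Fm L → Fm L) {Γ φ} → φ ∈ Γ → f φ ∈ mapF f Γ
  ∈-mapF f (here e) = here (cong f e)
  ∈-mapF f (there p) = there (∈-mapF f p)

  mapF-⊆ : ∀ (f : Fm L → Fm L) {Γ Δ} → Γ ⊆ᶜ Δ → mapF f Γ ⊆ᶜ mapF f Δ
  mapF-⊆ f {ψ ∷ Γ} s (here refl) = ∈-mapF f (s (here refl))
  mapF-⊆ f {ψ ∷ Γ} s (there p) = mapF-⊆ f {Γ} (λ q → s (there q)) p

  wk : ∀ {Γ Δ} {φ : Fm L} → Γ ⊆ᶜ Δ → Γ ⊢ φ → Δ ⊢ φ
  wk s (hyp x) = hyp (s x)
  wk s (⊥E d) = ⊥E (wk s d)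
  wk s (raa d) = raa (wk (⊆ᶜ-cons s) d)
  wk s (¬I d) = ¬I (wk (⊆ᶜ-cons s) d)
  wk s (¬E d e) = ¬E (wk s d) (wk s e)
  wk s (∧I d e) = ∧I (wk s d) (wk s e)
  wk s (∧E₁ d) = ∧E₁ (wk s d)
  wk s (∧E₂ d) = ∧E₂ (wk s d)
  wk s (∨I₁ d) = ∨I₁ (wk s d)
  wk s (∨I₂ d) = ∨I₂ (wk s d)
  wk s (∨E d e f) = ∨E (wk s d) (wk (⊆ᶜ-cons s) e) (wk (⊆ᶜ-cons s) f)
  wk s (⇒I d) = ⇒I (wk (⊆ᶜ-cons s) d)
  wk s (⇒E d e) = ⇒E (wk s d) (wk s e)
  wk s (∀I d) = ∀I (wk (mapF-⊆ shiftF s) d)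
  wk s (∀E t d) = ∀E t (wk s d)
  wk s (∃I t d) = ∃I t (wk s d)
  wk s (∃E d e) = ∃E (wk s d) (wk (⊆ᶜ-cons (mapF-⊆ shiftF s)) e)
  wk s (≐refl t) = ≐refl t
  wk s (≐E {φ = φ} d e) = ≐E {φ = φ} (wk s d) (wk s e)

  mapF-cong-comp : ∀ {f g f' g' : Fm L → Fm L} → (∀ φ → f (g φ) ≡ f' (g' φ)) → ∀ Γ → mapF f (mapF g Γ) ≡ mapF f' (mapF g' Γ)
  mapF-cong-comp e [] = refl
  mapF-cong-comp e (φ ∷ Γ) = cong₂ _∷_ (e φ) (mapF-cong-comp e Γ)

  subst⊢ : ∀ {Γ} {φ : Fm L} (τ : Subst) → Γ ⊢ φ → mapF (substF τ) Γ ⊢ substF τ φ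
  subst⊢ τ (hyp x) = hyp (∈-mapF (substF τ) x)
  subst⊢ τ (⊥E d) = ⊥E (subst⊢ τ d)
  subst⊢ τ (raa d) = raa (subst⊢ τ d)
  subst⊢ τ (¬I d) = ¬I (subst⊢ τ d)
  subst⊢ τ (¬E d e) = ¬E (subst⊢ τ d) (subst⊢ τ e)
  subst⊢ τ (∧I d e) = ∧I (subst⊢ τ d) (subst⊢ τ e)
  subst⊢ τ (∧E₁ d) = ∧E₁ (subst⊢ τ d)
  subst⊢ τ (∧E₂ d) = ∧E₂ (subst⊢ τ d)
  subst⊢ τ (∨I₁ d) = ∨I₁ (subst⊢ τ d)
  subst⊢ τ (∨I₂ d) = ∨I₂ (subst⊢ τ d)
  subst⊢ τ (∨E d e f) = ∨E (subst⊢ τ d) (subst⊢ τ e) (subst⊢ τ f)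
  subst⊢ τ (⇒I d) = ⇒I (subst⊢ τ d)
  subst⊢ τ (⇒E d e) = ⇒E (subst⊢ τ d) (subst⊢ τ e)
  subst⊢ τ (∀I {Γ = Γ} d) = ∀I (subst (_⊢ _) (mapF-cong-comp (substF-shift τ) Γ) (subst⊢ (liftσ τ) d))
  subst⊢ τ (∀E {φ = φ} t d) = subst (_ ⊢_) (sym (substF-[] τ φ t)) (∀E (substT τ t) (subst⊢ τ d))
  subst⊢ τ (∃I {φ = φ} t d) = ∃I (substT τ t) (subst (_ ⊢_) (substF-[] τ φ t) (subst⊢ τ d))
  subst⊢ τ (∃E {Γ = Γ} {φ = φ} {ψ = ψ} d e) = ∃E (subst⊢ τ d)
    (subst₂ _⊢_ (cong (substF (liftσ τ) φ ∷_) (mapF-cong-comp (substF-shift τ) Γ)) (substF-shift τ ψ) (subst⊢ (liftσ τ) e))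
  subst⊢ τ (≐refl t) = ≐refl (substT τ t)
  subst⊢ τ (≐E {φ = φ} {s = s} {t = t} d e) = subst (_ ⊢_) (sym (substF-[] τ φ t))
    (≐E {φ = substF (liftσ τ) φ} (subst⊢ τ d) (subst (_ ⊢_) (substF-[] τ φ s) (subst⊢ τ e)))

  -- Quantifier rules in which the eigenvariable is an arbitrary term of the metalanguage.

  fvC : List (Fm L) → ℕ
  fvC [] = 0
  fvC (φ ∷ Γ) = fv φ ⊔ fvC Γ

  -- Moves a derivation about the free variable `m` under a binder: `m` becomes the bound variable 0
  -- and all else is shifted. On formulas whose variables lie below `m` it is the plain shift that
  -- `∀I` and `∃E` ask for.
  unfresh : ℕ → Subst
  unfresh m i with i ≟ m
  ... | yes _ = var 0
  ... | no  _ = var (suc i)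

  unfresh-< : ∀ m i → i < m → unfresh m i ≡ var (suc i)
  unfresh-< m i p with i ≟ m
  ... | yes e = ⊥-elim (<⇒≢ p e)
  ... | no  _ = refl

  unfresh-≡ : ∀ m → unfresh m m ≡ var 0
  unfresh-≡ m with m ≟ m
  ... | yes e = refl
  ... | no  n = ⊥-elim (n refl)

  unfresh-shift : ∀ m φ → fv φ ≤ m → substF (unfresh m) φ ≡ shiftF φ
  unfresh-shift m φ p = substF-cong φ (λ i q → unfresh-< m i (≤-trans q p))

  unfresh-shiftC : ∀ m Γ → fvC Γ ≤ m → mapF (substF (unfresh m)) Γ ≡ mapF shiftF Γ
  unfresh-shiftC m [] p = refl
  unfresh-shiftC m (φ ∷ Γ) p = cong₂ _∷_ (unfresh-shift m φ (≤-trans (m≤m⊔n _ _) p))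
                                         (unfresh-shiftC m Γ (≤-trans (m≤n⊔m (fv φ) _) p))

  unfresh-[] : ∀ m φ → fv φ ≤ m → substF (unfresh m) (φ [ var m ]) ≡ φ
  unfresh-[] m φ p = trans (substF-comp (unfresh m) (sub0 (var m)) φ) (trans (substF-cong φ e) (substF-id φ))
    where
    e : ∀ i → i < fv φ → substT (unfresh m) (sub0 (var m) i) ≡ var i
    e zero q = unfresh-≡ m
    e (suc i) q = unfresh-< m i (≤-trans (≤-trans (n≤1+n _) q) p)

  -- Of the family of premises only the instance at `var m` is used, with `m` beyond the variables
  -- of `Γ` and `φ`. The stronger premise keeps eigenvariables and shifts out of all later proofs.
  ∀I-fresh : ∀ {Γ} (φ : Fm L) → (∀ t → Γ ⊢ φ [ t ]) → Γ ⊢ ∀' φ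
  ∀I-fresh {Γ} φ d = ∀I (subst₂ _⊢_ (unfresh-shiftC m Γ (m≤m⊔n _ _)) (unfresh-[] m φ (m≤n⊔m (fvC Γ) _)) (subst⊢ (unfresh m) (d (var m))))
    where
    m = fvC Γ ⊔ fv φ

  ∃E-fresh : ∀ {Γ} (φ : Fm L) {χ} → Γ ⊢ ∃' φ → (∀ t → φ [ t ] ∷ Γ ⊢ χ) → Γ ⊢ χ
  ∃E-fresh {Γ} φ {χ} e d = ∃E e
    (subst₂ _⊢_ (cong₂ _∷_ (unfresh-[] m φ (≤-trans (m≤n⊔m (fvC Γ) _) (m≤m⊔n _ _)))
                           (unfresh-shiftC m Γ (≤-trans (m≤m⊔n (fvC Γ) (fv φ)) (m≤m⊔n _ _))))
                (unfresh-shift m χ (m≤n⊔m (fvC Γ ⊔ fv φ) _))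
                (subst⊢ (unfresh m) (d (var m))))
    where
    m = fvC Γ ⊔ fv φ ⊔ fv χ

  -- Schematic formulas: k argument places, in which all substitutions commute with instantiation.

  record Pred (k : ℕ) : Set where
    field
      fm  : Vec (Term L) k → Fm L
      nat : ∀ τ ts → substF τ (fm ts) ≡ fm (substTs τ ts)
  open Pred public

  infixr 6 _∧ᴾ_
  infixr 5 _∨ᴾ_
  infixr 4 _⇒ᴾ_

  ⊥ᴾ : ∀ {k} → Pred k
  ⊥ᴾ = record { fm = λ _ → ⊥' ; nat = λ _ _ → refl }

  _∧ᴾ_ _∨ᴾ_ _⇒ᴾ_ : ∀ {k} → Pred k → Pred k → Pred k
  P ∧ᴾ Q = record { fm = λ ts → fm P ts ∧' fm Q ts ; nat = λ τ ts → cong₂ _∧'_ (nat P τ ts) (nat Q τ ts) }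
  P ∨ᴾ Q = record { fm = λ ts → fm P ts ∨' fm Q ts ; nat = λ τ ts → cong₂ _∨'_ (nat P τ ts) (nat Q τ ts) }
  P ⇒ᴾ Q = record { fm = λ ts → fm P ts ⇒' fm Q ts ; nat = λ τ ts → cong₂ _⇒'_ (nat P τ ts) (nat Q τ ts) }

  ¬ᴾ : ∀ {k} → Pred k → Pred k
  ¬ᴾ P = record { fm = λ ts → ¬' (fm P ts) ; nat = λ τ ts → cong ¬' (nat P τ ts) }

  nat-lift : ∀ {k} (P : Pred (suc k)) τ (ts : Vec (Term L) k)
           → substF (liftσ τ) (fm P (var 0 ∷ substTs shiftσ ts)) ≡ fm P (var 0 ∷ substTs shiftσ (substTs τ ts))
  nat-lift P τ ts = trans (nat P (liftσ τ) _)
    (cong (λ us → fm P (var 0 ∷ us)) (trans (substTs-comp (liftσ τ) shiftσ ts) (sym (substTs-comp shiftσ τ ts))))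

  ∀ᴾ ∃ᴾ : ∀ {k} → Pred (suc k) → Pred k
  ∀ᴾ P = record { fm = λ ts → ∀' (fm P (var 0 ∷ substTs shiftσ ts)) ; nat = λ τ ts → cong ∀' (nat-lift P τ ts) }
  ∃ᴾ P = record { fm = λ ts → ∃' (fm P (var 0 ∷ substTs shiftσ ts)) ; nat = λ τ ts → cong ∃' (nat-lift P τ ts) }

  -- The naturality proof is refl whenever g merely permutes its arguments.
  sub : ∀ {k m} → Pred m → (g : Vec (Term L) k → Vec (Term L) m) → (∀ τ ts → substTs τ (g ts) ≡ g (substTs τ ts)) → Pred k
  sub P g n = record { fm = λ ts → fm P (g ts) ; nat = λ τ ts → trans (nat P τ (g ts)) (cong (fm P) (n τ ts)) }

  -- The bound on the free variables is what yields `nat`: past its list `env` returns bare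
  -- variables, which `τ` would move although no argument changes there.
  formulaᴾ : ∀ k (φ : Fm L) → FreeBelow k φ → Pred k
  formulaᴾ k φ p = record { fm = λ ts → apply φ (toList ts)
                          ; nat = λ τ ts → trans (substF-comp τ _ φ) (substF-cong φ (λ i q → env-subst τ ts i (≤-trans q p))) }
    where
    env-subst : ∀ {k} τ (ts : Vec (Term L) k) i → i < k → substT τ (env (toList ts) i) ≡ env (toList (substTs τ ts)) i
    env-subst τ (t ∷ ts) zero q = refl
    env-subst τ (t ∷ ts) (suc i) (s≤s q) = env-subst τ ts i q

  nat-[] : ∀ {k} (P : Pred (suc k)) (ts : Vec (Term L) k) t → fm P (var 0 ∷ substTs shiftσ ts) [ t ] ≡ fm P (t ∷ ts)
  nat-[] P ts t = trans (nat P (sub0 t) _) (cong (λ us → fm P (t ∷ us)) (substTs-sub0-↑ t ts))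

  allI : ∀ {k Γ} (P : Pred (suc k)) {ts} → (∀ t → Γ ⊢ fm P (t ∷ ts)) → Γ ⊢ fm (∀ᴾ P) ts
  allI {Γ = Γ} P {ts} d = ∀I-fresh _ (λ t → subst (Γ ⊢_) (sym (nat-[] P ts t)) (d t))

  allE : ∀ {k Γ} (P : Pred (suc k)) {ts} → Γ ⊢ fm (∀ᴾ P) ts → ∀ t → Γ ⊢ fm P (t ∷ ts)
  allE {Γ = Γ} P {ts} d t = subst (Γ ⊢_) (nat-[] P ts t) (∀E t d)

  exI : ∀ {k Γ} (P : Pred (suc k)) {ts} t → Γ ⊢ fm P (t ∷ ts) → Γ ⊢ fm (∃ᴾ P) ts
  exI {Γ = Γ} P {ts} t d = ∃I t (subst (Γ ⊢_) (sym (nat-[] P ts t)) d)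

  hyp0 : ∀ {Γ} {φ : Fm L} → φ ∷ Γ ⊢ φ
  hyp0 = hyp (here refl)

  -- Continuation style: the witness is an arbitrary term of the metalanguage and its property
  -- arrives as a derivation. Each nested elimination adds one hypothesis, which the later uses of
  -- `w1`, `w2`, ... weaken past.
  exE : ∀ {k Γ} (P : Pred (suc k)) {ts χ} → Γ ⊢ fm (∃ᴾ P) ts
      → (∀ t → fm P (t ∷ ts) ∷ Γ ⊢ fm P (t ∷ ts) → fm P (t ∷ ts) ∷ Γ ⊢ χ) → Γ ⊢ χ
  exE {Γ = Γ} P {ts} {χ} d k = ∃E-fresh _ d (λ t → subst (λ φ → φ ∷ Γ ⊢ χ) (sym (nat-[] P ts t)) (k t hyp0))

  impI : ∀ {Γ} {φ ψ : Fm L} → (φ ∷ Γ ⊢ φ → φ ∷ Γ ⊢ ψ) → Γ ⊢ φ ⇒' ψ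
  impI k = ⇒I (k hyp0)

  negI : ∀ {Γ} {φ : Fm L} → (φ ∷ Γ ⊢ φ → φ ∷ Γ ⊢ ⊥') → Γ ⊢ ¬' φ
  negI k = ¬I (k hyp0)

  orE : ∀ {Γ} {φ ψ χ : Fm L} → Γ ⊢ φ ∨' ψ → (φ ∷ Γ ⊢ φ → φ ∷ Γ ⊢ χ) → (ψ ∷ Γ ⊢ ψ → ψ ∷ Γ ⊢ χ) → Γ ⊢ χ
  orE d k l = ∨E d (k hyp0) (l hyp0)

  em : ∀ {Γ} (φ : Fm L) → Γ ⊢ φ ∨' ¬' φ
  em φ = raa (¬E hyp0 (∨I₂ (¬I (¬E (hyp (there (here refl))) (∨I₁ hyp0)))))

  w1 : ∀ {Γ} {φ ψ : Fm L} → Γ ⊢ φ → ψ ∷ Γ ⊢ φ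
  w1 = wk there

  w2 : ∀ {Γ} {φ a b : Fm L} → Γ ⊢ φ → a ∷ b ∷ Γ ⊢ φ
  w2 = wk (there ∘ there)

  w3 : ∀ {Γ} {φ a b c : Fm L} → Γ ⊢ φ → a ∷ b ∷ c ∷ Γ ⊢ φ
  w3 = wk (there ∘ there ∘ there)

  w4 : ∀ {Γ} {φ a b c d : Fm L} → Γ ⊢ φ → a ∷ b ∷ c ∷ d ∷ Γ ⊢ φ
  w4 = wk (there ∘ there ∘ there ∘ there)

  w5 : ∀ {Γ} {φ a b c d e : Fm L} → Γ ⊢ φ → a ∷ b ∷ c ∷ d ∷ e ∷ Γ ⊢ φ
  w5 = wk (there ∘ there ∘ there ∘ there ∘ there)

  ≐-subst : ∀ {k Γ} (P : Pred (suc k)) {ts s t} → Γ ⊢ s ≐ t → Γ ⊢ fm P (s ∷ ts) → Γ ⊢ fm P (t ∷ ts)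
  ≐-subst {Γ = Γ} P {ts} {s} {t} e d =
    subst (Γ ⊢_) (nat-[] P ts t) (≐E {φ = fm P (var 0 ∷ substTs shiftσ ts)} e (subst (Γ ⊢_) (sym (nat-[] P ts s)) d))

pattern f0 = fz
pattern f1 = fs fz
pattern f2 = fs f1
pattern f3 = fs f2
pattern f4 = fs f3
pattern f5 = fs f4

module _ {L : Lang} where

  lookup-subst : ∀ {k} τ (ts : Vec (Term L) k) i → substT τ (lookup ts i) ≡ lookup (substTs τ ts) i
  lookup-subst τ (t ∷ ts) fz = refl
  lookup-subst τ (t ∷ ts) (fs i) = lookup-subst τ ts i

  at1 : ∀ {k} → Pred {L} 1 → Fin k → Pred k
  at1 P i = sub P (λ ts → lookup ts i ∷ []) (λ τ ts → cong (_∷ []) (lookup-subst τ ts i))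

  at2 : ∀ {k} → Pred {L} 2 → Fin k → Fin k → Pred k
  at2 P i j = sub P (λ ts → lookup ts i ∷ lookup ts j ∷ [])
    (λ τ ts → cong₂ (λ a b → a ∷ b ∷ []) (lookup-subst τ ts i) (lookup-subst τ ts j))

  at3 : ∀ {k} → Pred {L} 3 → Fin k → Fin k → Fin k → Pred k
  at3 P i j l = sub P (λ ts → lookup ts i ∷ lookup ts j ∷ lookup ts l ∷ [])
    (λ τ ts → cong₂ (λ a b → a ∷ b) (lookup-subst τ ts i) (cong₂ (λ a b → a ∷ b ∷ []) (lookup-subst τ ts j) (lookup-subst τ ts l)))

  eqᴾ : ∀ {k} → Fin k → Fin k → Pred {L} k
  eqᴾ i j = record { fm = λ ts → lookup ts i ≐ lookup ts j
                   ; nat = λ τ ts → cong₂ _≐_ (lookup-subst τ ts i) (lookup-subst τ ts j) }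

  infix 3 _⇔ᴾ_
  _⇔ᴾ_ : ∀ {k} → Pred {L} k → Pred k → Pred k
  P ⇔ᴾ Q = (P ⇒ᴾ Q) ∧ᴾ (Q ⇒ᴾ P)

-- Arithmetic inside the interpretation of Q: numerals, addition and order.

module Arith {L : Lang} (D : SeqData {L}) where
  open SeqAx D

  NP ZP : Pred {L} 1
  NP = formulaᴾ 1 (SeqData.N D) (SeqData.N-fv D)
  ZP = formulaᴾ 1 (SeqData.Z D) (SeqData.Z-fv D)
  EP SP : Pred {L} 2
  EP = formulaᴾ 2 (SeqData.E D) (SeqData.E-fv D)
  SP = formulaᴾ 2 (SeqData.S D) (SeqData.S-fv D)
  AP BP : Pred {L} 3
  AP = formulaᴾ 3 (SeqData.A D) (SeqData.A-fv D)
  BP = formulaᴾ 3 (SeqData.B D) (SeqData.B-fv D)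

  NN : ∀ {k} → Pred {L} (suc k)
  NN = at1 NP f0

  ∀ᴺ ∃ᴺ : ∀ {k} → Pred {L} (suc k) → Pred {L} k
  ∀ᴺ P = ∀ᴾ (NN ⇒ᴾ P)
  ∃ᴺ P = ∃ᴾ (NN ∧ᴾ P)

  -- Passed as an instance argument; `Base-cons` makes it follow every hypothesis that is added in
  -- the course of a proof.
  record Base (Γ : List (Fm L)) : Set where
    field
      wellDef : All (Γ ⊢_) WellDef
      robinson : All (Γ ⊢_) QAxioms
      sequence : Γ ⊢ SeqAxiom

  Base-wk : ∀ {Γ Δ} → Γ ⊆ᶜ Δ → Base Γ → Base Δ
  Base-wk s b = record { wellDef = All.map (wk s) (Base.wellDef b)
                       ; robinson = All.map (wk s) (Base.robinson b)
                       ; sequence = wk s (Base.sequence b) }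

  instance
    Base-cons : ∀ {Γ φ} → {{Base Γ}} → Base (φ ∷ Γ)
    Base-cons {{b}} = Base-wk there b

  app : ∀ {k Γ} (P : Pred {L} (suc k)) ts → Γ ⊢ fm (∀ᴺ P) ts → ∀ {x} → Γ ⊢ N[ x ] → Γ ⊢ fm P (x ∷ ts)
  app P ts d {x} nx = ⇒E (allE (NN ⇒ᴾ P) d x) nx

  app1 : ∀ {Γ} (P : Pred {L} 1) → Γ ⊢ fm (∀ᴺ P) [] → ∀ {x} → Γ ⊢ N[ x ] → Γ ⊢ fm P (x ∷ [])
  app1 P d nx = app P [] d nx

  app2 : ∀ {Γ} (P : Pred {L} 2) → Γ ⊢ fm (∀ᴺ (∀ᴺ P)) [] → ∀ {x y} → Γ ⊢ N[ x ] → Γ ⊢ N[ y ] → Γ ⊢ fm P (y ∷ x ∷ [])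
  app2 P d {x} nx ny = app P (x ∷ []) (app1 (∀ᴺ P) d nx) ny

  app3 : ∀ {Γ} (P : Pred {L} 3) → Γ ⊢ fm (∀ᴺ (∀ᴺ (∀ᴺ P))) []
       → ∀ {x y z} → Γ ⊢ N[ x ] → Γ ⊢ N[ y ] → Γ ⊢ N[ z ] → Γ ⊢ fm P (z ∷ y ∷ x ∷ [])
  app3 P d {x} {y} nx ny nz = app P (y ∷ x ∷ []) (app2 (∀ᴺ P) d nx ny) nz

  app4 : ∀ {Γ} (P : Pred {L} 4) → Γ ⊢ fm (∀ᴺ (∀ᴺ (∀ᴺ (∀ᴺ P)))) []
       → ∀ {x y z u} → Γ ⊢ N[ x ] → Γ ⊢ N[ y ] → Γ ⊢ N[ z ] → Γ ⊢ N[ u ] → Γ ⊢ fm P (u ∷ z ∷ y ∷ x ∷ [])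
  app4 P d {x} {y} {z} nx ny nz nu = app P (z ∷ y ∷ x ∷ []) (app3 (∀ᴺ P) d nx ny nz) nu

  module _ {Γ : List (Fm L)} {{b : Base Γ}} where
    private
      wd = Base.wellDef b
      qa = Base.robinson b

    axiom : ∀ {Δ : List (Fm L)} → All (Γ ⊢_) Δ → ∀ i → Γ ⊢ Data.List.lookup Δ i
    axiom a i = All.lookup a (∈-lookup i)

    E-refl : ∀ {x} → Γ ⊢ N[ x ] → Γ ⊢ E[ x , x ]
    E-refl = app1 (at2 EP f0 f0) (axiom wd (# 0))

    E-sym : ∀ {x y} → Γ ⊢ N[ x ] → Γ ⊢ N[ y ] → Γ ⊢ E[ x , y ] → Γ ⊢ E[ y , x ]
    E-sym nx ny = ⇒E (app2 (at2 EP f1 f0 ⇒ᴾ at2 EP f0 f1) (axiom wd (# 1)) nx ny)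

    E-trans : ∀ {x y z} → Γ ⊢ N[ x ] → Γ ⊢ N[ y ] → Γ ⊢ N[ z ] → Γ ⊢ E[ x , y ] → Γ ⊢ E[ y , z ] → Γ ⊢ E[ x , z ]
    E-trans nx ny nz d e = ⇒E (app3 (at2 EP f2 f1 ∧ᴾ at2 EP f1 f0 ⇒ᴾ at2 EP f2 f0) (axiom wd (# 2)) nx ny nz) (∧I d e)

    zeroE : ∀ {χ} → (∀ z → N[ z ] ∧' Z[ z ] ∷ Γ ⊢ N[ z ] ∧' Z[ z ] → N[ z ] ∧' Z[ z ] ∷ Γ ⊢ χ) → Γ ⊢ χ
    zeroE = exE (NN ∧ᴾ at1 ZP f0) {[]} (axiom wd (# 3))

    succE : ∀ {x χ} → Γ ⊢ N[ x ] → (∀ y → N[ y ] ∧' S[ x , y ] ∷ Γ ⊢ N[ y ] ∧' S[ x , y ] → N[ y ] ∧' S[ x , y ] ∷ Γ ⊢ χ) → Γ ⊢ χ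
    succE {x} nx = exE (NN ∧ᴾ at2 SP f1 f0) {x ∷ []} (app1 (∃ᴺ (at2 SP f1 f0)) (axiom wd (# 4)) nx)

    addE : ∀ {x y χ} → Γ ⊢ N[ x ] → Γ ⊢ N[ y ]
         → (∀ z → N[ z ] ∧' A[ x , y , z ] ∷ Γ ⊢ N[ z ] ∧' A[ x , y , z ] → N[ z ] ∧' A[ x , y , z ] ∷ Γ ⊢ χ) → Γ ⊢ χ
    addE {x} {y} nx ny = exE (NN ∧ᴾ at3 AP f2 f1 f0) {y ∷ x ∷ []} (app2 (∃ᴺ (at3 AP f2 f1 f0)) (axiom wd (# 5)) nx ny)

    Z-uniq : ∀ {x y} → Γ ⊢ N[ x ] → Γ ⊢ N[ y ] → Γ ⊢ Z[ x ] → Γ ⊢ Z[ y ] → Γ ⊢ E[ x , y ]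
    Z-uniq nx ny d e = ⇒E (app2 (at1 ZP f1 ∧ᴾ at1 ZP f0 ⇒ᴾ at2 EP f1 f0)
      (axiom wd (# 7)) nx ny) (∧I d e)

    S-fun : ∀ {x y z} → Γ ⊢ N[ x ] → Γ ⊢ N[ y ] → Γ ⊢ N[ z ] → Γ ⊢ S[ x , y ] → Γ ⊢ S[ x , z ] → Γ ⊢ E[ y , z ]
    S-fun nx ny nz d e = ⇒E (app3 (at2 SP f2 f1 ∧ᴾ at2 SP f2 f0 ⇒ᴾ at2 EP f1 f0)
      (axiom wd (# 8)) nx ny nz) (∧I d e)

    Z-cong : ∀ {x y} → Γ ⊢ N[ x ] → Γ ⊢ N[ y ] → Γ ⊢ Z[ x ] → Γ ⊢ E[ x , y ] → Γ ⊢ Z[ y ]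
    Z-cong nx ny d e = ⇒E (app2 (at1 ZP f1 ∧ᴾ at2 EP f1 f0 ⇒ᴾ at1 ZP f0)
      (axiom wd (# 11)) nx ny) (∧I d e)

    S-cong : ∀ {x y x' y'} → Γ ⊢ N[ x ] → Γ ⊢ N[ y ] → Γ ⊢ N[ x' ] → Γ ⊢ N[ y' ]
           → Γ ⊢ S[ x , y ] → Γ ⊢ E[ x , x' ] → Γ ⊢ E[ y , y' ] → Γ ⊢ S[ x' , y' ]
    S-cong nx ny nx' ny' d e f = ⇒E (app4 (at2 SP f3 f2 ∧ᴾ at2 EP f3 f1 ∧ᴾ at2 EP f2 f0 ⇒ᴾ at2 SP f1 f0)
      (axiom wd (# 12)) nx ny nx' ny')
      (∧I d (∧I e f))

    A-cong : ∀ {x y z z'} → Γ ⊢ N[ x ] → Γ ⊢ N[ y ] → Γ ⊢ N[ z ] → Γ ⊢ N[ z' ]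
           → Γ ⊢ A[ x , y , z ] → Γ ⊢ E[ z , z' ] → Γ ⊢ A[ x , y , z' ]
    A-cong {x} {y} {z} nx ny nz nz' d e = ⇒E (app P (y ∷ x ∷ z ∷ y ∷ x ∷ []) (app (∀ᴺ P) (x ∷ z ∷ y ∷ x ∷ []) (app4 (∀ᴺ (∀ᴺ P))
      (axiom wd (# 13))
      nx ny nz nx) ny) nz') (∧I d (∧I (E-refl nx) (∧I (E-refl ny) e)))
      where
      P : Pred {L} 6
      P = at3 AP f5 f4 f3 ∧ᴾ at2 EP f5 f2 ∧ᴾ at2 EP f4 f1 ∧ᴾ at2 EP f3 f0 ⇒ᴾ at3 AP f2 f1 f0

    S≢Z : ∀ {x y z} → Γ ⊢ N[ x ] → Γ ⊢ N[ y ] → Γ ⊢ N[ z ] → Γ ⊢ S[ x , y ] → Γ ⊢ Z[ z ] → Γ ⊢ E[ y , z ] → Γ ⊢ ⊥'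
    S≢Z nx ny nz d e f = ¬E (⇒E (app3 (at2 SP f2 f1 ∧ᴾ at1 ZP f0 ⇒ᴾ ¬ᴾ (at2 EP f1 f0)) (axiom qa (# 0)) nx ny nz) (∧I d e)) f

    S-inj : ∀ {x y x' y'} → Γ ⊢ N[ x ] → Γ ⊢ N[ y ] → Γ ⊢ N[ x' ] → Γ ⊢ N[ y' ]
          → Γ ⊢ S[ x , x' ] → Γ ⊢ S[ y , y' ] → Γ ⊢ E[ x' , y' ] → Γ ⊢ E[ x , y ]
    S-inj nx ny nx' ny' d e f = ⇒E (app4 (at2 SP f3 f1 ∧ᴾ at2 SP f2 f0 ∧ᴾ at2 EP f1 f0 ⇒ᴾ at2 EP f3 f2) (axiom qa (# 1)) nx ny nx' ny')
      (∧I d (∧I e f))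

    predE : ∀ {x χ} → Γ ⊢ N[ x ] → (Z[ x ] ∷ Γ ⊢ Z[ x ] → Z[ x ] ∷ Γ ⊢ χ)
          → (∀ y → N[ y ] ∧' S[ y , x ] ∷ Γ ⊢ N[ y ] ∧' S[ y , x ] → N[ y ] ∧' S[ y , x ] ∷ Γ ⊢ χ) → Γ ⊢ χ
    predE {x} nx k l = orE (app1 (at1 ZP f0 ∨ᴾ ∃ᴺ (at2 SP f0 f1)) (axiom qa (# 2)) nx) k
      (λ h → exE (NN ∧ᴾ at2 SP f0 f1) {x ∷ []} h (λ y g → wk (⊆ᶜ-cons there) (l y hyp0)))

    add-zero : ∀ {x y z} → Γ ⊢ N[ x ] → Γ ⊢ N[ y ] → Γ ⊢ N[ z ] → Γ ⊢ Z[ y ] → Γ ⊢ A[ x , y , z ] → Γ ⊢ E[ z , x ]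
    add-zero nx ny nz d e = ⇒E (app3 (at1 ZP f1 ∧ᴾ at3 AP f2 f1 f0 ⇒ᴾ at2 EP f0 f2) (axiom qa (# 3)) nx ny nz) (∧I d e)

    add-suc : ∀ {x y y' z' z} → Γ ⊢ N[ x ] → Γ ⊢ N[ y ] → Γ ⊢ N[ y' ] → Γ ⊢ N[ z' ] → Γ ⊢ N[ z ]
            → Γ ⊢ S[ y , y' ] → Γ ⊢ A[ x , y' , z' ] → Γ ⊢ A[ x , y , z ] → Γ ⊢ S[ z , z' ]
    add-suc {x} {y} {y'} {z'} nx ny ny' nz' nz d e f = ⇒E (app P (z' ∷ y' ∷ y ∷ x ∷ []) (app4 (∀ᴺ P) (axiom qa (# 4)) nx ny ny' nz') nz) (∧I d (∧I e f))
      where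
      P : Pred {L} 5
      P = at2 SP f3 f2 ∧ᴾ at3 AP f4 f2 f1 ∧ᴾ at3 AP f4 f3 f0 ⇒ᴾ at2 SP f0 f1

  -- Numerals.  Interpreted equality need not be equality, so a numeral is a description, not a term.

  mutual
    Num : ℕ → Pred {L} 1
    Num zero = NN ∧ᴾ at1 ZP f0
    Num (suc n) = NN ∧ᴾ ∃ᴾ (NumStep n)

    NumStep : ℕ → Pred {L} 2
    NumStep n = at1 (Num n) f0 ∧ᴾ at2 SP f0 f1

  num : ℕ → Term L → Fm L
  num n x = fm (Num n) (x ∷ [])

  num-N : ∀ {Γ} n {x} → Γ ⊢ num n x → Γ ⊢ N[ x ]
  num-N zero d = ∧E₁ d
  num-N (suc n) d = ∧E₁ d

  num-pred : ∀ {Γ} n {x χ} → Γ ⊢ num (suc n) x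
           → (∀ y → num n y ∧' S[ y , x ] ∷ Γ ⊢ num n y ∧' S[ y , x ] → num n y ∧' S[ y , x ] ∷ Γ ⊢ χ) → Γ ⊢ χ
  num-pred n {x} d k = exE (NumStep n) {x ∷ []} (∧E₂ d) k

  num-suc : ∀ {Γ} n {x y} → Γ ⊢ num n y → Γ ⊢ N[ x ] → Γ ⊢ S[ y , x ] → Γ ⊢ num (suc n) x
  num-suc n {x} {y} d nx s = ∧I nx (exI (NumStep n) {x ∷ []} y (∧I d s))

  num-cong : ∀ {Γ} {{b : Base Γ}} n {x y} → Γ ⊢ num n x → Γ ⊢ N[ y ] → Γ ⊢ E[ x , y ] → Γ ⊢ num n y
  num-cong zero d ny e = ∧I ny (Z-cong (∧E₁ d) ny (∧E₂ d) e)
  num-cong (suc n) {x} {y} d ny e = num-pred n d (λ z h →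
    num-suc n (∧E₁ h) (w1 ny) (S-cong (num-N n (∧E₁ h)) (w1 (∧E₁ d)) (num-N n (∧E₁ h)) (w1 ny) (∧E₂ h) (E-refl (num-N n (∧E₁ h))) (w1 e)))

  num-uniq : ∀ {Γ} {{b : Base Γ}} n {x y} → Γ ⊢ num n x → Γ ⊢ num n y → Γ ⊢ E[ x , y ]
  num-uniq zero d e = Z-uniq (∧E₁ d) (∧E₁ e) (∧E₂ d) (∧E₂ e)
  num-uniq (suc n) {x} {y} d e = num-pred n d (λ x' h → num-pred n (w1 e) (λ y' g →
    let nx' = num-N n (w1 (∧E₁ h)) ; ny' = num-N n (∧E₁ g) ; nx = w2 (∧E₁ d) ; ny = w2 (∧E₁ e) in
    S-fun ny' nx ny (S-cong nx' nx ny' nx (w1 (∧E₂ h)) (num-uniq n (w1 (∧E₁ h)) (∧E₁ g)) (E-refl nx)) (∧E₂ g)))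

  num-disj : ∀ {Γ} {{b : Base Γ}} n m {x} → ¬ n ≡ m → Γ ⊢ num n x → Γ ⊢ num m x → Γ ⊢ ⊥'
  num-disj zero zero p d e = ⊥-elim (p refl)
  num-disj zero (suc m) p d e = num-pred m e (λ y h →
    S≢Z (num-N m (∧E₁ h)) (w1 (∧E₁ e)) (w1 (∧E₁ d)) (∧E₂ h) (w1 (∧E₂ d)) (E-refl (w1 (∧E₁ e))))
  num-disj (suc n) zero p d e = num-disj zero (suc n) (λ q → p (sym q)) e d
  num-disj (suc n) (suc m) p d e = num-pred n d (λ y h → num-pred m (w1 e) (λ z g →
    let ny = num-N n (w1 (∧E₁ h)) ; nz = num-N m (∧E₁ g) ; nx = w2 (∧E₁ d) in
    num-disj n m (λ q → p (cong suc q))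
      (num-cong n (w1 (∧E₁ h)) nz (S-inj ny nz nx nx (w1 (∧E₂ h)) (∧E₂ g) (E-refl nx))) (∧E₁ g)))

  Numeral : ℕ → Fm L
  Numeral n = fm (∃ᴾ (Num n)) []

  numeral : ∀ {Γ} {{b : Base Γ}} n → Γ ⊢ Numeral n
  numeral zero = zeroE (λ z h → exI (Num 0) {[]} z h)
  numeral (suc n) = exE (Num n) {[]} (numeral n) (λ y h → succE (num-N n h) (λ x g →
    exI (Num (suc n)) {[]} x (num-suc n (w1 h) (∧E₁ g) (∧E₂ g))))

  numeralE : ∀ {Γ} {{b : Base Γ}} n {χ} → (∀ t → num n t ∷ Γ ⊢ num n t → num n t ∷ Γ ⊢ χ) → Γ ⊢ χ
  numeralE n k = exE (Num n) {[]} (numeral n) k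

  LeP LtP : Pred {L} 2
  LeP = ∃ᴾ (NN ∧ᴾ at3 AP f0 f1 f2)
  LtP = LeP ∧ᴾ ¬ᴾ EP

  -- Bounded quantifiers of the theory are eliminated through this finite disjunction: `belowE`
  -- leaves one case for each standard number.
  Below : ℕ → Pred {L} 1
  Below zero = ⊥ᴾ
  Below (suc n) = Below n ∨ᴾ Num n

  below : ℕ → Term L → Fm L
  below n x = fm (Below n) (x ∷ [])

  belowE : ∀ {Γ} n {x χ} → Γ ⊢ below n x → (∀ m → m < n → num m x ∷ Γ ⊢ num m x → num m x ∷ Γ ⊢ χ) → Γ ⊢ χ
  belowE zero d k = ⊥E d
  belowE (suc n) d k = orE d (λ h → belowE n h (λ m p g → wk (⊆ᶜ-cons there) (k m (m<n⇒m<1+n p) hyp0))) (λ h → k n ≤-refl h)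

  belowI : ∀ {Γ} n m {x} → m < n → Γ ⊢ num m x → Γ ⊢ below n x
  belowI (suc n) m p d with m ≟ n
  ... | yes refl = ∨I₂ d
  ... | no q = ∨I₁ (belowI n m (≤∧≢⇒< (≤-pred p) q) d)

  A-succ : ∀ {Γ} {{b : Base Γ}} {z x y x' y'} → Γ ⊢ N[ z ] → Γ ⊢ N[ x ] → Γ ⊢ N[ y ] → Γ ⊢ N[ x' ] → Γ ⊢ N[ y' ]
         → Γ ⊢ A[ z , x' , y' ] → Γ ⊢ S[ x' , x ] → Γ ⊢ S[ y' , y ] → Γ ⊢ A[ z , x , y ]
  A-succ nz nx ny nx' ny' a sx sy = addE nz nx (λ u h →
    A-cong (w1 nz) (w1 nx) (∧E₁ h) (w1 ny) (∧E₂ h)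
      (S-fun (w1 ny') (∧E₁ h) (w1 ny)
        (add-suc (w1 nz) (w1 nx') (w1 nx) (∧E₁ h) (w1 ny') (w1 sx) (∧E₂ h) (w1 a)) (w1 sy)))

  A-zero : ∀ {Γ} {{b : Base Γ}} {z x y} → Γ ⊢ N[ z ] → Γ ⊢ N[ x ] → Γ ⊢ N[ y ]
         → Γ ⊢ Z[ x ] → Γ ⊢ E[ z , y ] → Γ ⊢ A[ z , x , y ]
  A-zero nz nx ny d e = addE nz nx (λ u h →
    A-cong (w1 nz) (w1 nx) (∧E₁ h) (w1 ny) (∧E₂ h)
      (E-trans (∧E₁ h) (w1 nz) (w1 ny) (add-zero (w1 nz) (w1 nx) (∧E₁ h) (w1 d) (∧E₂ h)) (w1 e)))

  -- The induction follows the second summand, the argument on which Q4 and Q5 recurse.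
  A-num : ∀ {Γ} {{b : Base Γ}} a m {z x y} → Γ ⊢ num a z → Γ ⊢ num m x → Γ ⊢ num (m + a) y → Γ ⊢ A[ z , x , y ]
  A-num a zero dz dx dy = A-zero (num-N a dz) (∧E₁ dx) (num-N a dy) (∧E₂ dx) (num-uniq a dz dy)
  A-num a (suc m) {z} {x} {y} dz dx dy = num-pred m dx (λ x' h → num-pred (m + a) (w1 dy) (λ y' g →
    A-succ (num-N a (w2 dz)) (w2 (∧E₁ dx)) (w2 (∧E₁ dy)) (num-N m (w1 (∧E₁ h))) (num-N (m + a) (∧E₁ g))
      (A-num a m (w2 dz) (w1 (∧E₁ h)) (∧E₁ g)) (w1 (∧E₂ h)) (∧E₂ g)))

  leI : ∀ {Γ z x y} → Γ ⊢ N[ z ] → Γ ⊢ A[ z , x , y ] → Γ ⊢ Le x y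
  leI {z = z} {x} {y} nz d = exI (NN ∧ᴾ at3 AP f0 f1 f2) {x ∷ y ∷ []} z (∧I nz d)

  leE : ∀ {Γ x y χ} → Γ ⊢ Le x y → (∀ z → N[ z ] ∧' A[ z , x , y ] ∷ Γ ⊢ N[ z ] ∧' A[ z , x , y ] → N[ z ] ∧' A[ z , x , y ] ∷ Γ ⊢ χ) → Γ ⊢ χ
  leE {x = x} {y} = exE (NN ∧ᴾ at3 AP f0 f1 f2) {x ∷ y ∷ []}

  le-num : ∀ {Γ} {{b : Base Γ}} {m n x y} → m ≤ n → Γ ⊢ num m x → Γ ⊢ num n y → Γ ⊢ Le x y
  le-num {m = m} {n} {x} {y} p dx dy = numeralE (n ∸ m) (λ z h →
    leI (num-N (n ∸ m) h) (A-num (n ∸ m) m h (w1 dx) (w1 (subst (λ k → _ ⊢ num k y) (sym (m+[n∸m]≡n p)) dy))))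

  lt-num : ∀ {Γ} {{b : Base Γ}} {m n x y} → m < n → Γ ⊢ num m x → Γ ⊢ num n y → Γ ⊢ Lt x y
  lt-num {m = m} {n} p dx dy = ∧I (le-num (<⇒≤ p) dx dy)
    (negI (λ h → num-disj m n (<⇒≢ p) (w1 dx) (num-cong n (w1 dy) (num-N m (w1 dx)) (E-sym (num-N m (w1 dx)) (num-N n (w1 dy)) h))))

  -- The recursion is on the standard `n`. Q3 gives a nonzero `x` a predecessor `x'`; if `z + x = y`
  -- and `u = z + x'`, then Q5 makes `y` the successor of `u`, and the claim reduces to `x'` and `u`
  -- with a smaller numeral.
  le-below : ∀ {Γ} {{b : Base Γ}} n {x y} → Γ ⊢ N[ x ] → Γ ⊢ Le x y → Γ ⊢ num n y → Γ ⊢ below (suc n) x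
  le-below n {x} {y} nx d dy = predE nx (λ h → belowI (suc n) 0 (s≤s z≤n) (∧I (w1 nx) h)) (λ x' h →
    leE (w1 d) (λ z g → addE (∧E₁ g) (w1 (∧E₁ h)) (λ u f →
      let nx' = w2 (∧E₁ h) ; nz = w1 (∧E₁ g) ; ny = w3 (num-N n dy) ; nu = ∧E₁ f
          su = add-suc nz nx' (w3 nx) ny nu (w2 (∧E₂ h)) (w1 (∧E₂ g)) (∧E₂ f) in
      step n (w3 nx) nx' nu ny (w2 (∧E₂ h)) su (leI nz (∧E₂ f)) (w3 dy))))
    where
    step : ∀ {Γ} {{b : Base Γ}} n {x y x' u} → Γ ⊢ N[ x ] → Γ ⊢ N[ x' ] → Γ ⊢ N[ u ] → Γ ⊢ N[ y ] → Γ ⊢ S[ x' , x ] → Γ ⊢ S[ u , y ]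
         → Γ ⊢ Le x' u → Γ ⊢ num n y → Γ ⊢ below (suc n) x
    step zero nx nx' nu ny sx su l dy = ⊥E (S≢Z nu ny ny su (∧E₂ dy) (E-refl ny))
    step (suc n) {x} {y} {x'} {u} nx nx' nu ny sx su l dy = num-pred n dy (λ y' h →
      let ny' = num-N n (∧E₁ h) ; nu₁ = w1 nu ; ny₁ = w1 ny in
      belowE (suc n) (le-below n (w1 nx') (w1 l)
          (num-cong n (∧E₁ h) nu₁ (S-inj ny' nu₁ ny₁ ny₁ (∧E₂ h) (w1 su) (E-refl ny₁))))
        (λ m p g → belowI (suc (suc n)) (suc m) (s≤s p) (num-suc m g (w2 nx) (w2 sx))))

  lt-below : ∀ {Γ} {{b : Base Γ}} n {x y} → Γ ⊢ N[ x ] → Γ ⊢ Lt x y → Γ ⊢ num n y → Γ ⊢ below n x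
  lt-below n nx d dy = orE (le-below n nx (∧E₁ d) dy) (λ h → h)
    (λ h → ⊥E (¬E (w1 (∧E₂ d)) (num-uniq n h (w1 dy))))

  -- Q does not prove its order linear, but comparison with a standard numeral succeeds by recursion
  -- on that numeral. The element `x` stays arbitrary; in the Rosser argument it is an unknown
  -- proof.
  le-total : ∀ {Γ} {{b : Base Γ}} n {x y} → Γ ⊢ N[ x ] → Γ ⊢ num n y → Γ ⊢ Le x y ∨' Le y x
  le-total zero nx dy = ∨I₂ (leI nx (A-zero nx (∧E₁ dy) nx (∧E₂ dy) (E-refl nx)))
  le-total (suc n) {x} {y} nx dy = predE nx (λ h → ∨I₁ (le-num {m = 0} {suc n} z≤n (∧I (w1 nx) h) (w1 dy))) (λ x' h →
    num-pred n (w1 dy) (λ y' g →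
      let nx' = w1 (∧E₁ h) ; sx = w1 (∧E₂ h) ; ny' = num-N n (∧E₁ g) ; sy = ∧E₂ g ; nx₂ = w2 nx ; ny₂ = w2 (∧E₁ dy) in
      orE (le-total n nx' (∧E₁ g))
        (λ l → ∨I₁ (leE l (λ z k → leI (∧E₁ k) (A-succ (∧E₁ k) (w2 nx₂) (w2 ny₂) (w2 nx') (w2 ny') (∧E₂ k) (w2 sx) (w2 sy)))))
        (λ l → ∨I₂ (leE l (λ z k → leI (∧E₁ k) (A-succ (∧E₁ k) (w2 ny₂) (w2 nx₂) (w2 ny') (w2 nx') (∧E₂ k) (w2 sy) (w2 sx)))))))

dropⱽ : ∀ {A : Set} m {k} → Vec A (m + k) → Vec A k
dropⱽ zero v = v
dropⱽ (suc m) (x ∷ v) = dropⱽ m v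

takeⱽ : ∀ {A : Set} m {k} → Vec A (m + k) → Vec A m
takeⱽ zero v = []
takeⱽ (suc m) (x ∷ v) = x ∷ takeⱽ m v

dropⱽ-++ : ∀ {A : Set} {m k} (u : Vec A m) (v : Vec A k) → dropⱽ m (u ++ⱽ v) ≡ v
dropⱽ-++ [] v = refl
dropⱽ-++ (x ∷ u) v = dropⱽ-++ u v

takeⱽ-++ : ∀ {A : Set} {m k} (u : Vec A m) (v : Vec A k) → takeⱽ m (u ++ⱽ v) ≡ u
takeⱽ-++ [] v = refl
takeⱽ-++ (x ∷ u) v = cong (x ∷_) (takeⱽ-++ u v)

module _ {L : Lang} where

  subst-dropⱽ : ∀ m {k} τ (v : Vec (Term L) (m + k)) → substTs τ (dropⱽ m v) ≡ dropⱽ m (substTs τ v)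
  subst-dropⱽ zero τ v = refl
  subst-dropⱽ (suc m) τ (x ∷ v) = subst-dropⱽ m τ v

  subst-takeⱽ : ∀ m {k} τ (v : Vec (Term L) (m + k)) → substTs τ (takeⱽ m v) ≡ takeⱽ m (substTs τ v)
  subst-takeⱽ zero τ v = refl
  subst-takeⱽ (suc m) τ (x ∷ v) = cong (substT τ x ∷_) (subst-takeⱽ m τ v)

  subst-head : ∀ {k} τ (v : Vec (Term L) (suc k)) → substT τ (head v) ≡ head (substTs τ v)
  subst-head τ (x ∷ v) = refl

  subst-tail : ∀ {k} τ (v : Vec (Term L) (suc k)) → substTs τ (tail v) ≡ tail (substTs τ v)
  subst-tail τ (x ∷ v) = refl

-- Sequences of the theory and the representation of computations.

module Sequences {L : Lang} (D : SeqData {L}) where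
  open SeqAx D
  open Arith D

  -- The matrix of `SeqAxiom` with its arguments in de Bruijn order, so that `extE` can instantiate
  -- the axiom without any rewriting.
  ExtB : Pred {L} 6
  ExtB = at1 NP f3 ∧ᴾ at2 LeP f1 f3 ⇒ᴾ (at3 BP f0 f1 f2 ⇔ᴾ ((at2 LtP f1 f3 ∧ᴾ at3 BP f0 f1 f5) ∨ᴾ (at2 EP f1 f3 ∧ᴾ eqᴾ f0 f4)))

  abstract
    ExtP : Pred {L} 4
    ExtP = ∀ᴾ (∀ᴾ ExtB)

  -- The sequence w' extends w, cut off at k, by the value x at k.
  ext : Term L → Term L → Term L → Term L → Fm L
  ext w' k x w = fm ExtP (w' ∷ k ∷ x ∷ w ∷ [])

  abstract
    extE : ∀ {Γ} {{b : Base Γ}} w x k {χ} → (∀ w' → ext w' k x w ∷ Γ ⊢ ext w' k x w → ext w' k x w ∷ Γ ⊢ χ) → Γ ⊢ χ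
    extE {{b}} w x k = exE ExtP {k ∷ x ∷ w ∷ []}
      (allE (∃ᴾ ExtP) {x ∷ w ∷ []} (allE (∀ᴾ (∃ᴾ ExtP)) {w ∷ []} (allE (∀ᴾ (∀ᴾ (∃ᴾ ExtP))) {[]} (Base.sequence b) w) x) k)

    ext-at : ∀ {Γ w' k x w} → Γ ⊢ ext w' k x w → ∀ i y → Γ ⊢ fm ExtB (y ∷ i ∷ w' ∷ k ∷ x ∷ w ∷ [])
    ext-at {w' = w'} {k} {x} {w} d i y = allE ExtB {i ∷ w' ∷ k ∷ x ∷ w ∷ []} (allE (∀ᴾ ExtB) {w' ∷ k ∷ x ∷ w ∷ []} d i) y

  -- β need not respect interpreted equality in its index, so an entry at `n` has to be fixed at all
  -- representatives of `n` together. The value, in contrast, is compared by genuine equality, as in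
  -- the sequence axiom.
  EntryB : ℕ → Pred {L} 4
  EntryB n = at1 (Num n) f1 ⇒ᴾ (at3 BP f0 f1 f2 ⇔ᴾ eqᴾ f0 f3)

  abstract
    EntryP : ℕ → Pred {L} 2
    EntryP n = ∀ᴾ (∀ᴾ (EntryB n))

  -- x is the unique element of the sequence w at every representative of n.
  entry : ℕ → Term L → Term L → Fm L
  entry n w x = fm (EntryP n) (w ∷ x ∷ [])

  abstract
    entry-at : ∀ {Γ} n {w x i} y → Γ ⊢ entry n w x → Γ ⊢ num n i → Γ ⊢ B[ y , i , w ] ⇔' (y ≐ x)
    entry-at n {w} {x} {i} y d di = ⇒E (allE (EntryB n) {i ∷ w ∷ x ∷ []} (allE (∀ᴾ (EntryB n)) {w ∷ x ∷ []} d i) y) di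

    entryI : ∀ {Γ} n {w x} → (∀ i y → num n i ∷ Γ ⊢ num n i → num n i ∷ Γ ⊢ B[ y , i , w ] ⇔' (y ≐ x)) → Γ ⊢ entry n w x
    entryI n {w} {x} k = allI (∀ᴾ (EntryB n)) {w ∷ x ∷ []} (λ i → allI (EntryB n) {i ∷ w ∷ x ∷ []} (λ y → impI (k i y)))

  entry-out : ∀ {Γ} n {w x i y} → Γ ⊢ entry n w x → Γ ⊢ num n i → Γ ⊢ B[ y , i , w ] → Γ ⊢ y ≐ x
  entry-out n {y = y} d di e = ⇒E (∧E₁ (entry-at n y d di)) e

  entry-in : ∀ {Γ} n {w x i} → Γ ⊢ entry n w x → Γ ⊢ num n i → Γ ⊢ B[ x , i , w ]
  entry-in n {x = x} d di = ⇒E (∧E₂ (entry-at n x d di)) (≐refl x)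

  ext-new : ∀ {Γ} {{b : Base Γ}} n {w' k x w} → Γ ⊢ num n k → Γ ⊢ ext w' k x w → Γ ⊢ entry n w' x
  ext-new n {w'} {k} {x} {w} dk d = entryI n (λ i y h →
    let q = ⇒E (ext-at (w1 d) i y) (∧I (num-N n (w1 dk)) (le-num {m = n} {n} {i} {k} ≤-refl h (w1 dk)))
        eq = num-uniq n h (w1 dk) in
    ∧I (impI (λ g → orE (⇒E (∧E₁ (w1 q)) g) (λ l → ⊥E (¬E (∧E₂ (∧E₁ l)) (w2 eq))) ∧E₂))
       (impI (λ g → ⇒E (∧E₂ (w1 q)) (∨I₂ (∧I (w1 eq) g)))))

  ext-old : ∀ {Γ} {{b : Base Γ}} m n {w' k x w z} → m < n → Γ ⊢ num n k → Γ ⊢ ext w' k x w → Γ ⊢ entry m w z → Γ ⊢ entry m w' z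
  ext-old m n {w'} {k} {x} {w} {z} p dk d e = entryI m (λ i y h →
    let q = ⇒E (ext-at (w1 d) i y) (∧I (num-N n (w1 dk)) (le-num (<⇒≤ p) h (w1 dk)))
        lt = lt-num p h (w1 dk)
        r = entry-at m y (w1 e) h in
    ∧I (impI (λ g → orE (⇒E (∧E₁ (w1 q)) g) (λ l → ⇒E (∧E₁ (w2 r)) (∧E₂ l)) (λ l → ⊥E (¬E (∧E₂ (w2 lt)) (∧E₁ l)))))
       (impI (λ g → ⇒E (∧E₂ (w1 q)) (∨I₁ (∧I (w1 lt) (⇒E (∧E₂ (w1 r)) g))))))

  TraceE : (ℕ → ℕ) → ℕ → Pred {L} 2
  TraceE v n = at1 (Num (v n)) f0 ∧ᴾ at2 (EntryP n) f1 f0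

  TraceP : (ℕ → ℕ) → ℕ → Pred {L} 1
  TraceP v zero = ∃ᴾ (TraceE v 0)
  TraceP v (suc n) = TraceP v n ∧ᴾ ∃ᴾ (TraceE v (suc n))

  trace-at : ∀ {Γ} v n m {w} → m ≤ n → Γ ⊢ fm (TraceP v n) (w ∷ []) → Γ ⊢ fm (∃ᴾ (TraceE v m)) (w ∷ [])
  trace-at v zero zero p d = d
  trace-at v (suc n) m p d with m ≟ suc n
  ... | yes refl = ∧E₂ d
  ... | no q = trace-at v n m (≤-pred (≤∧≢⇒< p q)) (∧E₁ d)

  traceE-ext : ∀ {Γ} {{b : Base Γ}} v m n {w' k x w} → m < n → Γ ⊢ num n k → Γ ⊢ ext w' k x w
             → Γ ⊢ fm (∃ᴾ (TraceE v m)) (w ∷ []) → Γ ⊢ fm (∃ᴾ (TraceE v m)) (w' ∷ [])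
  traceE-ext v m n {w'} {k} {x} {w} p dk d t = exE (TraceE v m) {w ∷ []} t (λ a h →
    exI (TraceE v m) {w' ∷ []} a (∧I (∧E₁ h) (ext-old m n p (w1 dk) (w1 d) (∧E₂ h))))

  trace-ext : ∀ {Γ} {{b : Base Γ}} v m n {w' k x w} → m < n → Γ ⊢ num n k → Γ ⊢ ext w' k x w
            → Γ ⊢ fm (TraceP v m) (w ∷ []) → Γ ⊢ fm (TraceP v m) (w' ∷ [])
  trace-ext v zero n p dk d t = traceE-ext v 0 n p dk d t
  trace-ext v (suc m) n p dk d t = ∧I (trace-ext v m n (<⇒≤ p) dk d (∧E₁ t)) (traceE-ext v (suc m) n p dk d (∧E₂ t))

  -- One use of the sequence axiom for each entry, which is why the length is a standard number. The
  -- first use extends an arbitrary term, here `k` itself: nothing lies below index 0.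
  trace : ∀ {Γ} {{b : Base Γ}} v n → Γ ⊢ fm (∃ᴾ (TraceP v n)) []
  trace v zero = numeralE 0 (λ k dk → numeralE (v 0) (λ a da → extE k a k (λ w d →
    exI (TraceP v 0) {[]} w (exI (TraceE v 0) {w ∷ []} a (∧I (w1 da) (ext-new 0 (w2 dk) d))))))
  trace v (suc n) = exE (TraceP v n) {[]} (trace v n) (λ w t →
    numeralE (suc n) (λ k dk → numeralE (v (suc n)) (λ a da → extE w a k (λ w' d →
      exI (TraceP v (suc n)) {[]} w' (∧I (trace-ext v n (suc n) ≤-refl (w2 dk) d (w3 t))
        (exI (TraceE v (suc n)) {w' ∷ []} a (∧I (w1 da) (ext-new (suc n) (w2 dk) d))))))))

  -- Representation of primitive recursive functions

  compArg : ∀ m {k} → Vec (Term L) (suc (m + suc k)) → Vec (Term L) (suc k)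
  compArg m (z ∷ us) = z ∷ tail (dropⱽ m us)

  compArg-nat : ∀ m {k} τ (us : Vec (Term L) (suc (m + suc k))) → substTs τ (compArg m us) ≡ compArg m (substTs τ us)
  compArg-nat m τ (z ∷ us) = cong (substT τ z ∷_) (trans (subst-tail τ (dropⱽ m us)) (cong tail (subst-dropⱽ m τ us)))

  compOut : ∀ m {k} → Vec (Term L) (m + suc k) → Vec (Term L) (suc m)
  compOut m us = head (dropⱽ m us) ∷ takeⱽ m us

  compOut-nat : ∀ m {k} τ (us : Vec (Term L) (m + suc k)) → substTs τ (compOut m us) ≡ compOut m (substTs τ us)
  compOut-nat m τ us = cong₂ _∷_ (trans (subst-head τ (dropⱽ m us)) (cong head (subst-dropⱽ m τ us))) (subst-takeⱽ m τ us)

  -- The graph of a recursion says that some `w` records the computation. `Body` asks only for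
  -- closure: a right entry at 0, from each entry at `i` a right entry at the successor `i'`, and
  -- every entry at `y` equal to `z` in the interpreted sense. Soundness follows one path of entries
  -- up to the standard `y`; completeness takes for `w` a trace, whose entries are unique.
  module Prec {k : ℕ} (G : Pred {L} (suc k)) (H : Pred {L} (suc (suc (suc k)))) where
    InitA : Pred {L} (5 + k)
    InitA = sub G (λ { (a ∷ i ∷ w ∷ z ∷ y ∷ xs) → a ∷ xs }) (λ { τ (a ∷ i ∷ w ∷ z ∷ y ∷ xs) → refl }) ∧ᴾ at3 BP f0 f1 f2

    InitI : Pred {L} (4 + k)
    InitI = at1 (Num 0) f0 ⇒ᴾ ∃ᴾ InitA

    StepB : Pred {L} (7 + k)
    StepB = sub H (λ { (b ∷ i' ∷ a ∷ i ∷ w ∷ z ∷ y ∷ xs) → b ∷ i ∷ a ∷ xs }) (λ { τ (b ∷ i' ∷ a ∷ i ∷ w ∷ z ∷ y ∷ xs) → refl })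
      ∧ᴾ at3 BP f0 f1 f4

    StepI : Pred {L} (6 + k)
    StepI = at1 NP f2 ∧ᴾ at2 LtP f2 f5 ∧ᴾ at1 NP f0 ∧ᴾ at2 SP f2 f0 ∧ᴾ at3 BP f1 f2 f3 ⇒ᴾ ∃ᴾ StepB

    LastI : Pred {L} (4 + k)
    LastI = at3 BP f0 f3 f1 ⇒ᴾ at2 EP f0 f2

    Body : Pred {L} (3 + k)
    Body = ∀ᴾ InitI ∧ᴾ ∀ᴾ (∀ᴾ (∀ᴾ StepI)) ∧ᴾ at1 NP f1 ∧ᴾ ∀ᴾ LastI

  mutual
    repP : ∀ {k} → PR k → Pred {L} (suc k)
    repP zer = Num 0
    repP succ = NN ∧ᴾ at2 SP f1 f0
    repP (proj i) = NN ∧ᴾ at2 EP (fs i) f0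
    repP (comp {m} f gs) = compP gs (sub (repP f) (compOut m) (compOut-nat m))
    repP (prec g h) = ∃ᴾ (Prec.Body (repP g) (repP h))

    -- `K` takes the values of the inner functions, then the output and the inputs. The values are
    -- bound one function at a time; `compArg` and `compOut` select from this layout what each graph
    -- needs.
    compP : ∀ {m k} → Vec (PR k) m → Pred {L} (m + suc k) → Pred {L} (suc k)
    compP [] K = K
    compP (g ∷ gs) K = compP gs (∃ᴾ (compBody g gs K))

    compBody : ∀ {m k} → PR k → Vec (PR k) m → Pred {L} (suc m + suc k) → Pred {L} (suc m + suc k)
    compBody {m} g gs K = sub (repP g) (compArg m) (compArg-nat m) ∧ᴾ K

  Nums : ∀ {k} → List (Fm L) → Vec (Term L) k → Vec ℕ k → Set
  Nums Γ = Pointwise (λ t n → Γ ⊢ num n t)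

  nums-wk : ∀ {Γ Δ k} {ts : Vec (Term L) k} {ns} → Γ ⊆ᶜ Δ → Nums Γ ts ns → Nums Δ ts ns
  nums-wk s = PW.map (wk s)

  numsE : ∀ {Γ} {{b : Base Γ}} {k} (ns : Vec ℕ k) {χ} → (∀ {Δ} → Γ ⊆ᶜ Δ → ∀ ts → Nums Δ ts ns → Δ ⊢ χ) → Γ ⊢ χ
  numsE [] k = k id [] []
  numsE (n ∷ ns) k = numeralE n (λ t h → numsE ns (λ s ts hs → k (s ∘ there) (t ∷ ts) (wk s h ∷ hs)))

  nums-lookup : ∀ {Γ k} {ts : Vec (Term L) k} {ns} → Nums Γ ts ns → ∀ i → Γ ⊢ num (lookupV ns i) (lookup ts i)
  nums-lookup (h ∷ hs) fz = h
  nums-lookup (h ∷ hs) (fs i) = nums-lookup hs i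

  compArg-++ : ∀ {m k} z (zs : Vec (Term L) m) y (ts : Vec (Term L) k) → compArg m (z ∷ (zs ++ⱽ (y ∷ ts))) ≡ z ∷ ts
  compArg-++ z zs y ts = cong (λ v → z ∷ tail v) (dropⱽ-++ zs (y ∷ ts))

  compOut-++ : ∀ {m k} (zs : Vec (Term L) m) y (ts : Vec (Term L) k) → compOut m (zs ++ⱽ (y ∷ ts)) ≡ y ∷ zs
  compOut-++ zs y ts = cong₂ _∷_ (cong head (dropⱽ-++ zs (y ∷ ts))) (takeⱽ-++ zs (y ∷ ts))

  ≐-sym : ∀ {Γ} {s t : Term L} → Γ ⊢ s ≐ t → Γ ⊢ t ≐ s
  ≐-sym {s = s} d = ≐-subst (eqᴾ f0 f1) {s ∷ []} d (≐refl s)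

  fm-≡ : ∀ {Γ k} (P : Pred {L} k) {us vs} → us ≡ vs → Γ ⊢ fm P us → Γ ⊢ fm P vs
  fm-≡ P refl d = d

  mutual
    rep-sound : ∀ {k Γ} {{b : Base Γ}} (q : PR k) {y ts ns} → Nums Γ ts ns → Γ ⊢ fm (repP q) (y ∷ ts) → Γ ⊢ num (evalPR q ns) y
    rep-sound zer hs d = d
    rep-sound succ (_∷_ {y = n} h []) d = num-suc n h (∧E₁ d) (∧E₂ d)
    rep-sound (proj i) {ns = ns} hs d = num-cong (lookupV ns i) (nums-lookup hs i) (∧E₁ d) (∧E₂ d)
    rep-sound {{b}} (comp {m} f gs) {y} {ts} hs d = comp-sound gs (sub (repP f) (compOut m) (compOut-nat m)) hs d (λ s zs hz e →
      rep-sound {{Base-wk s b}} f hz (fm-≡ (repP f) (compOut-++ zs y ts) e))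
    rep-sound {Γ = Γ} (prec g h) {z} {y ∷ ts} {n ∷ ns} (hy ∷ hs) d = exE Body {z ∷ y ∷ ts} d (λ w e →
      exE (Reach n) {y ∷ w ∷ []}
        (reach w there e n ≤-refl (w1 hy))
        (λ a c → num-cong (val n) (∧E₁ c) (w1 (∧E₁ (∧E₂ (∧E₂ e))))
                   (⇒E (allE LastI {w ∷ z ∷ y ∷ ts} (w1 (∧E₂ (∧E₂ (∧E₂ e)))) a) (∧E₂ c))))
      where
      open Prec (repP g) (repP h)
      val : ℕ → ℕ
      val m = evalRec g h m ns
      Reach : ℕ → Pred {L} 3
      Reach m = at1 (Num (val m)) f0 ∧ᴾ at3 BP f0 f1 f2
      reach : ∀ {Δ} {{b : Base Δ}} w → Γ ⊆ᶜ Δ → Δ ⊢ fm Body (w ∷ z ∷ y ∷ ts) → ∀ m → m ≤ n → ∀ {i} → Δ ⊢ num m i → Δ ⊢ fm (∃ᴾ (Reach m)) (i ∷ w ∷ [])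
      reach w s e zero p {i} di =
        exE InitA {i ∷ w ∷ z ∷ y ∷ ts} (⇒E (allE InitI {w ∷ z ∷ y ∷ ts} (∧E₁ e) i) di) (λ a c →
          exI (Reach 0) {i ∷ w ∷ []} a (∧I (rep-sound g (nums-wk (there ∘ s) hs) (∧E₁ c)) (∧E₂ c)))
      reach w s e (suc m) p {i'} di' = num-pred m di' (λ i c →
        exE (Reach m) {i ∷ w ∷ []} (reach w (there ∘ s) (w1 e) m (<⇒≤ p) (∧E₁ c)) (λ a r →
          exE StepB {i' ∷ a ∷ i ∷ w ∷ z ∷ y ∷ ts}
            (⇒E (allE StepI {a ∷ i ∷ w ∷ z ∷ y ∷ ts} (allE (∀ᴾ StepI) {i ∷ w ∷ z ∷ y ∷ ts}
                  (allE (∀ᴾ (∀ᴾ StepI)) {w ∷ z ∷ y ∷ ts} (w2 (∧E₁ (∧E₂ e))) i) a) i')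
                (∧I (num-N m (w1 (∧E₁ c))) (∧I (lt-num p (w1 (∧E₁ c)) (wk (there ∘ there ∘ s) hy))
                  (∧I (num-N (suc m) (w2 di')) (∧I (w1 (∧E₂ c)) (∧E₂ r))))))
            (λ b' t → exI (Reach (suc m)) {i' ∷ w ∷ []} b'
              (∧I (rep-sound h (w2 (∧E₁ c) ∷ w1 (∧E₁ r) ∷ nums-wk (there ∘ there ∘ there ∘ s) hs) (∧E₁ t)) (∧E₂ t)))))

    comp-sound : ∀ {m k Γ} {{b : Base Γ}} (gs : Vec (PR k) m) (K : Pred {L} (m + suc k)) {y ts ns χ} → Nums Γ ts ns
               → Γ ⊢ fm (compP gs K) (y ∷ ts)
               → (∀ {Δ} → Γ ⊆ᶜ Δ → ∀ zs → Nums Δ zs (evalPRs gs ns) → Δ ⊢ fm K (zs ++ⱽ (y ∷ ts)) → Δ ⊢ χ) → Γ ⊢ χ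
    comp-sound [] K hs d k = k id [] [] d
    comp-sound {{b}} (g ∷ gs) K {y} {ts} hs d k = comp-sound gs (∃ᴾ (compBody g gs K)) hs d (λ s zs hz e →
      exE (compBody g gs K) {zs ++ⱽ (y ∷ ts)} e (λ z h → k (there ∘ s) (z ∷ zs)
        (rep-sound {{Base-wk (there ∘ s) b}} g (nums-wk (there ∘ s) hs) (fm-≡ (repP g) (compArg-++ z zs y ts) (∧E₁ h))
          ∷ nums-wk there hz)
        (∧E₂ h)))

  mutual
    rep-complete : ∀ {k Γ} {{b : Base Γ}} (q : PR k) {y ts ns} → Nums Γ ts ns → Γ ⊢ num (evalPR q ns) y → Γ ⊢ fm (repP q) (y ∷ ts)
    rep-complete zer hs d = d
    rep-complete succ (_∷_ {y = n} h []) d = num-pred n d (λ x e →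
      ∧I (w1 (∧E₁ d)) (S-cong (num-N n (∧E₁ e)) (w1 (∧E₁ d)) (num-N n (w1 h)) (w1 (∧E₁ d)) (∧E₂ e)
        (num-uniq n (∧E₁ e) (w1 h)) (E-refl (w1 (∧E₁ d)))))
    rep-complete (proj i) {ns = ns} hs d = ∧I (num-N (lookupV ns i) d) (num-uniq (lookupV ns i) (nums-lookup hs i) d)
    rep-complete {{b}} (comp {m} f gs) {y} {ts} {ns} hs d = numsE (evalPRs gs ns) (λ s zs hz →
      comp-complete {{Base-wk s b}} gs (sub (repP f) (compOut m) (compOut-nat m)) (nums-wk s hs) hz
        (fm-≡ (repP f) (sym (compOut-++ zs y ts)) (rep-complete {{Base-wk s b}} f hz (wk s d))))
    rep-complete {Γ = Γ} (prec g h) {z} {y ∷ ts} {n ∷ ns} (hy ∷ hs) d = exE (TraceP val n) {[]} (trace val n) (λ w t →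
      exI Body {z ∷ y ∷ ts} w (∧I
        (allI InitI {w ∷ z ∷ y ∷ ts} (λ i → impI (λ di →
          exE (TraceE val 0) {w ∷ []} (w1 (trace-at val n 0 z≤n t)) (λ a e →
            exI InitA {i ∷ w ∷ z ∷ y ∷ ts} a
              (∧I (rep-complete g (nums-wk (there ∘ there ∘ there) hs) (∧E₁ e)) (entry-in 0 (∧E₂ e) (w1 di)))))))
        (∧I
        (allI (∀ᴾ (∀ᴾ StepI)) {w ∷ z ∷ y ∷ ts} (λ i → allI (∀ᴾ StepI) {i ∷ w ∷ z ∷ y ∷ ts} (λ a →
          allI StepI {a ∷ i ∷ w ∷ z ∷ y ∷ ts} (λ i' → impI (λ c → step w i a i' t c)))))
        (∧I (num-N (val n) (w1 d))
        (allI LastI {w ∷ z ∷ y ∷ ts} (λ z' → impI (λ e →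
          exE (TraceE val n) {w ∷ []} (w1 (trace-at val n n ≤-refl t)) (λ a f →
            num-uniq (val n) (≐-subst (Num (val n)) {[]} (≐-sym (entry-out n (∧E₂ f) (w3 hy) (w1 e))) (∧E₁ f)) (w3 d)))))))))
      where
      open Prec (repP g) (repP h)
      val : ℕ → ℕ
      val m = evalRec g h m ns
      -- The index `i` comes from inside the theory, but it lies below the standard `n` and so
      -- represents some `m < n`. Uniqueness of the entry of the trace then identifies `a` with the
      -- value at `m`.
      step : ∀ w i a i' {φ : Fm L} (let ψ = N[ i ] ∧' Lt i y ∧' N[ i' ] ∧' S[ i , i' ] ∧' B[ a , i , w ])
           → φ ∷ Γ ⊢ fm (TraceP val n) (w ∷ []) → ψ ∷ φ ∷ Γ ⊢ ψ
           → ψ ∷ φ ∷ Γ ⊢ fm (∃ᴾ StepB) (i' ∷ a ∷ i ∷ w ∷ z ∷ y ∷ ts)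
      step w i a i' t c = belowE n (lt-below n (∧E₁ c) (∧E₁ (∧E₂ c)) (w2 hy)) (λ m p di →
        exE (TraceE val m) {w ∷ []} (w2 (trace-at val n m (<⇒≤ p) t)) (λ a' e →
          exE (TraceE val (suc m)) {w ∷ []} (w3 (trace-at val n (suc m) p t)) (λ b' e' →
            let c' = w3 c ; di' = w2 di in
            exI StepB {i' ∷ a ∷ i ∷ w ∷ z ∷ y ∷ ts} b'
              (∧I (rep-complete h (di' ∷ ≐-subst (Num (val m)) {[]} (≐-sym (entry-out m (w1 (∧E₂ e)) di' (∧E₂ (∧E₂ (∧E₂ (∧E₂ c')))))) (w1 (∧E₁ e))
                     ∷ nums-wk (there ∘ there ∘ there ∘ there ∘ there) hs) (∧E₁ e'))
                  (entry-in (suc m) (∧E₂ e') (num-suc m di' (∧E₁ (∧E₂ (∧E₂ c'))) (∧E₁ (∧E₂ (∧E₂ (∧E₂ c'))))))))))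

    comp-complete : ∀ {m k Γ} {{b : Base Γ}} (gs : Vec (PR k) m) (K : Pred {L} (m + suc k)) {y ts ns zs} → Nums Γ ts ns
                  → Nums Γ zs (evalPRs gs ns) → Γ ⊢ fm K (zs ++ⱽ (y ∷ ts)) → Γ ⊢ fm (compP gs K) (y ∷ ts)
    comp-complete [] K hs [] d = d
    comp-complete (g ∷ gs) K {y} {ts} {zs = z ∷ zs} hs (h ∷ hz) d = comp-complete gs (∃ᴾ (compBody g gs K)) hs hz
      (exI (compBody g gs K) {zs ++ⱽ (y ∷ ts)} z
        (∧I (fm-≡ (repP g) (sym (compArg-++ z zs y ts)) (rep-complete g hs h)) d))

-- Primitive recursive functions

IsPR : ∀ {k} → (Vec ℕ k → ℕ) → Set
IsPR {k} f = Σ (PR k) λ q → ∀ xs → evalPR q xs ≡ f xs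

PR¹ : (ℕ → ℕ) → Set
PR¹ f = Σ (PR 1) λ q → ∀ x → evalPR q (x ∷ []) ≡ f x

PR² : (ℕ → ℕ → ℕ) → Set
PR² f = Σ (PR 2) λ q → ∀ x y → evalPR q (x ∷ y ∷ []) ≡ f x y

PR³ : (ℕ → ℕ → ℕ → ℕ) → Set
PR³ f = Σ (PR 3) λ q → ∀ x y z → evalPR q (x ∷ y ∷ z ∷ []) ≡ f x y z

toPR¹ : ∀ {f} → IsPR {1} f → PR¹ (λ x → f (x ∷ []))
toPR¹ (q , e) = q , λ x → e (x ∷ [])

toPR² : ∀ {f} → IsPR {2} f → PR² (λ x y → f (x ∷ y ∷ []))
toPR² (q , e) = q , λ x y → e (x ∷ y ∷ [])

toPR³ : ∀ {f} → IsPR {3} f → PR³ (λ x y z → f (x ∷ y ∷ z ∷ []))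
toPR³ (q , e) = q , λ x y z → e (x ∷ y ∷ z ∷ [])

argᴿ : ∀ {k} (i : Fin k) → IsPR (λ xs → lookupV xs i)
argᴿ i = proj i , λ _ → refl

app¹ : ∀ {k f} {g : Vec ℕ k → ℕ} → PR¹ f → IsPR g → IsPR (λ xs → f (g xs))
app¹ {f = f} (p , d) (q , e) = comp p (q ∷ []) , λ xs → trans (d _) (cong f (e xs))

app² : ∀ {k f} {g h : Vec ℕ k → ℕ} → PR² f → IsPR g → IsPR h → IsPR (λ xs → f (g xs) (h xs))
app² {f = f} (p , d) (q , e) (r , e') = comp p (q ∷ r ∷ []) , λ xs → trans (d _ _) (cong₂ f (e xs) (e' xs))

app³ : ∀ {k f} {g h l : Vec ℕ k → ℕ} → PR³ f → IsPR g → IsPR h → IsPR l → IsPR (λ xs → f (g xs) (h xs) (l xs))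
app³ {f = f} (p , d) (q , e) (r , e') (s , e'') = comp p (q ∷ r ∷ s ∷ []) , λ xs →
  trans (d _ _ _) (trans (cong₂ (λ a b → f a b _) (e xs) (e' xs)) (cong (f _ _) (e'' xs)))

recᴿ : ∀ {k} {g : Vec ℕ k → ℕ} {h : Vec ℕ (suc (suc k)) → ℕ} (f : ℕ → Vec ℕ k → ℕ) → IsPR g → IsPR h
     → (∀ xs → f 0 xs ≡ g xs) → (∀ n xs → f (suc n) xs ≡ h (n ∷ f n xs ∷ xs))
     → IsPR (λ { (n ∷ xs) → f n xs })
recᴿ {k} {g} {h} f (p , d) (q , e) eq₀ eqₛ = prec p q , λ { (n ∷ xs) → go n xs }
  where
  go : ∀ n xs → evalRec p q n xs ≡ f n xs
  go zero xs = trans (d xs) (sym (eq₀ xs))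
  go (suc n) xs = trans (e _) (trans (cong (λ m → h (n ∷ m ∷ xs)) (go n xs)) (sym (eqₛ n xs)))

sucᴿ : PR¹ suc
sucᴿ = succ , λ _ → refl

constᴿ : ∀ {k} n → IsPR {k} (λ _ → n)
constᴿ zero = comp zer [] , λ _ → refl
constᴿ (suc n) = app¹ sucᴿ (constᴿ n)

addᴿ : PR² _+_
addᴿ = toPR² (recᴿ (λ { n (x ∷ []) → n + x }) (argᴿ fz) (app¹ sucᴿ (argᴿ (fs fz))) (λ { (x ∷ []) → refl }) (λ { n (x ∷ []) → refl }))

mulᴿ : PR² _*_
mulᴿ = toPR² (recᴿ (λ { n (x ∷ []) → n * x }) (constᴿ 0) (app² addᴿ (argᴿ (fs (fs fz))) (argᴿ (fs fz)))
  (λ { (x ∷ []) → refl }) (λ { n (x ∷ []) → refl }))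

predᴿ : PR¹ pred
predᴿ = toPR¹ (recᴿ (λ { n [] → pred n }) (constᴿ 0) (argᴿ fz) (λ { [] → refl }) (λ { n [] → refl }))

monusᴿ : PR² _∸_
monusᴿ = toPR² (app² {f = λ x y → y ∸ x}
  (toPR² (recᴿ (λ { n (x ∷ []) → x ∸ n }) (argᴿ fz) (app¹ predᴿ (argᴿ (fs fz))) (λ { (x ∷ []) → refl }) (λ { n (x ∷ []) → sym (pred[m∸n]≡m∸[1+n] x n) })))
  (argᴿ (fs fz)) (argᴿ fz))

-- Zero plays the role of truth.
ite : ℕ → ℕ → ℕ → ℕ
ite zero a b = a
ite (suc _) a b = b

iteᴿ : PR³ ite
iteᴿ = toPR³ (recᴿ (λ { n (a ∷ b ∷ []) → ite n a b }) (argᴿ fz) (argᴿ (fs (fs (fs fz)))) (λ { (a ∷ b ∷ []) → refl }) (λ { n (a ∷ b ∷ []) → refl }))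

dist : ℕ → ℕ → ℕ
dist a b = (a ∸ b) + (b ∸ a)

distᴿ : PR² dist
distᴿ = toPR² (app² addᴿ (app² monusᴿ (argᴿ fz) (argᴿ (fs fz))) (app² monusᴿ (argᴿ (fs fz)) (argᴿ fz)))

dist-refl : ∀ a → dist a a ≡ 0
dist-refl a = cong₂ _+_ (n∸n≡0 a) (n∸n≡0 a)

dist-≡ : ∀ a b → dist a b ≡ 0 → a ≡ b
dist-≡ a b e = ≤-antisym (m∸n≡0⇒m≤n (m+n≡0⇒m≡0 (a ∸ b) e)) (m∸n≡0⇒m≤n (m+n≡0⇒n≡0 (a ∸ b) e))

triangle : ℕ → ℕ
triangle zero = 0
triangle (suc n) = suc n + triangle n

triangleᴿ : PR¹ triangle
triangleᴿ = toPR¹ (recᴿ (λ { n [] → triangle n }) (constᴿ 0) (app² addᴿ (app¹ sucᴿ (argᴿ fz)) (argᴿ (fs fz))) (λ { [] → refl }) (λ { n [] → refl }))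

-- The largest n with triangle n ≤ c.
root : ℕ → ℕ
root zero = 0
root (suc c) = ite (dist (triangle (suc (root c))) (suc c)) (suc (root c)) (root c)

rootᴿ : PR¹ root
rootᴿ = toPR¹ (recᴿ (λ { n [] → root n }) (constᴿ 0)
  (app³ iteᴿ (app² distᴿ (app¹ triangleᴿ (app¹ sucᴿ (argᴿ (fs fz)))) (app¹ sucᴿ (argᴿ fz))) (app¹ sucᴿ (argᴿ (fs fz))) (argᴿ (fs fz)))
  (λ { [] → refl }) (λ { n [] → refl }))

-- `root` moves up exactly when the next number is the next triangular number. The induction on `b`
-- stays within row `s`; the start of row `suc s` is the successor of the last point of row `s`,
-- where `b` equals `s`.
root-triangle : ∀ s b → b ≤ s → root (triangle s + b) ≡ s
root-triangle zero zero p = refl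
root-triangle (suc s) zero p = trans (cong root (trans (+-identityʳ _) (cong suc (+-comm s (triangle s))))) step
  where
  ih : root (triangle s + s) ≡ s
  ih = root-triangle s s ≤-refl
  step : root (suc (triangle s + s)) ≡ suc s
  step rewrite ih | +-comm (triangle s) s | dist-refl (s + triangle s) = refl
root-triangle s (suc b) p = trans (cong root (+-suc (triangle s) b)) step
  where
  ih : root (triangle s + b) ≡ s
  ih = root-triangle s b (<⇒≤ p)
  step : root (suc (triangle s + b)) ≡ s
  step rewrite ih with dist (s + triangle s) (triangle s + b) in e
  ... | suc _ = refl
  ... | zero = ⊥-elim (<⇒≢ p (sym (+-cancelˡ-≡ (triangle s) s b (trans (+-comm (triangle s) s) (dist-≡ _ _ e)))))

unpair₁ unpair₂ : ℕ → ℕ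
unpair₂ c = c ∸ triangle (root c)
unpair₁ c = root c ∸ unpair₂ c

unpair₂ᴿ : PR¹ unpair₂
unpair₂ᴿ = toPR¹ (app² monusᴿ (argᴿ fz) (app¹ triangleᴿ (app¹ rootᴿ (argᴿ fz))))

unpair₁ᴿ : PR¹ unpair₁
unpair₁ᴿ = toPR¹ (app² monusᴿ (app¹ rootᴿ (argᴿ fz)) (app¹ unpair₂ᴿ (argᴿ fz)))

-- Primitive recursive coding of pairs, lists and Horn derivations.

module Coding (L : Lang) where

  -- The triangular numbers inside the definition of pair have no name; unification finds them.
  mutual
    pair-triangle : ∀ a b → pair {L} a b ≡ triangle (a + b) + b
    pair-triangle a b with a + b
    ... | n = cong (_+ b) (tri-triangle a b n)

    tri-triangle : ∀ a b n → _ ≡ triangle n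
    tri-triangle a b zero = refl
    tri-triangle a b (suc n) = cong (suc n +_) (tri-triangle a b n)

  -- Abstract, since pair applied to a numeral unfolds into a large sum.
  infixr 5 _▹_
  abstract
    _▹_ : ℕ → ℕ → ℕ
    a ▹ b = pair {L} a b

    ▹-pair : ∀ a b → a ▹ b ≡ pair {L} a b
    ▹-pair a b = refl

    ▹-triangle : ∀ a b → a ▹ b ≡ triangle (a + b) + b
    ▹-triangle = pair-triangle

  pairᴿ : PR² _▹_
  pairᴿ = proj₁ q , λ a b → trans (proj₂ q a b) (sym (▹-triangle a b))
    where
    q : PR² (λ a b → triangle (a + b) + b)
    q = toPR² (app² addᴿ (app¹ triangleᴿ (app² addᴿ (argᴿ fz) (argᴿ (fs fz)))) (argᴿ (fs fz)))

  abstract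
    root-pair : ∀ a b → root (a ▹ b) ≡ a + b
    root-pair a b = trans (cong root (▹-triangle a b)) (root-triangle (a + b) b (m≤n+m b a))

    unpair₂-pair : ∀ a b → unpair₂ (a ▹ b) ≡ b
    unpair₂-pair a b rewrite root-pair a b | ▹-triangle a b = m+n∸m≡n (triangle (a + b)) b

    unpair₁-pair : ∀ a b → unpair₁ (a ▹ b) ≡ a
    unpair₁-pair a b rewrite unpair₂-pair a b | root-pair a b = m+n∸n≡m a b

    pair-inj : ∀ {a b c d} → a ▹ b ≡ c ▹ d → a ≡ c × b ≡ d
    pair-inj {a} {b} {c} {d} e = trans (sym (unpair₁-pair a b)) (trans (cong unpair₁ e) (unpair₁-pair c d))
                               , trans (sym (unpair₂-pair a b)) (trans (cong unpair₂ e) (unpair₂-pair c d))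

    ≤-pair : ∀ a b → b ≤ a ▹ b
    ≤-pair a b = subst (b ≤_) (sym (▹-triangle a b)) (m≤n+m b (triangle (a + b)))

  codeL : List ℕ → ℕ
  codeL [] = 0
  codeL (x ∷ l) = suc (x ▹ codeL l)

  length≤codeL : ∀ l → length l ≤ codeL l
  length≤codeL [] = z≤n
  length≤codeL (x ∷ l) = s≤s (≤-trans (length≤codeL l) (≤-pair x _))

  hdᶜ tlᶜ : ℕ → ℕ
  hdᶜ l = unpair₁ (pred l)
  tlᶜ l = unpair₂ (pred l)

  hdᴿ : PR¹ hdᶜ
  hdᴿ = toPR¹ (app¹ unpair₁ᴿ (app¹ predᴿ (argᴿ fz)))

  tlᴿ : PR¹ tlᶜ
  tlᴿ = toPR¹ (app¹ unpair₂ᴿ (app¹ predᴿ (argᴿ fz)))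

  dropᶜ : ℕ → ℕ → ℕ
  dropᶜ zero l = l
  dropᶜ (suc j) l = tlᶜ (dropᶜ j l)

  dropᴿ : PR² dropᶜ
  dropᴿ = toPR² (recᴿ (λ { j (l ∷ []) → dropᶜ j l }) (argᴿ fz) (app¹ tlᴿ (argᴿ (fs fz))) (λ { (l ∷ []) → refl }) (λ { j (l ∷ []) → refl }))

  nthᶜ : ℕ → ℕ → ℕ
  nthᶜ l j = hdᶜ (dropᶜ j l)

  nthᴿ : PR² nthᶜ
  nthᴿ = toPR² (app¹ hdᴿ (app² dropᴿ (argᴿ (fs fz)) (argᴿ fz)))

  drop-suc : ∀ j (l : List ℕ) → drop (suc j) l ≡ drop 1 (drop j l)
  drop-suc zero l = refl
  drop-suc (suc j) [] = refl
  drop-suc (suc j) (x ∷ l) = drop-suc j l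

  tlᶜ-codeL : ∀ l → tlᶜ (codeL l) ≡ codeL (drop 1 l)
  tlᶜ-codeL [] = refl
  tlᶜ-codeL (x ∷ l) = unpair₂-pair x (codeL l)

  dropᶜ-codeL : ∀ j l → dropᶜ j (codeL l) ≡ codeL (drop j l)
  dropᶜ-codeL zero l = refl
  dropᶜ-codeL (suc j) l = trans (cong tlᶜ (dropᶜ-codeL j l)) (trans (tlᶜ-codeL (drop j l)) (cong codeL (sym (drop-suc j l))))

  -- Out of range the value is 0.
  lookupᴸ : List ℕ → ℕ → ℕ
  lookupᴸ [] i = 0
  lookupᴸ (x ∷ l) zero = x
  lookupᴸ (x ∷ l) (suc i) = lookupᴸ l i

  nthᶜ-codeL : ∀ l i → nthᶜ (codeL l) i ≡ lookupᴸ l i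
  nthᶜ-codeL l i = trans (cong hdᶜ (dropᶜ-codeL i l)) (go l i)
    where
    go : ∀ l i → hdᶜ (codeL (drop i l)) ≡ lookupᴸ l i
    go [] zero = refl
    go [] (suc i) = refl
    go (x ∷ l) zero = unpair₁-pair x (codeL l)
    go (x ∷ l) (suc i) = go l i

  -- Past the end of a list `hdᶜ` would return 0; the value 1 on the empty list keeps 0 from
  -- counting as a member.
  headTest : ℕ → ℕ → ℕ
  headTest x l = ite l 1 (dist (hdᶜ l) x)

  -- Zero is truth, so the product is a disjunction over positions. In `mem` the code of the list
  -- serves as the number of positions, since it bounds the length.
  memUpTo : ℕ → ℕ → ℕ → ℕ
  memUpTo zero x l = 1
  memUpTo (suc j) x l = memUpTo j x l * headTest x (dropᶜ j l)

  mem : ℕ → ℕ → ℕ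
  mem x l = memUpTo l x l

  headTestᴿ : PR² headTest
  headTestᴿ = toPR² (app³ iteᴿ (argᴿ (fs fz)) (constᴿ 1) (app² distᴿ (app¹ hdᴿ (argᴿ (fs fz))) (argᴿ fz)))

  memUpToᴿ : PR³ memUpTo
  memUpToᴿ = toPR³ (recᴿ (λ { j (x ∷ l ∷ []) → memUpTo j x l }) (constᴿ 1)
    (app² mulᴿ (argᴿ (fs fz)) (app² headTestᴿ (argᴿ (fs (fs fz))) (app² dropᴿ (argᴿ fz) (argᴿ (fs (fs (fs fz)))))))
    (λ { (x ∷ l ∷ []) → refl }) (λ { j (x ∷ l ∷ []) → refl }))

  memᴿ : PR² mem
  memᴿ = toPR² (app³ memUpToᴿ (argᴿ (fs fz)) (argᴿ fz) (argᴿ (fs fz)))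

  headTest-sound : ∀ x l → headTest x (codeL l) ≡ 0 → x ∈ l
  headTest-sound x (y ∷ l) e = here (sym (trans (sym (unpair₁-pair y (codeL l))) (dist-≡ _ x e)))

  ∈-drop : ∀ {x : ℕ} j l → x ∈ drop j l → x ∈ l
  ∈-drop zero l p = p
  ∈-drop (suc j) (y ∷ l) p = there (∈-drop j l p)

  memUpTo-sound : ∀ j x l → memUpTo j x (codeL l) ≡ 0 → x ∈ l
  memUpTo-sound (suc j) x l e with m*n≡0⇒m≡0∨n≡0 (memUpTo j x (codeL l)) e
  ... | inj₁ q = memUpTo-sound j x l q
  ... | inj₂ q = ∈-drop j l (headTest-sound x (drop j l) (subst (λ c → headTest x c ≡ 0) (dropᶜ-codeL j l) q))

  mem-sound : ∀ x l → mem x (codeL l) ≡ 0 → x ∈ l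
  mem-sound x l = memUpTo-sound (codeL l) x l

  ∈-index : ∀ {x : ℕ} {l} → x ∈ l → Σ ℕ λ j → j < length l × Σ (List ℕ) λ l' → drop j l ≡ x ∷ l'
  ∈-index {l = y ∷ l} (here refl) = 0 , s≤s z≤n , l , refl
  ∈-index (there p) with ∈-index p
  ... | j , q , l' , e = suc j , s≤s q , l' , e

  memUpTo-complete : ∀ n j x l l' → j < n → drop j l ≡ x ∷ l' → memUpTo n x (codeL l) ≡ 0
  memUpTo-complete (suc n) j x l l' p e with j ≟ n
  ... | yes refl = trans (cong (memUpTo n x (codeL l) *_) (trans (cong (headTest x) (trans (dropᶜ-codeL n l) (cong codeL e)))
                     (trans (cong (λ y → dist y x) (unpair₁-pair x (codeL l'))) (dist-refl x)))) (*-zeroʳ (memUpTo n x (codeL l)))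
  ... | no q = cong (_* headTest x (dropᶜ n (codeL l))) (memUpTo-complete n j x l l' (≤∧≢⇒< (≤-pred p) q) e)

  mem-complete : ∀ x l → x ∈ l → mem x (codeL l) ≡ 0
  mem-complete x l p with ∈-index p
  ... | j , q , l' , e = memUpTo-complete (codeL l) j x l l' (≤-trans q (length≤codeL l)) e

  -- Horn systems over coded syntax

  record Atom : Set where
    constructor atom
    field
      tag a₁ a₂ a₃ a₄ : ℕ

  codeA : Atom → ℕ
  codeA (atom t a b c d) = t ▹ a ▹ b ▹ c ▹ d

  codeA-inj : ∀ x y → codeA x ≡ codeA y → x ≡ y
  codeA-inj (atom t a b c d) (atom t' a' b' c' d') e with pair-inj {t} {_} {t'} e
  ... | refl , e₁ with pair-inj {a} {_} {a'} e₁
  ... | refl , e₂ with pair-inj {b} {_} {b'} e₂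
  ... | refl , e₃ with pair-inj {c} {_} {c'} e₃
  ... | refl , refl = refl

  data Pat : Set where
    var : ℕ → Pat
    lit : ℕ → Pat
    sucᵖ : Pat → Pat
    _▸_ : Pat → Pat → Pat
  infixr 5 _▸_

  evalPat : (ℕ → ℕ) → Pat → ℕ
  evalPat e (var i) = e i
  evalPat e (lit n) = n
  evalPat e (sucᵖ p) = suc (evalPat e p)
  evalPat e (p ▸ q) = evalPat e p ▹ evalPat e q

  record AtomPat : Set where
    constructor atomᵖ
    field
      tag : ℕ
      p₁ p₂ p₃ p₄ : Pat

  evalA : (ℕ → ℕ) → AtomPat → Atom
  evalA e (atomᵖ t p q r s) = atom t (evalPat e p) (evalPat e q) (evalPat e r) (evalPat e s)

  infix 3 _⊸_
  record Rule : Set where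
    constructor _⊸_
    field
      premises : List AtomPat
      conclusion : AtomPat
  open Rule public

  evalPat-ext : ∀ {e e'} → (∀ i → e i ≡ e' i) → ∀ p → evalPat e p ≡ evalPat e' p
  evalPat-ext h (var i) = h i
  evalPat-ext h (lit n) = refl
  evalPat-ext h (sucᵖ p) = cong suc (evalPat-ext h p)
  evalPat-ext h (p ▸ q) = cong₂ _▹_ (evalPat-ext h p) (evalPat-ext h q)

  evalA-ext : ∀ {e e'} → (∀ i → e i ≡ e' i) → ∀ a → evalA e a ≡ evalA e' a
  evalA-ext h (atomᵖ t p q r s) rewrite evalPat-ext h p | evalPat-ext h q | evalPat-ext h r | evalPat-ext h s = refl

  patᴿ : ∀ p → PR¹ (λ e → evalPat (nthᶜ e) p)
  patᴿ (var i) = toPR¹ (app² nthᴿ (argᴿ fz) (constᴿ i))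
  patᴿ (lit n) = toPR¹ (constᴿ n)
  patᴿ (sucᵖ p) = toPR¹ (app¹ sucᴿ (app¹ (patᴿ p) (argᴿ fz)))
  patᴿ (p ▸ q) = toPR¹ (app² pairᴿ (app¹ (patᴿ p) (argᴿ fz)) (app¹ (patᴿ q) (argᴿ fz)))

  atomPatᴿ : ∀ a → PR¹ (λ e → codeA (evalA (nthᶜ e) a))
  atomPatᴿ (atomᵖ t p q r s) = toPR¹ (app² pairᴿ (constᴿ t) (app² pairᴿ (app¹ (patᴿ p) (argᴿ fz)) (app² pairᴿ (app¹ (patᴿ q) (argᴿ fz))
    (app² pairᴿ (app¹ (patᴿ r) (argᴿ fz)) (app¹ (patᴿ s) (argᴿ fz))))))

  module Horn (Rules : List Rule) (p : PR 2) (fact : ℕ → Atom) (factᴿ : PR¹ (λ x → codeA (fact x))) where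

    -- The environment of a rule instance is one number read by `nthᶜ`, so that running through all
    -- instances means running through all numbers. `byFact` feeds in the computably enumerable set,
    -- with `y` as the witness of enumeration.
    data Der : Atom → Set where
      byRule : ∀ {r} → r ∈ Rules → ∀ e → All (λ a → Der (evalA (nthᶜ e) a)) (premises r) → Der (evalA (nthᶜ e) (conclusion r))
      byFact : ∀ x y → evalPR p (x ∷ y ∷ []) ≡ 0 → Der (fact x)

    -- A stage is a coded list, so that being derived by stage i is a primitive recursive test.
    missing : List AtomPat → ℕ → ℕ → ℕ
    missing [] e s = 0
    missing (a ∷ as) e s = mem (codeA (evalA (nthᶜ e) a)) s + missing as e s

    fire : ℕ → ℕ → ℕ → ℕ
    fire c x s = ite c (suc (x ▹ s)) s

    factStep : ℕ → ℕ → ℕ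
    factStep e s = fire (evalPR p (nthᶜ e 0 ∷ nthᶜ e 1 ∷ [])) (codeA (fact (nthᶜ e 0))) s

    steps : List Rule → ℕ → ℕ → ℕ
    steps [] e s = factStep e s
    steps (r ∷ rs) e s = fire (missing (premises r) e (steps rs e s)) (codeA (evalA (nthᶜ e) (conclusion r))) (steps rs e s)

    stage : ℕ → ℕ
    stage zero = 0
    -- Each environment `e` is the first component of `e ▹ k` for every `k`, and `k ≤ e ▹ k`. Hence
    -- every rule instance is tried again after its premises have appeared.
    stage (suc i) = steps Rules (unpair₁ i) (stage i)

    missingᴿ : ∀ as → PR² (missing as)
    missingᴿ [] = toPR² (constᴿ 0)
    missingᴿ (a ∷ as) = toPR² (app² addᴿ (app² memᴿ (app¹ (atomPatᴿ a) (argᴿ fz)) (argᴿ (fs fz))) (app² (missingᴿ as) (argᴿ fz) (argᴿ (fs fz))))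

    fireᴿ : PR³ fire
    fireᴿ = toPR³ (app³ iteᴿ (argᴿ fz) (app¹ sucᴿ (app² pairᴿ (argᴿ (fs fz)) (argᴿ (fs (fs fz))))) (argᴿ (fs (fs fz))))

    factStepᴿ : PR² factStep
    factStepᴿ = toPR² (app³ fireᴿ (app² (p , λ _ _ → refl) (app² nthᴿ (argᴿ fz) (constᴿ 0)) (app² nthᴿ (argᴿ fz) (constᴿ 1)))
      (app¹ factᴿ (app² nthᴿ (argᴿ fz) (constᴿ 0))) (argᴿ (fs fz)))

    stepsᴿ : ∀ rs → PR² (steps rs)
    stepsᴿ [] = factStepᴿ
    stepsᴿ (r ∷ rs) = toPR² (app³ fireᴿ (app² (missingᴿ (premises r)) (argᴿ fz) rest) (app¹ (atomPatᴿ (conclusion r)) (argᴿ fz)) rest)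
      where
      rest : IsPR {2} _
      rest = app² (stepsᴿ rs) (argᴿ fz) (argᴿ (fs fz))

    stageᴿ : PR¹ stage
    stageᴿ = toPR¹ (recᴿ (λ { i [] → stage i }) (constᴿ 0) (app² (stepsᴿ Rules) (app¹ unpair₁ᴿ (argᴿ fz)) (argᴿ (fs fz)))
      (λ { [] → refl }) (λ { i [] → refl }))

    derivedBy : ℕ → ℕ → ℕ
    derivedBy i x = mem x (stage i)

    derivedByᴿ : PR² derivedBy
    derivedByᴿ = toPR² (app² memᴿ (argᴿ (fs fz)) (app¹ stageᴿ (argᴿ fz)))

    codeD : List Atom → ℕ
    codeD l = codeL (map codeA l)

    mem-soundᴰ : ∀ x l → mem (codeA x) (codeD l) ≡ 0 → x ∈ l
    mem-soundᴰ x l e with ∈-map⁻ codeA (mem-sound (codeA x) (map codeA l) e)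
    ... | y , q , h = subst (_∈ l) (sym (codeA-inj x y h)) q

    mem-completeᴰ : ∀ x l → x ∈ l → mem (codeA x) (codeD l) ≡ 0
    mem-completeᴰ x l q = mem-complete (codeA x) (map codeA l) (∈-map⁺ codeA q)

    fire-list : ∀ c x l → Σ (List Atom) λ l' → fire c (codeA x) (codeD l) ≡ codeD l' × (∀ {y} → y ∈ l → y ∈ l')
              × (∀ {y} → y ∈ l' → y ∈ l ⊎ (c ≡ 0 × y ≡ x)) × (c ≡ 0 → x ∈ l')
    fire-list zero x l = x ∷ l , refl , there , (λ { (here e) → inj₂ (refl , e) ; (there q) → inj₁ q }) , λ _ → here refl
    fire-list (suc c) x l = l , refl , id , inj₁ , λ ()

    missing-sound : ∀ as e l → All Der l → missing as e (codeD l) ≡ 0 → All (λ a → Der (evalA (nthᶜ e) a)) as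
    missing-sound [] e l d h = []
    missing-sound (a ∷ as) e l d h =
      All.lookup d (mem-soundᴰ (evalA (nthᶜ e) a) l (m+n≡0⇒m≡0 (mem (codeA (evalA (nthᶜ e) a)) (codeD l)) h))
      ∷ missing-sound as e l d (m+n≡0⇒n≡0 (mem (codeA (evalA (nthᶜ e) a)) (codeD l)) h)

    missing-complete : ∀ as e l → All (λ a → evalA (nthᶜ e) a ∈ l) as → missing as e (codeD l) ≡ 0
    missing-complete [] e l [] = refl
    missing-complete (a ∷ as) e l (h ∷ hs) = cong₂ _+_ (mem-completeᴰ _ l h) (missing-complete as e l hs)

    -- The coded stage is shadowed by an honest list of atoms, on which soundness and growth are
    -- plain list reasoning; `out-code` ties the two together.
    record Step (rs : List Rule) (e : ℕ) (l : List Atom) : Set where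
      field
        out : List Atom
        out-code : steps rs e (codeD l) ≡ codeD out
        grows : ∀ {y} → y ∈ l → y ∈ out
        out-sound : All Der l → All Der out
        out-fact : evalPR p (nthᶜ e 0 ∷ nthᶜ e 1 ∷ []) ≡ 0 → fact (nthᶜ e 0) ∈ out
        out-rule : ∀ {r} → r ∈ rs → All (λ a → evalA (nthᶜ e) a ∈ l) (premises r) → evalA (nthᶜ e) (conclusion r) ∈ out
    open Step

    step : ∀ rs e l → (∀ {r} → r ∈ rs → r ∈ Rules) → Step rs e l
    step [] e l sub = record
      { out = proj₁ f ; out-code = proj₁ (proj₂ f) ; grows = proj₁ (proj₂ (proj₂ f))
      ; out-sound = λ d → All.tabulate (λ q → snd (proj₁ (proj₂ (proj₂ (proj₂ f))) q) d)
      ; out-fact = proj₂ (proj₂ (proj₂ (proj₂ f))) ; out-rule = λ () }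
      where
      f = fire-list (evalPR p (nthᶜ e 0 ∷ nthᶜ e 1 ∷ [])) (fact (nthᶜ e 0)) l
      snd : ∀ {y} → y ∈ l ⊎ (evalPR p (nthᶜ e 0 ∷ nthᶜ e 1 ∷ []) ≡ 0 × y ≡ fact (nthᶜ e 0)) → All Der l → Der y
      snd (inj₁ q) d = All.lookup d q
      snd (inj₂ (h , refl)) d = byFact _ _ h
    step (r ∷ rs) e l sub = record
      { out = proj₁ f
      ; out-code = trans (cong (λ s → fire (missing (premises r) e s) (codeA (evalA (nthᶜ e) (conclusion r))) s) (out-code S)) (proj₁ (proj₂ f))
      ; grows = λ q → up (grows S q)
      ; out-sound = λ d → All.tabulate (λ q → snd (proj₁ (proj₂ (proj₂ (proj₂ f))) q) (out-sound S d))
      ; out-fact = λ h → up (out-fact S h)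
      ; out-rule = λ { (here refl) hs → proj₂ (proj₂ (proj₂ (proj₂ f))) (missing-complete (premises r) e (out S) (All.map (grows S) hs))
                     ; (there q) hs → up (out-rule S q hs) } }
      where
      S = step rs e l (λ q → sub (there q))
      f = fire-list (missing (premises r) e (codeD (out S))) (evalA (nthᶜ e) (conclusion r)) (out S)
      up : ∀ {y} → y ∈ out S → y ∈ proj₁ f
      up = proj₁ (proj₂ (proj₂ f))
      snd : ∀ {y} → y ∈ out S ⊎ (missing (premises r) e (codeD (out S)) ≡ 0 × y ≡ evalA (nthᶜ e) (conclusion r)) → All Der (out S) → Der y
      snd (inj₁ q) d = All.lookup d q
      snd (inj₂ (h , refl)) d = byRule (sub (here refl)) e (missing-sound (premises r) e (out S) d h)

    derived : ℕ → List Atom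
    derived zero = []
    derived (suc i) = out (step Rules (unpair₁ i) (derived i) id)

    stage-derived : ∀ i → stage i ≡ codeD (derived i)
    stage-derived zero = refl
    stage-derived (suc i) = trans (cong (steps Rules (unpair₁ i)) (stage-derived i)) (out-code (step Rules (unpair₁ i) (derived i) id))

    derived-Der : ∀ i → All Der (derived i)
    derived-Der zero = []
    derived-Der (suc i) = out-sound (step Rules (unpair₁ i) (derived i) id) (derived-Der i)

    derived-mono : ∀ {i j x} → i ≤ j → x ∈ derived i → x ∈ derived j
    derived-mono {i} {j} {x} p q = subst (λ k → x ∈ derived k) (m∸n+n≡m p) (go (j ∸ i))
      where
      go : ∀ k → x ∈ derived (k + i)
      go zero = q
      go (suc k) = grows (step Rules (unpair₁ (k + i)) (derived (k + i)) id) (go k)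

    derivedBy-sound : ∀ i x → derivedBy i (codeA x) ≡ 0 → Der x
    derivedBy-sound i x h = All.lookup (derived-Der i) (mem-soundᴰ x (derived i) (subst (λ s → mem (codeA x) s ≡ 0) (stage-derived i) h))

    mutual
      Der-derived : ∀ {x} → Der x → ∃ λ i → x ∈ derived i
      Der-derived (byRule {r} q e ds) with Ders-derived e ds
      ... | i , hs = suc (e ▹ i) , subst (λ e' → evalA (nthᶜ e) (conclusion r) ∈ out (step Rules e' (derived (e ▹ i)) id)) (sym (unpair₁-pair e i))
                       (out-rule (step Rules e (derived (e ▹ i)) id) q (All.map (derived-mono (≤-pair e i)) hs))
      Der-derived (byFact x y h) = suc (e ▹ 0) , subst (λ e' → fact x ∈ out (step Rules e' (derived (e ▹ 0)) id)) (sym (unpair₁-pair e 0))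
                       (subst (λ z → fact z ∈ out S) (nthᶜ-codeL (x ∷ y ∷ []) 0)
                         (out-fact S (trans (cong₂ (λ a b → evalPR p (a ∷ b ∷ [])) (nthᶜ-codeL (x ∷ y ∷ []) 0) (nthᶜ-codeL (x ∷ y ∷ []) 1)) h)))
        where
        e = codeL (x ∷ y ∷ [])
        S = step Rules e (derived (e ▹ 0)) id

      Ders-derived : ∀ {as} e → All (λ a → Der (evalA (nthᶜ e) a)) as → ∃ λ i → All (λ a → evalA (nthᶜ e) a ∈ derived i) as
      Ders-derived e [] = 0 , []
      Ders-derived e (d ∷ ds) with Der-derived d | Ders-derived e ds
      ... | i , h | j , hs = i ⊔ j , derived-mono (m≤m⊔n i j) h ∷ All.map (derived-mono (m≤n⊔m i j)) hs

    derivedBy-complete : ∀ {x} → Der x → ∃ λ i → derivedBy i (codeA x) ≡ 0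
    derivedBy-complete {x} d with Der-derived d
    ... | i , h = i , subst (λ s → mem (codeA x) s ≡ 0) (sym (stage-derived i)) (mem-completeᴰ x (derived i) h)

    byRuleᴸ : ∀ {r} → r ∈ Rules → ∀ l → All (λ a → Der (evalA (lookupᴸ l) a)) (premises r) → Der (evalA (lookupᴸ l) (conclusion r))
    byRuleᴸ {r} q l ds = subst Der (evalA-ext (nthᶜ-codeL l) (conclusion r))
      (byRule q (codeL l) (All.map (λ {a} → subst Der (sym (evalA-ext (nthᶜ-codeL l) a))) ds))

-- Arithmetization of derivability.

module Provability (L : Lang) where
  open Coding L

  mutual
    -- A second copy of the coding, built from the opaque pairing so that codes with numeral tags do
    -- not unfold during type checking. `codeᶠ-code` reconciles it with `code`.
    codeᵀ : Term L → ℕ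
    codeᵀ (var i) = 0 ▹ i
    codeᵀ (fun f ts) = 1 ▹ toℕ f ▹ codeᵀs ts

    codeᵀs : ∀ {k} → Vec (Term L) k → ℕ
    codeᵀs [] = 0
    codeᵀs (t ∷ ts) = suc (codeᵀ t ▹ codeᵀs ts)

  codeᶠ : Fm L → ℕ
  codeᶠ ⊥' = 0 ▹ 0
  codeᶠ (rel r ts) = 1 ▹ toℕ r ▹ codeᵀs ts
  codeᶠ (s ≐ t) = 2 ▹ codeᵀ s ▹ codeᵀ t
  codeᶠ (¬' φ) = 3 ▹ codeᶠ φ
  codeᶠ (φ ∧' ψ) = 4 ▹ codeᶠ φ ▹ codeᶠ ψ
  codeᶠ (φ ∨' ψ) = 5 ▹ codeᶠ φ ▹ codeᶠ ψ
  codeᶠ (φ ⇒' ψ) = 6 ▹ codeᶠ φ ▹ codeᶠ ψ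
  codeᶠ (∀' φ) = 7 ▹ codeᶠ φ
  codeᶠ (∃' φ) = 8 ▹ codeᶠ φ

  mutual
    codeᵀ-code : ∀ t → codeᵀ t ≡ codeT t
    codeᵀ-code (var i) = ▹-pair 0 i
    codeᵀ-code (fun f ts) = ▹-code {1} refl (▹-code {toℕ f} refl (codeᵀs-code ts))

    codeᵀs-code : ∀ {k} (ts : Vec (Term L) k) → codeᵀs ts ≡ codeTs ts
    codeᵀs-code [] = refl
    codeᵀs-code (t ∷ ts) = cong suc (▹-code (codeᵀ-code t) (codeᵀs-code ts))

    ▹-code : ∀ {a b c d} → a ≡ c → b ≡ d → a ▹ b ≡ pair {L} c d
    ▹-code refl refl = ▹-pair _ _

  codeᶠ-code : ∀ φ → codeᶠ φ ≡ code φ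
  codeᶠ-code ⊥' = ▹-pair 0 0
  codeᶠ-code (rel r ts) = ▹-code {1} refl (▹-code {toℕ r} refl (codeᵀs-code ts))
  codeᶠ-code (s ≐ t) = ▹-code {2} refl (▹-code (codeᵀ-code s) (codeᵀ-code t))
  codeᶠ-code (¬' φ) = ▹-code {3} refl (codeᶠ-code φ)
  codeᶠ-code (φ ∧' ψ) = ▹-code {4} refl (▹-code (codeᶠ-code φ) (codeᶠ-code ψ))
  codeᶠ-code (φ ∨' ψ) = ▹-code {5} refl (▹-code (codeᶠ-code φ) (codeᶠ-code ψ))
  codeᶠ-code (φ ⇒' ψ) = ▹-code {6} refl (▹-code (codeᶠ-code φ) (codeᶠ-code ψ))
  codeᶠ-code (∀' φ) = ▹-code {7} refl (codeᶠ-code φ)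
  codeᶠ-code (∃' φ) = ▹-code {8} refl (codeᶠ-code φ)

  codeC : List (Fm L) → ℕ
  codeC [] = 0
  codeC (φ ∷ Γ) = suc (codeᶠ φ ▹ codeC Γ)

  -- Injectivity of the coding

  mutual
    codeᵀ-inj : ∀ (s t : Term L) → codeᵀ s ≡ codeᵀ t → s ≡ t
    codeᵀ-inj (var i) (var j) e = cong var (proj₂ (pair-inj {0} {i} {0} e))
    codeᵀ-inj (var i) (fun f ts) e with proj₁ (pair-inj {0} {i} {1} e)
    ... | ()
    codeᵀ-inj (fun f ts) (var i) e with proj₁ (pair-inj {1} {_} {0} e)
    ... | ()
    codeᵀ-inj (fun f ts) (fun g us) e with pair-inj {toℕ f} {_} {toℕ g} (proj₂ (pair-inj {1} {_} {1} e))
    ... | h , k with toℕ-injective h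
    ... | refl = cong (fun f) (codeᵀs-inj ts us k)

    codeᵀs-inj : ∀ {k} (ts us : Vec (Term L) k) → codeᵀs ts ≡ codeᵀs us → ts ≡ us
    codeᵀs-inj [] [] e = refl
    codeᵀs-inj (t ∷ ts) (u ∷ us) e with pair-inj {codeᵀ t} {_} {codeᵀ u} (suc-injective e)
    ... | h , k = cong₂ _∷_ (codeᵀ-inj t u h) (codeᵀs-inj ts us k)

  -- Inversion by the tag of a code: one pass over the constructors of `χ` serves injectivity and
  -- all the inversion lemmas, in place of a comparison of each pair of constructors.
  Shape : ℕ → ℕ → Fm L → Set
  Shape 0 b χ = χ ≡ ⊥'
  Shape 1 b χ = Σ (Fin (nRel L)) λ r → Σ (Vec (Term L) (relArity L r)) λ ts → χ ≡ rel r ts × b ≡ toℕ r ▹ codeᵀs ts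
  Shape 2 b χ = Σ (Term L) λ s → Σ (Term L) λ t → χ ≡ (s ≐ t) × b ≡ codeᵀ s ▹ codeᵀ t
  Shape 3 b χ = Σ (Fm L) λ φ → χ ≡ ¬' φ × b ≡ codeᶠ φ
  Shape 4 b χ = Σ (Fm L) λ φ → Σ (Fm L) λ ψ → χ ≡ φ ∧' ψ × b ≡ codeᶠ φ ▹ codeᶠ ψ
  Shape 5 b χ = Σ (Fm L) λ φ → Σ (Fm L) λ ψ → χ ≡ φ ∨' ψ × b ≡ codeᶠ φ ▹ codeᶠ ψ
  Shape 6 b χ = Σ (Fm L) λ φ → Σ (Fm L) λ ψ → χ ≡ (φ ⇒' ψ) × b ≡ codeᶠ φ ▹ codeᶠ ψ
  Shape 7 b χ = Σ (Fm L) λ φ → χ ≡ ∀' φ × b ≡ codeᶠ φ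
  Shape 8 b χ = Σ (Fm L) λ φ → χ ≡ ∃' φ × b ≡ codeᶠ φ
  Shape _ b χ = ⊥

  shape : ∀ χ t b → t ▹ b ≡ codeᶠ χ → Shape t b χ
  shape χ t b e with χ
  ... | ⊥' = subst (λ t → Shape t b _) (sym (proj₁ (pair-inj {t} {b} {0} e))) refl
  ... | rel r ts with pair-inj {t} {b} {1} e
  ...   | refl , h = r , ts , refl , h
  shape χ t b e | s ≐ s' with pair-inj {t} {b} {2} e
  ...   | refl , h = s , s' , refl , h
  shape χ t b e | ¬' φ with pair-inj {t} {b} {3} e
  ...   | refl , h = φ , refl , h
  shape χ t b e | φ ∧' ψ with pair-inj {t} {b} {4} e
  ...   | refl , h = φ , ψ , refl , h
  shape χ t b e | φ ∨' ψ with pair-inj {t} {b} {5} e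
  ...   | refl , h = φ , ψ , refl , h
  shape χ t b e | φ ⇒' ψ with pair-inj {t} {b} {6} e
  ...   | refl , h = φ , ψ , refl , h
  shape χ t b e | ∀' φ with pair-inj {t} {b} {7} e
  ...   | refl , h = φ , refl , h
  shape χ t b e | ∃' φ with pair-inj {t} {b} {8} e
  ...   | refl , h = φ , refl , h

  code-inj : ∀ φ ψ → codeᶠ φ ≡ codeᶠ ψ → φ ≡ ψ
  code-inj ⊥' ψ e = sym (shape ψ 0 _ e)
  code-inj (rel r ts) ψ e with shape ψ 1 _ e
  ... | r' , us , refl , h with pair-inj {toℕ r} {_} {toℕ r'} h
  ... | h₁ , h₂ with toℕ-injective h₁
  ... | refl = cong (rel r) (codeᵀs-inj ts us h₂)
  code-inj (s ≐ t) ψ e with shape ψ 2 _ e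
  ... | s' , t' , refl , h with pair-inj {codeᵀ s} {_} {codeᵀ s'} h
  ... | h₁ , h₂ = cong₂ _≐_ (codeᵀ-inj s s' h₁) (codeᵀ-inj t t' h₂)
  code-inj (¬' φ) ψ e with shape ψ 3 _ e
  ... | φ' , refl , h = cong ¬' (code-inj φ φ' h)
  code-inj (φ ∧' φ₁) ψ e with shape ψ 4 _ e
  ... | φ' , φ₁' , refl , h with pair-inj {codeᶠ φ} {_} {codeᶠ φ'} h
  ... | h₁ , h₂ = cong₂ _∧'_ (code-inj φ φ' h₁) (code-inj φ₁ φ₁' h₂)
  code-inj (φ ∨' φ₁) ψ e with shape ψ 5 _ e
  ... | φ' , φ₁' , refl , h with pair-inj {codeᶠ φ} {_} {codeᶠ φ'} h
  ... | h₁ , h₂ = cong₂ _∨'_ (code-inj φ φ' h₁) (code-inj φ₁ φ₁' h₂)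
  code-inj (φ ⇒' φ₁) ψ e with shape ψ 6 _ e
  ... | φ' , φ₁' , refl , h with pair-inj {codeᶠ φ} {_} {codeᶠ φ'} h
  ... | h₁ , h₂ = cong₂ _⇒'_ (code-inj φ φ' h₁) (code-inj φ₁ φ₁' h₂)
  code-inj (∀' φ) ψ e with shape ψ 7 _ e
  ... | φ' , refl , h = cong ∀' (code-inj φ φ' h)
  code-inj (∃' φ) ψ e with shape ψ 8 _ e
  ... | φ' , refl , h = cong ∃' (code-inj φ φ' h)

  codeC-inj : ∀ Γ Δ → codeC Γ ≡ codeC Δ → Γ ≡ Δ
  codeC-inj [] [] e = refl
  codeC-inj (φ ∷ Γ) (ψ ∷ Δ) e with pair-inj {codeᶠ φ} {_} {codeᶠ ψ} (suc-injective e)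
  ... | h , k = cong₂ _∷_ (code-inj φ ψ h) (codeC-inj Γ Δ k)

  inv-cons : ∀ Γ {a g} → codeC Γ ≡ suc (a ▹ g) → Σ (Fm L) λ φ → Σ (List (Fm L)) λ Δ → Γ ≡ φ ∷ Δ × codeᶠ φ ≡ a × codeC Δ ≡ g
  inv-cons (φ ∷ Γ) {a} e with pair-inj {codeᶠ φ} {_} {a} (suc-injective e)
  ... | h , k = φ , Γ , refl , h , k

  inv¬ : ∀ χ {a} → codeᶠ χ ≡ 3 ▹ a → Σ (Fm L) λ φ → χ ≡ ¬' φ × codeᶠ φ ≡ a
  inv¬ χ {a} e with shape χ 3 a (sym e)
  ... | φ , h , k = φ , h , sym k

  inv∀ : ∀ χ {a} → codeᶠ χ ≡ 7 ▹ a → Σ (Fm L) λ φ → χ ≡ ∀' φ × codeᶠ φ ≡ a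
  inv∀ χ {a} e with shape χ 7 a (sym e)
  ... | φ , h , k = φ , h , sym k

  inv∃ : ∀ χ {a} → codeᶠ χ ≡ 8 ▹ a → Σ (Fm L) λ φ → χ ≡ ∃' φ × codeᶠ φ ≡ a
  inv∃ χ {a} e with shape χ 8 a (sym e)
  ... | φ , h , k = φ , h , sym k

  components : ∀ {a b c d} → a ▹ b ≡ c ▹ d → c ≡ a × d ≡ b
  components e = pair-inj (sym e)

  inv∧ : ∀ χ {a b} → codeᶠ χ ≡ 4 ▹ a ▹ b → Σ (Fm L) λ φ → Σ (Fm L) λ ψ → χ ≡ φ ∧' ψ × codeᶠ φ ≡ a × codeᶠ ψ ≡ b
  inv∧ χ {a} {b} e with shape χ 4 (a ▹ b) (sym e)
  ... | φ , ψ , h , k = φ , ψ , h , components k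

  inv∨ : ∀ χ {a b} → codeᶠ χ ≡ 5 ▹ a ▹ b → Σ (Fm L) λ φ → Σ (Fm L) λ ψ → χ ≡ φ ∨' ψ × codeᶠ φ ≡ a × codeᶠ ψ ≡ b
  inv∨ χ {a} {b} e with shape χ 5 (a ▹ b) (sym e)
  ... | φ , ψ , h , k = φ , ψ , h , components k

  inv⇒ : ∀ χ {a b} → codeᶠ χ ≡ 6 ▹ a ▹ b → Σ (Fm L) λ φ → Σ (Fm L) λ ψ → χ ≡ (φ ⇒' ψ) × codeᶠ φ ≡ a × codeᶠ ψ ≡ b
  inv⇒ χ {a} {b} e with shape χ 6 (a ▹ b) (sym e)
  ... | φ , ψ , h , k = φ , ψ , h , components k

  inv≐ : ∀ χ {a b} → codeᶠ χ ≡ 2 ▹ a ▹ b → Σ (Term L) λ s → Σ (Term L) λ t → χ ≡ (s ≐ t) × codeᵀ s ≡ a × codeᵀ t ≡ b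
  inv≐ χ {a} {b} e with shape χ 2 (a ▹ b) (sym e)
  ... | φ , ψ , h , k = φ , ψ , h , components k

  inv⊥ : ∀ χ → codeᶠ χ ≡ 0 ▹ 0 → χ ≡ ⊥'
  inv⊥ χ e = shape χ 0 0 (sym e)

  -- The substitutions that the inference rules mention, with what becomes of them under binders.
  -- Being first-order data they have codes, unlike functions on variables.
  data SubstName : Set where
    shiftˢ : SubstName
    inst   : Term L → SubstName
    lift   : SubstName → SubstName

  ⟪_⟫ : SubstName → ℕ → Term L
  ⟪ shiftˢ ⟫ i = var (suc i)
  ⟪ inst t ⟫ = sub0 t
  ⟪ lift s ⟫ = liftσ ⟪ s ⟫

  tagS argS codeS : SubstName → ℕ
  tagS shiftˢ = 0
  tagS (inst t) = 1
  tagS (lift s) = 2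
  argS shiftˢ = 0
  argS (inst t) = codeᵀ t
  argS (lift s) = codeS s
  codeS s = tagS s ▹ argS s

  inv-lift : ∀ s {a} → codeS s ≡ 2 ▹ a → Σ SubstName λ s' → s ≡ lift s' × codeS s' ≡ a
  inv-lift s e = go s (proj₁ (pair-inj e)) (proj₂ (pair-inj e))
    where
    go : ∀ s {a} → tagS s ≡ 2 → argS s ≡ a → Σ SubstName λ s' → s ≡ lift s' × codeS s' ≡ a
    go (lift s) refl h = s , refl , h

  inv-inst : ∀ s {a} → codeS s ≡ 1 ▹ a → Σ (Term L) λ t → s ≡ inst t × codeᵀ t ≡ a
  inv-inst s e = go s (proj₁ (pair-inj e)) (proj₂ (pair-inj e))
    where
    go : ∀ s {a} → tagS s ≡ 1 → argS s ≡ a → Σ (Term L) λ t → s ≡ inst t × codeᵀ t ≡ a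
    go (inst t) refl h = t , refl , h

  inv-shift : ∀ s → codeS s ≡ 0 ▹ 0 → s ≡ shiftˢ
  inv-shift s e = go s (proj₁ (pair-inj e))
    where
    go : ∀ s → tagS s ≡ 0 → s ≡ shiftˢ
    go shiftˢ refl = refl

  -- The inference rules as a Horn system; the rules are referred to by the numbers on the right.

  private
    x₀ x₁ x₂ x₃ x₄ x₅ O : Pat
    x₀ = var 0
    x₁ = var 1
    x₂ = var 2
    x₃ = var 3
    x₄ = var 4
    x₅ = var 5
    O = lit 0

  -- The judgments. `V`, `T`, `Vs`, `F`: the effect of a coded substitution on a variable, a term, a
  -- vector of given length, a formula. `C`: a context and its shift. `M`: membership in a context.
  -- `Q`: derivability. `Ax`: an axiom of the theory. `Cl`: a context of axioms. `Th`: a theorem.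
  -- `Fun`, `Rel`: arities of the language.
  Vᵖ Tᵖ Fᵖ : Pat → Pat → Pat → AtomPat
  Vᵖ s i t = atomᵖ 0 s i t O
  Tᵖ s a b = atomᵖ 1 s a b O
  Fᵖ s a b = atomᵖ 3 s a b O
  Vsᵖ : Pat → Pat → Pat → Pat → AtomPat
  Vsᵖ k s a b = atomᵖ 2 k s a b
  Cᵖ Mᵖ Qᵖ Funᵖ Relᵖ : Pat → Pat → AtomPat
  Cᵖ a b = atomᵖ 4 a b O O
  Mᵖ a b = atomᵖ 5 a b O O
  Qᵖ a b = atomᵖ 6 a b O O
  Funᵖ a b = atomᵖ 10 a b O O
  Relᵖ a b = atomᵖ 11 a b O O
  Axᵖ Clᵖ Thᵖ : Pat → AtomPat
  Axᵖ a = atomᵖ 7 a O O O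
  Clᵖ a = atomᵖ 8 a O O O
  Thᵖ a = atomᵖ 9 a O O O

  shᵖ ⊥ᵖ : Pat
  shᵖ = lit 0 ▸ lit 0
  ⊥ᵖ = lit 0 ▸ lit 0
  instᵖ liftᵖ ¬ᵖ ∀ᵖ ∃ᵖ varᵖ : Pat → Pat
  instᵖ t = lit 1 ▸ t
  liftᵖ s = lit 2 ▸ s
  ¬ᵖ a = lit 3 ▸ a
  ∀ᵖ a = lit 7 ▸ a
  ∃ᵖ a = lit 8 ▸ a
  varᵖ i = lit 0 ▸ i
  consᵖ eqᵖ andᵖ orᵖ impᵖ appᵖ : Pat → Pat → Pat
  consᵖ a g = sucᵖ (a ▸ g)
  eqᵖ a b = lit 2 ▸ a ▸ b
  andᵖ a b = lit 4 ▸ a ▸ b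
  orᵖ a b = lit 5 ▸ a ▸ b
  impᵖ a b = lit 6 ▸ a ▸ b
  appᵖ f ts = lit 1 ▸ f ▸ ts

  rules : List Rule
  rules =
      ([] ⊸ Vᵖ shᵖ x₀ (varᵖ (sucᵖ x₀)))  -- 0
    ∷ ([] ⊸ Vᵖ (instᵖ x₀) O x₀)
    ∷ ([] ⊸ Vᵖ (instᵖ x₀) (sucᵖ x₁) (varᵖ x₁))
    ∷ ([] ⊸ Vᵖ (liftᵖ x₀) O (varᵖ O))
    ∷ (Vᵖ x₀ x₁ x₂ ∷ Tᵖ shᵖ x₂ x₃ ∷ [] ⊸ Vᵖ (liftᵖ x₀) (sucᵖ x₁) x₃)
    ∷ (Vᵖ x₀ x₁ x₂ ∷ [] ⊸ Tᵖ x₀ (varᵖ x₁) x₂)  -- 5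
    ∷ (Funᵖ x₁ x₂ ∷ Vsᵖ x₂ x₀ x₃ x₄ ∷ [] ⊸ Tᵖ x₀ (appᵖ x₁ x₃) (appᵖ x₁ x₄))
    ∷ ([] ⊸ Vsᵖ O x₀ O O)
    ∷ (Tᵖ x₀ x₁ x₂ ∷ Vsᵖ x₃ x₀ x₄ x₅ ∷ [] ⊸ Vsᵖ (sucᵖ x₃) x₀ (consᵖ x₁ x₄) (consᵖ x₂ x₅))
    ∷ ([] ⊸ Fᵖ x₀ ⊥ᵖ ⊥ᵖ)
    ∷ (Relᵖ x₁ x₂ ∷ Vsᵖ x₂ x₀ x₃ x₄ ∷ [] ⊸ Fᵖ x₀ (appᵖ x₁ x₃) (appᵖ x₁ x₄))  -- 10
    ∷ (Tᵖ x₀ x₁ x₂ ∷ Tᵖ x₀ x₃ x₄ ∷ [] ⊸ Fᵖ x₀ (eqᵖ x₁ x₃) (eqᵖ x₂ x₄))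
    ∷ (Fᵖ x₀ x₁ x₂ ∷ [] ⊸ Fᵖ x₀ (¬ᵖ x₁) (¬ᵖ x₂))
    ∷ (Fᵖ x₀ x₁ x₂ ∷ Fᵖ x₀ x₃ x₄ ∷ [] ⊸ Fᵖ x₀ (andᵖ x₁ x₃) (andᵖ x₂ x₄))
    ∷ (Fᵖ x₀ x₁ x₂ ∷ Fᵖ x₀ x₃ x₄ ∷ [] ⊸ Fᵖ x₀ (orᵖ x₁ x₃) (orᵖ x₂ x₄))
    ∷ (Fᵖ x₀ x₁ x₂ ∷ Fᵖ x₀ x₃ x₄ ∷ [] ⊸ Fᵖ x₀ (impᵖ x₁ x₃) (impᵖ x₂ x₄))  -- 15
    ∷ (Fᵖ (liftᵖ x₀) x₁ x₂ ∷ [] ⊸ Fᵖ x₀ (∀ᵖ x₁) (∀ᵖ x₂))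
    ∷ (Fᵖ (liftᵖ x₀) x₁ x₂ ∷ [] ⊸ Fᵖ x₀ (∃ᵖ x₁) (∃ᵖ x₂))
    ∷ ([] ⊸ Cᵖ O O)
    ∷ (Fᵖ shᵖ x₀ x₁ ∷ Cᵖ x₂ x₃ ∷ [] ⊸ Cᵖ (consᵖ x₀ x₂) (consᵖ x₁ x₃))
    ∷ ([] ⊸ Mᵖ x₀ (consᵖ x₀ x₁))  -- 20
    ∷ (Mᵖ x₀ x₁ ∷ [] ⊸ Mᵖ x₀ (consᵖ x₂ x₁))
    -- `Cᵖ` certifies that `x₀` codes a context, since `Mᵖ` accepts any number as the tail. Likewise
    -- `Fᵖ shᵖ` and `Tᵖ shᵖ` certify a formula or a term in the rules that introduce one from
    -- nowhere.
    ∷ (Cᵖ x₀ x₁ ∷ Mᵖ x₂ x₀ ∷ [] ⊸ Qᵖ x₀ x₂)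
    ∷ (Qᵖ x₀ ⊥ᵖ ∷ Fᵖ shᵖ x₁ x₂ ∷ [] ⊸ Qᵖ x₀ x₁)
    ∷ (Qᵖ (consᵖ (¬ᵖ x₁) x₀) ⊥ᵖ ∷ [] ⊸ Qᵖ x₀ x₁)
    ∷ (Qᵖ (consᵖ x₁ x₀) ⊥ᵖ ∷ [] ⊸ Qᵖ x₀ (¬ᵖ x₁))  -- 25
    ∷ (Qᵖ x₀ (¬ᵖ x₁) ∷ Qᵖ x₀ x₁ ∷ [] ⊸ Qᵖ x₀ ⊥ᵖ)
    ∷ (Qᵖ x₀ x₁ ∷ Qᵖ x₀ x₂ ∷ [] ⊸ Qᵖ x₀ (andᵖ x₁ x₂))
    ∷ (Qᵖ x₀ (andᵖ x₁ x₂) ∷ [] ⊸ Qᵖ x₀ x₁)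
    ∷ (Qᵖ x₀ (andᵖ x₁ x₂) ∷ [] ⊸ Qᵖ x₀ x₂)
    ∷ (Qᵖ x₀ x₁ ∷ Fᵖ shᵖ x₂ x₃ ∷ [] ⊸ Qᵖ x₀ (orᵖ x₁ x₂))  -- 30
    ∷ (Qᵖ x₀ x₂ ∷ Fᵖ shᵖ x₁ x₃ ∷ [] ⊸ Qᵖ x₀ (orᵖ x₁ x₂))
    ∷ (Qᵖ x₀ (orᵖ x₁ x₂) ∷ Qᵖ (consᵖ x₁ x₀) x₃ ∷ Qᵖ (consᵖ x₂ x₀) x₃ ∷ [] ⊸ Qᵖ x₀ x₃)
    ∷ (Qᵖ (consᵖ x₁ x₀) x₂ ∷ [] ⊸ Qᵖ x₀ (impᵖ x₁ x₂))
    ∷ (Qᵖ x₀ (impᵖ x₁ x₂) ∷ Qᵖ x₀ x₁ ∷ [] ⊸ Qᵖ x₀ x₂)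
    ∷ (Cᵖ x₀ x₁ ∷ Qᵖ x₁ x₂ ∷ [] ⊸ Qᵖ x₀ (∀ᵖ x₂))  -- 35
    ∷ (Qᵖ x₀ (∀ᵖ x₁) ∷ Tᵖ shᵖ x₂ x₃ ∷ Fᵖ (instᵖ x₂) x₁ x₄ ∷ [] ⊸ Qᵖ x₀ x₄)
    ∷ (Tᵖ shᵖ x₂ x₃ ∷ Fᵖ (instᵖ x₂) x₁ x₄ ∷ Qᵖ x₀ x₄ ∷ [] ⊸ Qᵖ x₀ (∃ᵖ x₁))
    ∷ (Qᵖ x₀ (∃ᵖ x₁) ∷ Cᵖ x₀ x₂ ∷ Fᵖ shᵖ x₃ x₄ ∷ Qᵖ (consᵖ x₁ x₂) x₄ ∷ [] ⊸ Qᵖ x₀ x₃)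
    ∷ (Cᵖ x₀ x₁ ∷ Tᵖ shᵖ x₂ x₃ ∷ [] ⊸ Qᵖ x₀ (eqᵖ x₂ x₂))
    ∷ (Qᵖ x₀ (eqᵖ x₁ x₂) ∷ Fᵖ (instᵖ x₁) x₃ x₄ ∷ Fᵖ (instᵖ x₂) x₃ x₅ ∷ Qᵖ x₀ x₄ ∷ [] ⊸ Qᵖ x₀ x₅)  -- 40
    ∷ ([] ⊸ Clᵖ O)
    ∷ (Axᵖ x₀ ∷ Clᵖ x₁ ∷ [] ⊸ Clᵖ (consᵖ x₀ x₁))
    ∷ (Qᵖ x₀ x₁ ∷ Clᵖ x₀ ∷ [] ⊸ Thᵖ x₁)
    ∷ []

  funRule : Fin (nFun L) → Rule
  funRule f = [] ⊸ Funᵖ (lit (toℕ f)) (lit (funArity L f))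

  relRule : Fin (nRel L) → Rule
  relRule r = [] ⊸ Relᵖ (lit (toℕ r)) (lit (relArity L r))

  Rules : List Rule
  Rules = rules ++ map funRule (allFin (nFun L)) ++ map relRule (allFin (nRel L))

  factA : ℕ → Atom
  factA x = atom 7 x 0 0 0

  factᴿ : PR¹ (λ x → codeA (factA x))
  factᴿ = toPR¹ (app² pairᴿ (constᴿ 7) (app² pairᴿ (argᴿ fz) (app² pairᴿ (constᴿ 0) (app² pairᴿ (constᴿ 0) (constᴿ 0)))))

  module _ (T : Fm L → Set) (ce : CETheory T) where
    open Horn Rules (proj₁ ce) factA factᴿ public

    Th : ℕ → Atom
    Th a = atom 9 a 0 0 0

    private
      by : ∀ i l → All (λ a → Der (evalA (lookupᴸ l) a)) (premises (Data.List.lookup rules i))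
         → Der (evalA (lookupᴸ l) (conclusion (Data.List.lookup rules i)))
      by i = byRuleᴸ (∈-++⁺ˡ {xs = rules} (∈-lookup {xs = rules} i))

    -- Stated for any code `s` whose values at variables are derivable, rather than for a
    -- `SubstName`: the case of `lift` in `derV` needs the instance for the shift, before `derV` is
    -- available.
    derT : ∀ s σ → (∀ i → Der (atom 0 s i (codeᵀ (σ i)) 0)) → ∀ t → Der (atom 1 s (codeᵀ t) (codeᵀ (substT σ t)) 0)
    derTs : ∀ s σ → (∀ i → Der (atom 0 s i (codeᵀ (σ i)) 0)) → ∀ {k} (ts : Vec (Term L) k) → Der (atom 2 k s (codeᵀs ts) (codeᵀs (substTs σ ts)))
    derT s σ h (var i) = by (# 5) (_ ∷ _ ∷ _ ∷ []) (h i ∷ [])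
    derT s σ h (fun f ts) = by (# 6) (_ ∷ _ ∷ _ ∷ _ ∷ _ ∷ [])
      (byRuleᴸ (∈-++⁺ʳ rules (∈-++⁺ˡ (∈-map⁺ funRule (∈-allFin f)))) [] [] ∷ derTs s σ h ts ∷ [])
    derTs s σ h [] = by (# 7) (_ ∷ []) []
    derTs s σ h {suc k} (t ∷ ts) = by (# 8) (_ ∷ _ ∷ _ ∷ _ ∷ _ ∷ _ ∷ [])
      (derT s σ h t ∷ derTs s σ h ts ∷ [])

    derShift : ∀ t → Der (atom 1 (0 ▹ 0) (codeᵀ t) (codeᵀ (↑ t)) 0)
    derShift = derT (0 ▹ 0) (λ i → var (suc i)) (λ i → by (# 0) (_ ∷ []) [])

    derV : ∀ s i → Der (atom 0 (codeS s) i (codeᵀ (⟪ s ⟫ i)) 0)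
    derV shiftˢ i = by (# 0) (_ ∷ []) []
    derV (inst t) zero = by (# 1) (_ ∷ []) []
    derV (inst t) (suc i) = by (# 2) (_ ∷ _ ∷ []) []
    derV (lift s) zero = by (# 3) (_ ∷ []) []
    derV (lift s) (suc i) = by (# 4) (_ ∷ _ ∷ _ ∷ _ ∷ []) (derV s i ∷ derShift (⟪ s ⟫ i) ∷ [])

    derF : ∀ s φ → Der (atom 3 (codeS s) (codeᶠ φ) (codeᶠ (substF ⟪ s ⟫ φ)) 0)
    derF s ⊥' = by (# 9) (_ ∷ []) []
    derF s (rel r ts) = by (# 10) (_ ∷ _ ∷ _ ∷ _ ∷ _ ∷ [])
      (byRuleᴸ (∈-++⁺ʳ rules (∈-++⁺ʳ (map funRule (allFin (nFun L))) (∈-map⁺ relRule (∈-allFin r)))) [] [] ∷ derTs (codeS s) ⟪ s ⟫ (derV s) ts ∷ [])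
    derF s (t ≐ u) = by (# 11) (_ ∷ _ ∷ _ ∷ _ ∷ _ ∷ [])
      (derT (codeS s) ⟪ s ⟫ (derV s) t ∷ derT (codeS s) ⟪ s ⟫ (derV s) u ∷ [])
    derF s (¬' φ) = by (# 12) (_ ∷ _ ∷ _ ∷ []) (derF s φ ∷ [])
    derF s (φ ∧' ψ) = by (# 13) (_ ∷ _ ∷ _ ∷ _ ∷ _ ∷ []) (derF s φ ∷ derF s ψ ∷ [])
    derF s (φ ∨' ψ) = by (# 14) (_ ∷ _ ∷ _ ∷ _ ∷ _ ∷ []) (derF s φ ∷ derF s ψ ∷ [])
    derF s (φ ⇒' ψ) = by (# 15) (_ ∷ _ ∷ _ ∷ _ ∷ _ ∷ []) (derF s φ ∷ derF s ψ ∷ [])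
    derF s (∀' φ) = by (# 16) (_ ∷ _ ∷ _ ∷ []) (derF (lift s) φ ∷ [])
    derF s (∃' φ) = by (# 17) (_ ∷ _ ∷ _ ∷ []) (derF (lift s) φ ∷ [])

    derC : ∀ Γ → Der (atom 4 (codeC Γ) (codeC (mapF shiftF Γ)) 0 0)
    derC [] = by (# 18) [] []
    derC (φ ∷ Γ) = by (# 19) (_ ∷ _ ∷ _ ∷ _ ∷ []) (derF shiftˢ φ ∷ derC Γ ∷ [])

    derM : ∀ {φ : Fm L} {Γ} → φ ∈ Γ → Der (atom 5 (codeᶠ φ) (codeC Γ) 0 0)
    derM {φ} {ψ ∷ Γ} (here refl) = by (# 20) (_ ∷ _ ∷ []) []
    derM {φ} {ψ ∷ Γ} (there p) = by (# 21) (_ ∷ _ ∷ _ ∷ []) (derM p ∷ [])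

    derQ : ∀ {Γ φ} → Γ ⊢ φ → Der (atom 6 (codeC Γ) (codeᶠ φ) 0 0)
    derQ {Γ} (hyp p) = by (# 22) (_ ∷ _ ∷ _ ∷ []) (derC Γ ∷ derM p ∷ [])
    derQ {Γ} {φ} (⊥E d) = by (# 23) (_ ∷ _ ∷ _ ∷ []) (derQ d ∷ derF shiftˢ φ ∷ [])
    derQ (raa d) = by (# 24) (_ ∷ _ ∷ []) (derQ d ∷ [])
    derQ (¬I d) = by (# 25) (_ ∷ _ ∷ []) (derQ d ∷ [])
    derQ (¬E d e) = by (# 26) (_ ∷ _ ∷ []) (derQ d ∷ derQ e ∷ [])
    derQ (∧I d e) = by (# 27) (_ ∷ _ ∷ _ ∷ []) (derQ d ∷ derQ e ∷ [])
    derQ (∧E₁ d) = by (# 28) (_ ∷ _ ∷ _ ∷ []) (derQ d ∷ [])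
    derQ (∧E₂ d) = by (# 29) (_ ∷ _ ∷ _ ∷ []) (derQ d ∷ [])
    derQ (∨I₁ {φ = φ} {ψ} d) = by (# 30) (_ ∷ _ ∷ _ ∷ _ ∷ []) (derQ d ∷ derF shiftˢ ψ ∷ [])
    derQ (∨I₂ {φ = φ} d) = by (# 31) (_ ∷ _ ∷ _ ∷ _ ∷ []) (derQ d ∷ derF shiftˢ φ ∷ [])
    derQ (∨E d e f) = by (# 32) (_ ∷ _ ∷ _ ∷ _ ∷ []) (derQ d ∷ derQ e ∷ derQ f ∷ [])
    derQ (⇒I d) = by (# 33) (_ ∷ _ ∷ _ ∷ []) (derQ d ∷ [])
    derQ (⇒E d e) = by (# 34) (_ ∷ _ ∷ _ ∷ []) (derQ d ∷ derQ e ∷ [])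
    derQ {Γ} (∀I d) = by (# 35) (_ ∷ _ ∷ _ ∷ []) (derC Γ ∷ derQ d ∷ [])
    derQ (∀E {φ = φ} t d) = by (# 36) (_ ∷ _ ∷ _ ∷ _ ∷ _ ∷ []) (derQ d ∷ derShift t ∷ derF (inst t) φ ∷ [])
    derQ (∃I {φ = φ} t d) = by (# 37) (_ ∷ _ ∷ _ ∷ _ ∷ _ ∷ []) (derShift t ∷ derF (inst t) φ ∷ derQ d ∷ [])
    derQ {Γ} (∃E {φ = φ} {ψ} d e) = by (# 38) (_ ∷ _ ∷ _ ∷ _ ∷ _ ∷ [])
      (derQ d ∷ derC Γ ∷ derF shiftˢ ψ ∷ derQ e ∷ [])
    derQ {Γ} (≐refl t) = by (# 39) (_ ∷ _ ∷ _ ∷ _ ∷ []) (derC Γ ∷ derShift t ∷ [])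
    derQ (≐E {φ = φ} {s} {t} d e) = by (# 40) (_ ∷ _ ∷ _ ∷ _ ∷ _ ∷ _ ∷ [])
      (derQ d ∷ derF (inst s) φ ∷ derF (inst t) φ ∷ derQ e ∷ [])

    derCl : ∀ {Γ} → All T Γ → Der (atom 8 (codeC Γ) 0 0 0)
    derCl [] = by (# 41) [] []
    derCl {φ ∷ Γ} (h ∷ hs) = by (# 42) (_ ∷ _ ∷ [])
      (byFact (codeᶠ φ) (proj₁ q) (proj₂ q) ∷ derCl hs ∷ [])
      where
      q = proj₁ (proj₂ ce (codeᶠ φ)) (φ , h , sym (codeᶠ-code φ))

    Th-complete : ∀ {φ} → T ⊩ φ → Der (Th (codeᶠ φ))
    Th-complete {φ} (Γ , h , d) = by (# 43) (_ ∷ _ ∷ []) (derQ d ∷ derCl h ∷ [])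

    -- Soundness of the Horn system

    -- Rules without premises put arbitrary numbers into `V` and `M` atoms, so these are read
    -- conditionally, for those numbers that are codes. `T`, `Vs`, `F`, `C` and `Q` assert in
    -- addition that the coded expression exists, which lets them certify well-formedness.
    meaning : Atom → Set
    meaning (atom 0 s i t _) = ∀ S → codeS S ≡ s → codeᵀ (⟪ S ⟫ i) ≡ t
    meaning (atom 1 s a b _) = Σ (Term L) λ t → codeᵀ t ≡ a × (∀ S → codeS S ≡ s → codeᵀ (substT ⟪ S ⟫ t) ≡ b)
    meaning (atom 2 k s a b) = Σ (Vec (Term L) k) λ ts → codeᵀs ts ≡ a × (∀ S → codeS S ≡ s → codeᵀs (substTs ⟪ S ⟫ ts) ≡ b)
    meaning (atom 3 s a b _) = Σ (Fm L) λ φ → codeᶠ φ ≡ a × (∀ S → codeS S ≡ s → codeᶠ (substF ⟪ S ⟫ φ) ≡ b)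
    meaning (atom 4 a b _ _) = Σ (List (Fm L)) λ Γ → codeC Γ ≡ a × codeC (mapF shiftF Γ) ≡ b
    meaning (atom 5 a g _ _) = ∀ Γ → codeC Γ ≡ g → Σ (Fm L) λ φ → φ ∈ Γ × codeᶠ φ ≡ a
    meaning (atom 6 g a _ _) = Σ (List (Fm L)) λ Γ → Σ (Fm L) λ φ → codeC Γ ≡ g × codeᶠ φ ≡ a × (Γ ⊢ φ)
    meaning (atom 7 a _ _ _) = Σ (Fm L) λ φ → T φ × codeᶠ φ ≡ a
    meaning (atom 8 g _ _ _) = Σ (List (Fm L)) λ Γ → codeC Γ ≡ g × All T Γ
    meaning (atom 9 a _ _ _) = Σ (Fm L) λ φ → codeᶠ φ ≡ a × (T ⊩ φ)
    meaning (atom 10 f k _ _) = Σ (Fin (nFun L)) λ f' → toℕ f' ≡ f × funArity L f' ≡ k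
    meaning (atom 11 r k _ _) = Σ (Fin (nRel L)) λ r' → toℕ r' ≡ r × relArity L r' ≡ k
    meaning (atom _ _ _ _ _) = ⊤

    private
      Vᵐ Tᵐ Fᵐ : ℕ → ℕ → ℕ → Set
      Vᵐ s i t = meaning (atom 0 s i t 0)
      Tᵐ s a b = meaning (atom 1 s a b 0)
      Fᵐ s a b = meaning (atom 3 s a b 0)
      Vsᵐ : ℕ → ℕ → ℕ → ℕ → Set
      Vsᵐ k s a b = meaning (atom 2 k s a b)
      Cᵐ Mᵐ Qᵐ : ℕ → ℕ → Set
      Cᵐ a b = meaning (atom 4 a b 0 0)
      Mᵐ a b = meaning (atom 5 a b 0 0)
      Qᵐ a b = meaning (atom 6 a b 0 0)

      sh : ℕ
      sh = 0 ▹ 0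

      cst : ℕ → ℕ → ℕ
      cst a g = suc (a ▹ g)

      V-shift : ∀ i → Vᵐ sh i (0 ▹ suc i)
      V-shift i S h with inv-shift S h
      ... | refl = refl

      V-inst₀ : ∀ t → Vᵐ (1 ▹ t) 0 t
      V-inst₀ t S h with inv-inst S h
      ... | t' , refl , refl = refl

      V-instₛ : ∀ t i → Vᵐ (1 ▹ t) (suc i) (0 ▹ i)
      V-instₛ t i S h with inv-inst S h
      ... | t' , refl , refl = refl

      V-lift₀ : ∀ s → Vᵐ (2 ▹ s) 0 (0 ▹ 0)
      V-lift₀ s S h with inv-lift S h
      ... | S' , refl , refl = refl

      V-liftₛ : ∀ {s i t t'} → Vᵐ s i t → Tᵐ sh t t' → Vᵐ (2 ▹ s) (suc i) t'
      V-liftₛ {i = i} v (t , refl , f) S h with inv-lift S h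
      ... | S' , refl , refl with codeᵀ-inj (⟪ S' ⟫ i) t (v S' refl)
      ... | refl = f shiftˢ refl

      T-var : ∀ {s i t} → Vᵐ s i t → Tᵐ s (0 ▹ i) t
      T-var {i = i} v = var i , refl , v

      T-fun : ∀ {s f k a b} → meaning (atom 10 f k 0 0) → Vsᵐ k s a b → Tᵐ s (1 ▹ f ▹ a) (1 ▹ f ▹ b)
      T-fun (f , refl , refl) (ts , refl , g) = fun f ts , refl , λ S h → cong (λ c → 1 ▹ toℕ f ▹ c) (g S h)

      Vs-cons : ∀ {s a b k as bs} → Tᵐ s a b → Vsᵐ k s as bs → Vsᵐ (suc k) s (cst a as) (cst b bs)
      Vs-cons (t , refl , g) (ts , refl , gs) = t ∷ ts , refl , λ S h → cong₂ cst (g S h) (gs S h)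

      F-rel : ∀ {s r k a b} → meaning (atom 11 r k 0 0) → Vsᵐ k s a b → Fᵐ s (1 ▹ r ▹ a) (1 ▹ r ▹ b)
      F-rel (r , refl , refl) (ts , refl , g) = rel r ts , refl , λ S h → cong (λ c → 1 ▹ toℕ r ▹ c) (g S h)

      F-eq : ∀ {s a b c d} → Tᵐ s a b → Tᵐ s c d → Fᵐ s (2 ▹ a ▹ c) (2 ▹ b ▹ d)
      F-eq (t , refl , f) (u , refl , g) = (t ≐ u) , refl , λ S h → cong₂ (λ x y → 2 ▹ x ▹ y) (f S h) (g S h)

      F-un : ∀ {s s' a b} n (op : Fm L → Fm L) (ls : SubstName → SubstName) → (∀ φ → codeᶠ (op φ) ≡ n ▹ codeᶠ φ)
           → (∀ S φ → substF ⟪ S ⟫ (op φ) ≡ op (substF ⟪ ls S ⟫ φ)) → (∀ S → codeS S ≡ s → codeS (ls S) ≡ s')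
           → Fᵐ s' a b → Fᵐ s (n ▹ a) (n ▹ b)
      F-un n op ls e e' k (φ , refl , f) = op φ , e φ , λ S h →
        trans (cong codeᶠ (e' S φ)) (trans (e _) (cong (n ▹_) (f (ls S) (k S h))))

      F-bin : ∀ {s a b c d} n (op : Fm L → Fm L → Fm L) → (∀ φ ψ → codeᶠ (op φ ψ) ≡ n ▹ codeᶠ φ ▹ codeᶠ ψ)
            → (∀ S φ ψ → substF ⟪ S ⟫ (op φ ψ) ≡ op (substF ⟪ S ⟫ φ) (substF ⟪ S ⟫ ψ))
            → Fᵐ s a b → Fᵐ s c d → Fᵐ s (n ▹ a ▹ c) (n ▹ b ▹ d)
      F-bin n op e e' (φ , refl , f) (ψ , refl , g) = op φ ψ , e φ ψ , λ S h →
        trans (cong codeᶠ (e' S φ ψ)) (trans (e _ _) (cong₂ (λ x y → n ▹ x ▹ y) (f S h) (g S h)))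

      C-cons : ∀ {a b g h} → Fᵐ sh a b → Cᵐ g h → Cᵐ (cst a g) (cst b h)
      C-cons (φ , refl , f) (Γ , refl , refl) = φ ∷ Γ , refl , cong (λ c → cst c _) (f shiftˢ refl)

      M-here : ∀ a g → Mᵐ a (cst a g)
      M-here a g Γ h with inv-cons Γ h
      ... | φ , Δ , refl , refl , refl = φ , here refl , refl

      M-there : ∀ {a g} b → Mᵐ a g → Mᵐ a (cst b g)
      M-there b m Γ h with inv-cons Γ h
      ... | ψ , Δ , refl , refl , refl with m Δ refl
      ... | φ , p , k = φ , there p , k

      at : ∀ {Γ Δ φ ψ} → codeC Γ ≡ codeC Δ → codeᶠ φ ≡ codeᶠ ψ → Γ ⊢ φ → Δ ⊢ ψ
      at {Γ} {Δ} {φ} {ψ} h k d = subst₂ _⊢_ (codeC-inj Γ Δ h) (code-inj φ ψ k) d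

      Q-hyp : ∀ {g g' a} → Cᵐ g g' → Mᵐ a g → Qᵐ g a
      Q-hyp (Γ , refl , _) m with m Γ refl
      ... | φ , p , h = Γ , φ , refl , h , hyp p

      Q-⊥E : ∀ {g a b} → Qᵐ g (0 ▹ 0) → Fᵐ sh a b → Qᵐ g a
      Q-⊥E (Γ , χ , refl , k , d) (φ , refl , _) with inv⊥ χ k
      ... | refl = Γ , φ , refl , refl , ⊥E d

      Q-raa : ∀ {g a} → Qᵐ (cst (3 ▹ a) g) (0 ▹ 0) → Qᵐ g a
      Q-raa (Γ , χ , h , k , d) with inv⊥ χ k | inv-cons Γ h
      ... | refl | ψ , Δ , refl , l , refl with inv¬ ψ l
      ... | φ , refl , refl = Δ , φ , refl , refl , raa d

      Q-¬I : ∀ {g a} → Qᵐ (cst a g) (0 ▹ 0) → Qᵐ g (3 ▹ a)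
      Q-¬I (Γ , χ , h , k , d) with inv⊥ χ k | inv-cons Γ h
      ... | refl | φ , Δ , refl , refl , refl = Δ , ¬' φ , refl , refl , ¬I d

      Q-¬E : ∀ {g a} → Qᵐ g (3 ▹ a) → Qᵐ g a → Qᵐ g (0 ▹ 0)
      Q-¬E (Γ , χ , refl , k , d) (Γ' , φ' , h , k' , e) with inv¬ χ k
      ... | φ , refl , refl = Γ , ⊥' , refl , refl , ¬E d (at h k' e)

      Q-∧I : ∀ {g a b} → Qᵐ g a → Qᵐ g b → Qᵐ g (4 ▹ a ▹ b)
      Q-∧I (Γ , φ , refl , refl , d) (Γ' , ψ , h , refl , e) = Γ , φ ∧' ψ , refl , refl , ∧I d (at h refl e)

      Q-∧E₁ : ∀ {g a b} → Qᵐ g (4 ▹ a ▹ b) → Qᵐ g a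
      Q-∧E₁ {g} {a} {b} (Γ , χ , refl , k , d) with inv∧ χ {a} {b} k
      ... | φ , ψ , refl , refl , refl = Γ , φ , refl , refl , ∧E₁ d

      Q-∧E₂ : ∀ {g a b} → Qᵐ g (4 ▹ a ▹ b) → Qᵐ g b
      Q-∧E₂ {g} {a} {b} (Γ , χ , refl , k , d) with inv∧ χ {a} {b} k
      ... | φ , ψ , refl , refl , refl = Γ , ψ , refl , refl , ∧E₂ d

      Q-∨I₁ : ∀ {g a b c} → Qᵐ g a → Fᵐ sh b c → Qᵐ g (5 ▹ a ▹ b)
      Q-∨I₁ (Γ , φ , refl , refl , d) (ψ , refl , _) = Γ , φ ∨' ψ , refl , refl , ∨I₁ d

      Q-∨I₂ : ∀ {g a b c} → Qᵐ g b → Fᵐ sh a c → Qᵐ g (5 ▹ a ▹ b)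
      Q-∨I₂ (Γ , φ , refl , refl , d) (ψ , refl , _) = Γ , ψ ∨' φ , refl , refl , ∨I₂ d

      Q-∨E : ∀ {g a b c} → Qᵐ g (5 ▹ a ▹ b) → Qᵐ (cst a g) c → Qᵐ (cst b g) c → Qᵐ g c
      Q-∨E {g} {a} {b} (Γ , χ , refl , k , d) (Γ₁ , θ , h₁ , refl , e) (Γ₂ , θ' , h₂ , k₂ , f) with inv∨ χ {a} {b} k
      ... | φ , ψ , refl , refl , refl = Γ , θ , refl , refl , ∨E d (at h₁ refl e) (at h₂ k₂ f)

      Q-⇒I : ∀ {g a b} → Qᵐ (cst a g) b → Qᵐ g (6 ▹ a ▹ b)
      Q-⇒I (Γ , ψ , h , refl , d) with inv-cons Γ h
      ... | φ , Δ , refl , refl , refl = Δ , (φ ⇒' ψ) , refl , refl , ⇒I d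

      Q-⇒E : ∀ {g a b} → Qᵐ g (6 ▹ a ▹ b) → Qᵐ g a → Qᵐ g b
      Q-⇒E {g} {a} {b} (Γ , χ , refl , k , d) (Γ' , φ' , h , k' , e) with inv⇒ χ {a} {b} k
      ... | φ , ψ , refl , refl , refl = Γ , ψ , refl , refl , ⇒E d (at h k' e)

      Q-∀I : ∀ {g g' a} → Cᵐ g g' → Qᵐ g' a → Qᵐ g (7 ▹ a)
      Q-∀I (Γ , refl , refl) (Γ' , φ , h , refl , d) = Γ , ∀' φ , refl , refl , ∀I (at h refl d)

      Q-∀E : ∀ {g a t t' b} → Qᵐ g (7 ▹ a) → Tᵐ sh t t' → Fᵐ (1 ▹ t) a b → Qᵐ g b
      Q-∀E {a = a} (Γ , χ , refl , k , d) (t , refl , _) (φ' , h , f) with inv∀ χ {a} k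
      ... | φ , refl , refl with code-inj φ' φ h
      ... | refl = Γ , φ [ t ] , refl , f (inst t) refl , ∀E t d

      Q-∃I : ∀ {g a t t' b} → Tᵐ sh t t' → Fᵐ (1 ▹ t) a b → Qᵐ g b → Qᵐ g (8 ▹ a)
      Q-∃I (t , refl , _) (φ , refl , f) (Γ , ψ , refl , h , d) = Γ , ∃' φ , refl , refl , ∃I t (at refl (trans h (sym (f (inst t) refl))) d)

      Q-∃E : ∀ {g a g' b b'} → Qᵐ g (8 ▹ a) → Cᵐ g g' → Fᵐ sh b b' → Qᵐ (cst a g') b' → Qᵐ g b
      Q-∃E {a = a} (Γ , χ , refl , k , d) (Γ' , h , refl) (ψ , refl , f) (Δ , ψ' , h' , k' , e) with inv∃ χ {a} k | codeC-inj Γ' Γ h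
      ... | φ , refl , refl | refl = Γ , ψ , refl , refl , ∃E d (at h' (trans k' (sym (f shiftˢ refl))) e)

      Q-refl : ∀ {g g' t t'} → Cᵐ g g' → Tᵐ sh t t' → Qᵐ g (2 ▹ t ▹ t)
      Q-refl (Γ , refl , _) (t , refl , _) = Γ , (t ≐ t) , refl , refl , ≐refl t

      Q-≐E : ∀ {g s t a b c} → Qᵐ g (2 ▹ s ▹ t) → Fᵐ (1 ▹ s) a b → Fᵐ (1 ▹ t) a c → Qᵐ g b → Qᵐ g c
      Q-≐E {g} {s} {t} (Γ , χ , refl , k , d) (φ , refl , f) (φ' , h , f') (Γ' , ψ , h' , k' , e) with inv≐ χ {s} {t} k | code-inj φ' φ h
      ... | s' , t' , refl , refl , refl | refl = Γ , φ [ t' ] , refl , f' (inst t') refl ,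
            ≐E {φ = φ} d (at h' (trans k' (sym (f (inst s') refl))) e)

      Cl-cons : ∀ {a g} → meaning (atom 7 a 0 0 0) → meaning (atom 8 g 0 0 0) → meaning (atom 8 (cst a g) 0 0 0)
      Cl-cons (φ , h , refl) (Γ , refl , hs) = φ ∷ Γ , refl , h ∷ hs

      Th-intro : ∀ {g a} → Qᵐ g a → meaning (atom 8 g 0 0 0) → meaning (atom 9 a 0 0 0)
      Th-intro (Γ , φ , refl , refl , d) (Γ' , h , hs) = φ , refl , Γ , subst (All T) (codeC-inj Γ' Γ h) hs , d

    Sound : Rule → Set
    Sound r = ∀ (e : ℕ → ℕ) → All (λ a → meaning (evalA e a)) (premises r) → meaning (evalA e (conclusion r))

    sound-rules : All Sound rules
    sound-rules =
        (λ { e [] → V-shift _ })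
      ∷ (λ { e [] → V-inst₀ _ })
      ∷ (λ { e [] → V-instₛ _ _ })
      ∷ (λ { e [] → V-lift₀ _ })
      ∷ (λ { e (p ∷ q ∷ []) → V-liftₛ {i = e 1} {e 2} p q })
      ∷ (λ { e (p ∷ []) → T-var p })
      ∷ (λ { e (p ∷ q ∷ []) → T-fun p q })
      ∷ (λ { e [] → [] , refl , λ _ _ → refl })
      ∷ (λ { e (p ∷ q ∷ []) → Vs-cons p q })
      ∷ (λ { e [] → ⊥' , refl , λ _ _ → refl })
      ∷ (λ { e (p ∷ q ∷ []) → F-rel p q })
      ∷ (λ { e (p ∷ q ∷ []) → F-eq p q })
      ∷ (λ { e (p ∷ []) → F-un 3 ¬' id (λ _ → refl) (λ _ _ → refl) (λ _ h → h) p })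
      ∷ (λ { e (p ∷ q ∷ []) → F-bin 4 _∧'_ (λ _ _ → refl) (λ _ _ _ → refl) p q })
      ∷ (λ { e (p ∷ q ∷ []) → F-bin 5 _∨'_ (λ _ _ → refl) (λ _ _ _ → refl) p q })
      ∷ (λ { e (p ∷ q ∷ []) → F-bin 6 _⇒'_ (λ _ _ → refl) (λ _ _ _ → refl) p q })
      ∷ (λ { e (p ∷ []) → F-un 7 ∀' lift (λ _ → refl) (λ _ _ → refl) (λ _ h → cong (2 ▹_) h) p })
      ∷ (λ { e (p ∷ []) → F-un 8 ∃' lift (λ _ → refl) (λ _ _ → refl) (λ _ h → cong (2 ▹_) h) p })
      ∷ (λ { e [] → [] , refl , refl })
      ∷ (λ { e (p ∷ q ∷ []) → C-cons p q })
      ∷ (λ { e [] → M-here _ _ })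
      ∷ (λ { e (p ∷ []) → M-there (e 2) p })
      ∷ (λ { e (p ∷ q ∷ []) → Q-hyp {e 0} {e 1} p q })
      ∷ (λ { e (p ∷ q ∷ []) → Q-⊥E p q })
      ∷ (λ { e (p ∷ []) → Q-raa p })
      ∷ (λ { e (p ∷ []) → Q-¬I p })
      ∷ (λ { e (p ∷ q ∷ []) → Q-¬E p q })
      ∷ (λ { e (p ∷ q ∷ []) → Q-∧I p q })
      ∷ (λ { e (p ∷ []) → Q-∧E₁ p })
      ∷ (λ { e (p ∷ []) → Q-∧E₂ p })
      ∷ (λ { e (p ∷ q ∷ []) → Q-∨I₁ p q })
      ∷ (λ { e (p ∷ q ∷ []) → Q-∨I₂ p q })
      ∷ (λ { e (p ∷ q ∷ r ∷ []) → Q-∨E p q r })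
      ∷ (λ { e (p ∷ []) → Q-⇒I p })
      ∷ (λ { e (p ∷ q ∷ []) → Q-⇒E p q })
      ∷ (λ { e (p ∷ q ∷ []) → Q-∀I p q })
      ∷ (λ { e (p ∷ q ∷ r ∷ []) → Q-∀E p q r })
      ∷ (λ { e (p ∷ q ∷ r ∷ []) → Q-∃I p q r })
      ∷ (λ { e (p ∷ q ∷ r ∷ s ∷ []) → Q-∃E p q r s })
      ∷ (λ { e (p ∷ q ∷ []) → Q-refl p q })
      ∷ (λ { e (p ∷ q ∷ r ∷ s ∷ []) → Q-≐E p q r s })
      ∷ (λ { e [] → [] , refl , [] })
      ∷ (λ { e (p ∷ q ∷ []) → Cl-cons p q })
      ∷ (λ { e (p ∷ q ∷ []) → Th-intro p q })
      ∷ []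

    sound-Rules : All Sound Rules
    sound-Rules = ++⁺ sound-rules (++⁺
      (All-map⁺ (All.tabulate {xs = allFin (nFun L)} (λ {f} _ e _ → f , refl , refl)))
      (All-map⁺ (All.tabulate {xs = allFin (nRel L)} (λ {r} _ e _ → r , refl , refl))))

    mutual
      Der-sound : ∀ {x} → Der x → meaning x
      Der-sound (byRule {r} q e ds) = All.lookup sound-Rules q (nthᶜ e) (Ders-sound (premises r) e ds)
      Der-sound (byFact x y h) with proj₂ (proj₂ ce x) (y , h)
      ... | φ , t , k = φ , t , trans (codeᶠ-code φ) k

      Ders-sound : ∀ as e → All (λ a → Der (evalA (nthᶜ e) a)) as → All (λ a → meaning (evalA (nthᶜ e) a)) as
      Ders-sound [] e [] = []
      Ders-sound (a ∷ as) e (d ∷ ds) = Der-sound d ∷ Ders-sound as e ds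

    Th-sound : ∀ {φ} → Der (Th (codeᶠ φ)) → T ⊩ φ
    Th-sound {φ} d with Der-sound d
    ... | ψ , h , t = subst (T ⊩_) (code-inj ψ φ h) t

-- Alternating normal forms for formulas of bounded complexity.

module Prenex (L : Lang) where

  -- Literals are kept flat: their arguments are variables, and a function symbol occurs only
  -- through its graph, with the value as first argument. As the language is finite, satisfaction of
  -- literals becomes a finite case distinction.
  data Sym : Set where
    eqˢ  : Sym
    relˢ : Fin (nRel L) → Sym
    funˢ : Fin (nFun L) → Sym

  arity : Sym → ℕ
  arity eqˢ = 2
  arity (relˢ r) = relArity L r
  arity (funˢ f) = suc (funArity L f)

  symP : ∀ s → Pred {L} (arity s)
  symP eqˢ = eqᴾ fz (fs fz)
  symP (relˢ r) = record { fm = rel r ; nat = λ _ _ → refl }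
  symP (funˢ f) = record { fm = λ { (y ∷ ts) → y ≐ fun f ts } ; nat = λ { _ (y ∷ ts) → refl } }

  litP : Bool → ∀ s → Pred {L} (arity s)
  litP b s = if b then symP s else ¬ᴾ (symP s)

  -- Alternating normal forms in scope j: a formula of level n + 1 is a block of existential
  -- quantifiers in front of a conjunction of negated formulas of level n.
  data Nf : ℕ → ℕ → Set where
    at : ∀ {j} → Bool → (s : Sym) → Vec (Fin j) (arity s) → Nf 0 j
    cj : ∀ {n j} → List (Nf n j) → Nf (suc n) j
    ex : ∀ {n j} → Nf (suc n) (suc j) → Nf (suc n) j

  lookups-subst : ∀ {j k} τ (ts : Vec (Term L) j) (is : Vec (Fin j) k) → substTs τ (mapⱽ (lookup ts) is) ≡ mapⱽ (lookup (substTs τ ts)) is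
  lookups-subst τ ts [] = refl
  lookups-subst τ ts (i ∷ is) = cong₂ _∷_ (lookup-subst τ ts i) (lookups-subst τ ts is)

  mutual
    ⟦_⟧ : ∀ {n j} → Nf n j → Pred {L} j
    ⟦ at b s is ⟧ = sub (litP b s) (λ ts → mapⱽ (lookup ts) is) (λ τ ts → lookups-subst τ ts is)
    ⟦ cj l ⟧ = ⋀¬ l
    ⟦ ex χ ⟧ = ∃ᴾ ⟦ χ ⟧

    ⋀¬ : ∀ {n j} → List (Nf n j) → Pred {L} j
    ⋀¬ [] = ¬ᴾ ⊥ᴾ
    ⋀¬ (χ ∷ l) = ¬ᴾ ⟦ χ ⟧ ∧ᴾ ⋀¬ l

  liftᶠ : ∀ {i j} → (Fin i → Fin j) → Fin (suc i) → Fin (suc j)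
  liftᶠ ρ fz = fz
  liftᶠ ρ (fs i) = fs (ρ i)

  mutual
    ren : ∀ {n i j} → (Fin i → Fin j) → Nf n i → Nf n j
    ren ρ (at b s is) = at b s (mapⱽ ρ is)
    ren ρ (cj l) = cj (rens ρ l)
    ren ρ (ex χ) = ex (ren (liftᶠ ρ) χ)

    rens : ∀ {n i j} → (Fin i → Fin j) → List (Nf n i) → List (Nf n j)
    rens ρ [] = []
    rens ρ (χ ∷ l) = ren ρ χ ∷ rens ρ l

  pull : ∀ {i j} → (Fin i → Fin j) → Vec (Term L) j → Vec (Term L) i
  pull ρ ts = tabulate (λ i → lookup ts (ρ i))

  pull-map : ∀ {i j k} (ρ : Fin i → Fin j) ts (is : Vec (Fin i) k) → mapⱽ (lookup ts) (mapⱽ ρ is) ≡ mapⱽ (lookup (pull ρ ts)) is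
  pull-map ρ ts [] = refl
  pull-map ρ ts (i ∷ is) = cong₂ _∷_ (sym (lookup∘tabulate (λ i → lookup ts (ρ i)) i)) (pull-map ρ ts is)

  substTs-tabulate : ∀ {k} τ (f : Fin k → Term L) → substTs τ (tabulate f) ≡ tabulate (λ i → substT τ (f i))
  substTs-tabulate {zero} τ f = refl
  substTs-tabulate {suc k} τ f = cong (substT τ (f fz) ∷_) (substTs-tabulate τ (λ i → f (fs i)))

  pull-lift : ∀ {i j} (ρ : Fin i → Fin j) τ t ts → pull (liftᶠ ρ) (t ∷ substTs τ ts) ≡ t ∷ substTs τ (pull ρ ts)
  pull-lift ρ τ t ts = cong (t ∷_) (trans (tabulate-cong (λ i → sym (lookup-subst τ ts (ρ i)))) (sym (substTs-tabulate τ _)))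

  mutual
    ren-fm : ∀ {n i j} (ρ : Fin i → Fin j) (χ : Nf n i) ts → fm ⟦ ren ρ χ ⟧ ts ≡ fm ⟦ χ ⟧ (pull ρ ts)
    ren-fm ρ (at b s is) ts = cong (fm (litP b s)) (pull-map ρ ts is)
    ren-fm ρ (cj l) ts = rens-fm ρ l ts
    ren-fm ρ (ex χ) ts = cong ∃' (trans (ren-fm (liftᶠ ρ) χ _) (cong (fm ⟦ χ ⟧) (pull-lift ρ shiftσ (var 0) ts)))

    rens-fm : ∀ {n i j} (ρ : Fin i → Fin j) (l : List (Nf n i)) ts → fm (⋀¬ (rens ρ l)) ts ≡ fm (⋀¬ l) (pull ρ ts)
    rens-fm ρ [] ts = refl
    rens-fm ρ (χ ∷ l) ts = cong₂ (λ a b → ¬' a ∧' b) (ren-fm ρ χ ts) (rens-fm ρ l ts)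

  infix 3 _≈_
  record _≈_ (φ ψ : Fm L) : Set where
    constructor equiv
    field
      to   : ∀ {Γ} → Γ ⊢ φ → Γ ⊢ ψ
      from : ∀ {Γ} → Γ ⊢ ψ → Γ ⊢ φ
  open _≈_ public

  ≈-refl : ∀ {φ} → φ ≈ φ
  ≈-refl = equiv id id

  ≡⇒≈ : ∀ {φ ψ} → φ ≡ ψ → φ ≈ ψ
  ≡⇒≈ refl = ≈-refl

  ≈-sym : ∀ {φ ψ} → φ ≈ ψ → ψ ≈ φ
  ≈-sym e = equiv (from e) (to e)

  ≈-trans : ∀ {φ ψ χ} → φ ≈ ψ → ψ ≈ χ → φ ≈ χ
  ≈-trans e f = equiv (to f ∘ to e) (from e ∘ from f)

  ∧-cong : ∀ {φ φ' ψ ψ'} → φ ≈ φ' → ψ ≈ ψ' → φ ∧' ψ ≈ φ' ∧' ψ'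
  ∧-cong e f = equiv (λ d → ∧I (to e (∧E₁ d)) (to f (∧E₂ d))) (λ d → ∧I (from e (∧E₁ d)) (from f (∧E₂ d)))

  ∨-cong : ∀ {φ φ' ψ ψ'} → φ ≈ φ' → ψ ≈ ψ' → φ ∨' ψ ≈ φ' ∨' ψ'
  ∨-cong e f = equiv (λ d → orE d (λ h → ∨I₁ (to e h)) (λ h → ∨I₂ (to f h))) (λ d → orE d (λ h → ∨I₁ (from e h)) (λ h → ∨I₂ (from f h)))

  ¬-cong : ∀ {φ ψ} → φ ≈ ψ → ¬' φ ≈ ¬' ψ
  ¬-cong e = equiv (λ d → negI (λ h → ¬E (w1 d) (from e h))) (λ d → negI (λ h → ¬E (w1 d) (to e h)))

  ¬¬-elim : ∀ {φ} → ¬' (¬' φ) ≈ φ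
  ¬¬-elim = equiv (λ d → raa (¬E (w1 d) hyp0)) (λ d → negI (λ h → ¬E h (w1 d)))

  ¬∧-≈ : ∀ {φ ψ} → ¬' (φ ∧' ψ) ≈ ¬' φ ∨' ¬' ψ
  ¬∧-≈ {φ} {ψ} = equiv
    (λ d → orE (em φ) (λ h → ∨I₂ (negI (λ g → ¬E (w2 d) (∧I (w1 h) g)))) ∨I₁)
    (λ d → negI (λ h → orE (w1 d) (λ g → ¬E g (∧E₁ (w1 h))) (λ g → ¬E g (∧E₂ (w1 h)))))

  ¬∨-≈ : ∀ {φ ψ} → ¬' (φ ∨' ψ) ≈ ¬' φ ∧' ¬' ψ
  ¬∨-≈ = equiv (λ d → ∧I (negI (λ h → ¬E (w1 d) (∨I₁ h))) (negI (λ h → ¬E (w1 d) (∨I₂ h))))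
    (λ d → negI (λ h → orE h (λ g → ¬E (∧E₁ (w2 d)) g) (λ g → ¬E (∧E₂ (w2 d)) g)))

  ⇒-≈ : ∀ {φ ψ} → (φ ⇒' ψ) ≈ ¬' φ ∨' ψ
  ⇒-≈ {φ} = equiv (λ d → orE (em φ) (λ h → ∨I₂ (⇒E (w1 d) h)) ∨I₁)
    (λ d → impI (λ h → orE (w1 d) (λ g → ⊥E (¬E g (w1 h))) id))

  ¬⇒-≈ : ∀ {φ ψ} → ¬' (φ ⇒' ψ) ≈ φ ∧' ¬' ψ
  ¬⇒-≈ = equiv (λ d → ∧I (raa (¬E (w1 d) (impI (λ h → ⊥E (¬E (hyp (there (here refl))) h))))) (negI (λ h → ¬E (w1 d) (impI (λ _ → w1 h)))))
    (λ d → negI (λ h → ¬E (∧E₂ (w1 d)) (⇒E h (∧E₁ (w1 d)))))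

  ¬∀-≈ : ∀ {φ : Fm L} → ¬' (∀' φ) ≈ ∃' (¬' φ)
  ¬∀-≈ {φ} = equiv (λ d → raa (¬E (w1 d) (∀I-fresh φ (λ t → raa (¬E (hyp (there (here refl))) (∃I t hyp0))))))
    (λ d → ∃E-fresh (¬' φ) d (λ t → negI (λ h → ¬E (hyp (there (here refl))) (∀E t h))))

  -- Boolean operations on normal forms

  and-cj : ∀ {n j} → List (Nf n j) → Nf (suc n) j → Nf (suc n) j
  and-cj l (cj l') = cj (l ++ l')
  and-cj l (ex χ) = ex (and-cj (rens fs l) χ)

  and-nf : ∀ {n j} → Nf (suc n) j → Nf (suc n) j → Nf (suc n) j
  and-nf (cj l) χ = and-cj l χ
  and-nf (ex χ) χ' = ex (and-nf χ (ren fs χ'))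

  and-all : ∀ {n j} → Nf (suc n) j → List (Nf (suc n) j) → List (Nf (suc n) j)
  and-all χ [] = []
  and-all χ (χ' ∷ l) = and-nf χ χ' ∷ and-all χ l

  -- The distributive law: a disjunction of two conjunctions of negations is the conjunction of
  -- `¬ (χ ∧ χ')` over all pairs. Conjunction preserves a level only from 1 on, so disjunction is
  -- available from level 2 on.
  and-pairs : ∀ {n j} → List (Nf (suc n) j) → List (Nf (suc n) j) → List (Nf (suc n) j)
  and-pairs [] l' = []
  and-pairs (χ ∷ l) l' = and-all χ l' ++ and-pairs l l'

  or-cj : ∀ {n j} → List (Nf (suc n) j) → Nf (suc (suc n)) j → Nf (suc (suc n)) j
  or-cj l (cj l') = cj (and-pairs l l')
  or-cj l (ex χ) = ex (or-cj (rens fs l) χ)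

  or-nf : ∀ {n j} → Nf (suc (suc n)) j → Nf (suc (suc n)) j → Nf (suc (suc n)) j
  or-nf (cj l) χ = or-cj l χ
  or-nf (ex χ) χ' = ex (or-nf χ (ren fs χ'))

  ⊤-intro : ∀ {Γ} → Γ ⊢ ¬' (⊥' {L})
  ⊤-intro = negI id

  ⋀¬-++ : ∀ {n j} (l l' : List (Nf n j)) ts → fm (⋀¬ (l ++ l')) ts ≈ fm (⋀¬ l) ts ∧' fm (⋀¬ l') ts
  ⋀¬-++ [] l' ts = equiv (λ d → ∧I ⊤-intro d) ∧E₂
  ⋀¬-++ (χ ∷ l) l' ts = ≈-trans (∧-cong ≈-refl (⋀¬-++ l l' ts))
    (equiv (λ d → ∧I (∧I (∧E₁ d) (∧E₁ (∧E₂ d))) (∧E₂ (∧E₂ d))) (λ d → ∧I (∧E₁ (∧E₁ d)) (∧I (∧E₂ (∧E₁ d)) (∧E₂ d))))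

  pull-fs : ∀ {j} t (ts : Vec (Term L) j) → pull fs (t ∷ ts) ≡ ts
  pull-fs t ts = tabulate∘lookup ts

  ren-fs : ∀ {n j} (χ : Nf n j) t ts → fm ⟦ ren fs χ ⟧ (t ∷ ts) ≈ fm ⟦ χ ⟧ ts
  ren-fs χ t ts = ≡⇒≈ (trans (ren-fm fs χ (t ∷ ts)) (cong (fm ⟦ χ ⟧) (pull-fs t ts)))

  rens-fs : ∀ {n j} (l : List (Nf n j)) t ts → fm (⋀¬ (rens fs l)) (t ∷ ts) ≈ fm (⋀¬ l) ts
  rens-fs l t ts = ≡⇒≈ (trans (rens-fm fs l (t ∷ ts)) (cong (fm (⋀¬ l)) (pull-fs t ts)))

  ∃-∧-right : ∀ {k} (P R : Pred {L} (suc k)) {ts φ} → (∀ t → fm R (t ∷ ts) ≈ φ ∧' fm P (t ∷ ts)) → fm (∃ᴾ R) ts ≈ φ ∧' fm (∃ᴾ P) ts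
  ∃-∧-right P R {ts} {φ} e = equiv
    (λ d → exE R d (λ t h → ∧I (∧E₁ (to (e t) h)) (exI P t (∧E₂ (to (e t) h)))))
    (λ d → exE P (∧E₂ d) (λ t h → exI R t (from (e t) (∧I (w1 (∧E₁ d)) h))))

  ∃-∧-left : ∀ {k} (P R : Pred {L} (suc k)) {ts φ} → (∀ t → fm R (t ∷ ts) ≈ fm P (t ∷ ts) ∧' φ) → fm (∃ᴾ R) ts ≈ fm (∃ᴾ P) ts ∧' φ
  ∃-∧-left P R {ts} {φ} e = equiv
    (λ d → exE R d (λ t h → ∧I (exI P t (∧E₁ (to (e t) h))) (∧E₂ (to (e t) h))))
    (λ d → exE P (∧E₁ d) (λ t h → exI R t (from (e t) (∧I h (w1 (∧E₂ d))))))

  -- Pulling an existential quantifier out of a disjunction needs a nonempty domain; any term would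
  -- do.
  someTerm : Term L
  someTerm = var 0

  ∃-∨-right : ∀ {k} (P R : Pred {L} (suc k)) {ts φ} → (∀ t → fm R (t ∷ ts) ≈ φ ∨' fm P (t ∷ ts)) → fm (∃ᴾ R) ts ≈ φ ∨' fm (∃ᴾ P) ts
  ∃-∨-right P R {ts} {φ} e = equiv
    (λ d → exE R d (λ t h → orE (to (e t) h) ∨I₁ (λ g → ∨I₂ (exI P t g))))
    (λ d → orE d (λ h → exI R someTerm (from (e someTerm) (∨I₁ h))) (λ h → exE P h (λ t g → exI R t (from (e t) (∨I₂ g)))))

  ∃-∨-left : ∀ {k} (P R : Pred {L} (suc k)) {ts φ} → (∀ t → fm R (t ∷ ts) ≈ fm P (t ∷ ts) ∨' φ) → fm (∃ᴾ R) ts ≈ fm (∃ᴾ P) ts ∨' φ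
  ∃-∨-left P R {ts} {φ} e = equiv
    (λ d → exE R d (λ t h → orE (to (e t) h) (λ g → ∨I₁ (exI P t g)) ∨I₂))
    (λ d → orE d (λ h → exE P h (λ t g → exI R t (from (e t) (∨I₁ g)))) (λ h → exI R someTerm (from (e someTerm) (∨I₂ h))))

  and-cj-≈ : ∀ {n j} (l : List (Nf n j)) (χ : Nf (suc n) j) ts → fm ⟦ and-cj l χ ⟧ ts ≈ fm (⋀¬ l) ts ∧' fm ⟦ χ ⟧ ts
  and-cj-≈ l (cj l') ts = ⋀¬-++ l l' ts
  and-cj-≈ l (ex χ) ts = ∃-∧-right ⟦ χ ⟧ ⟦ and-cj (rens fs l) χ ⟧ {ts} (λ t →
    ≈-trans (and-cj-≈ (rens fs l) χ (t ∷ ts)) (∧-cong (rens-fs l t ts) ≈-refl))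

  and-nf-≈ : ∀ {n j} (χ χ' : Nf (suc n) j) ts → fm ⟦ and-nf χ χ' ⟧ ts ≈ fm ⟦ χ ⟧ ts ∧' fm ⟦ χ' ⟧ ts
  and-nf-≈ (cj l) χ' ts = and-cj-≈ l χ' ts
  and-nf-≈ (ex χ) χ' ts = ∃-∧-left ⟦ χ ⟧ ⟦ and-nf χ (ren fs χ') ⟧ {ts} (λ t →
    ≈-trans (and-nf-≈ χ (ren fs χ') (t ∷ ts)) (∧-cong ≈-refl (ren-fs χ' t ts)))

  and-all-≈ : ∀ {n j} (χ : Nf (suc n) j) l ts → fm (⋀¬ (and-all χ l)) ts ≈ ¬' (fm ⟦ χ ⟧ ts) ∨' fm (⋀¬ l) ts
  and-all-≈ χ [] ts = equiv (λ _ → ∨I₂ ⊤-intro) (λ _ → ⊤-intro)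
  and-all-≈ χ (χ' ∷ l) ts = ≈-trans
    (∧-cong (≈-trans (¬-cong (and-nf-≈ χ χ' ts)) ¬∧-≈) (and-all-≈ χ l ts))
    (equiv (λ d → orE (∧E₁ d) ∨I₁ (λ h → orE (∧E₂ (w1 d)) ∨I₁ (λ g → ∨I₂ (∧I (w1 h) g))))
           (λ d → orE d (λ h → ∧I (∨I₁ h) (∨I₁ h)) (λ h → ∧I (∨I₂ (∧E₁ h)) (∨I₂ (∧E₂ h)))))

  and-pairs-≈ : ∀ {n j} (l l' : List (Nf (suc n) j)) ts → fm (⋀¬ (and-pairs l l')) ts ≈ fm (⋀¬ l) ts ∨' fm (⋀¬ l') ts
  and-pairs-≈ [] l' ts = equiv (λ _ → ∨I₁ ⊤-intro) (λ _ → ⊤-intro)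
  and-pairs-≈ (χ ∷ l) l' ts = ≈-trans (⋀¬-++ (and-all χ l') (and-pairs l l') ts) (≈-trans
    (∧-cong (and-all-≈ χ l' ts) (and-pairs-≈ l l' ts))
    (equiv (λ d → orE (∧E₁ d) (λ h → orE (∧E₂ (w1 d)) (λ g → ∨I₁ (∧I (w1 h) g)) ∨I₂) ∨I₂)
           (λ d → orE d (λ h → ∧I (∨I₁ (∧E₁ h)) (∨I₁ (∧E₂ h))) (λ h → ∧I (∨I₂ h) (∨I₂ h)))))

  or-cj-≈ : ∀ {n j} (l : List (Nf (suc n) j)) (χ : Nf (suc (suc n)) j) ts → fm ⟦ or-cj l χ ⟧ ts ≈ fm (⋀¬ l) ts ∨' fm ⟦ χ ⟧ ts
  or-cj-≈ l (cj l') ts = and-pairs-≈ l l' ts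
  or-cj-≈ l (ex χ) ts = ∃-∨-right ⟦ χ ⟧ ⟦ or-cj (rens fs l) χ ⟧ {ts} (λ t →
    ≈-trans (or-cj-≈ (rens fs l) χ (t ∷ ts)) (∨-cong (rens-fs l t ts) ≈-refl))

  or-nf-≈ : ∀ {n j} (χ χ' : Nf (suc (suc n)) j) ts → fm ⟦ or-nf χ χ' ⟧ ts ≈ fm ⟦ χ ⟧ ts ∨' fm ⟦ χ' ⟧ ts
  or-nf-≈ (cj l) χ' ts = or-cj-≈ l χ' ts
  or-nf-≈ (ex χ) χ' ts = ∃-∨-left ⟦ χ ⟧ ⟦ or-nf χ (ren fs χ') ⟧ {ts} (λ t →
    ≈-trans (or-nf-≈ χ (ren fs χ') (t ∷ ts)) (∨-cong ≈-refl (ren-fs χ' t ts)))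

  record Normal (n : ℕ) {j : ℕ} (F : Vec (Term L) j → Fm L) : Set where
    constructor normal
    field
      nf  : Nf n j
      nf≈ : ∀ ts → fm ⟦ nf ⟧ ts ≈ F ts
  open Normal public

  resp : ∀ {n j} {F G : Vec (Term L) j → Fm L} → (∀ ts → F ts ≈ G ts) → Normal n F → Normal n G
  resp e (normal χ h) = normal χ (λ ts → ≈-trans (h ts) (e ts))

  negN : ∀ {n j} {F : Vec (Term L) j → Fm L} → Normal n F → Normal (suc n) (λ ts → ¬' (F ts))
  negN (normal χ h) = normal (cj (χ ∷ [])) (λ ts → ≈-trans (equiv ∧E₁ (λ d → ∧I d ⊤-intro)) (¬-cong (h ts)))

  andN : ∀ {n j} {F G : Vec (Term L) j → Fm L} → Normal (suc n) F → Normal (suc n) G → Normal (suc n) (λ ts → F ts ∧' G ts)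
  andN (normal χ h) (normal χ' h') = normal (and-nf χ χ') (λ ts → ≈-trans (and-nf-≈ χ χ' ts) (∧-cong (h ts) (h' ts)))

  orN : ∀ {n j} {F G : Vec (Term L) j → Fm L} → Normal (suc (suc n)) F → Normal (suc (suc n)) G → Normal (suc (suc n)) (λ ts → F ts ∨' G ts)
  orN (normal χ h) (normal χ' h') = normal (or-nf χ χ') (λ ts → ≈-trans (or-nf-≈ χ χ' ts) (∨-cong (h ts) (h' ts)))

  exN : ∀ {n j} {F : Vec (Term L) (suc j) → Fm L} (G : Vec (Term L) j → Fm L) → (∀ ts t → F (t ∷ ts) ≡ G ts [ t ])
      → Normal (suc n) F → Normal (suc n) (λ ts → ∃' (G ts))
  exN {F = F} G e (normal χ h) = normal (ex χ) (λ ts → equiv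
    (λ d → exE ⟦ χ ⟧ {ts} d (λ t g → ∃I t (subst (_ ⊢_) (e ts t) (to (h (t ∷ ts)) g))))
    (λ d → ∃E-fresh (G ts) d (λ t → exI ⟦ χ ⟧ {ts} t (from (h (t ∷ ts)) (subst (_ ⊢_) (sym (e ts t)) hyp0)))))

  renN : ∀ {n i j} {F : Vec (Term L) i → Fm L} (ρ : Fin i → Fin j) → Normal n F → Normal n (λ ts → F (pull ρ ts))
  renN ρ (normal χ h) = normal (ren ρ χ) (λ ts → ≈-trans (≡⇒≈ (ren-fm ρ χ ts)) (h (pull ρ ts)))

  -- Level 2 contains all literals: φ is ¬¬φ.
  atN : ∀ {j} b s (is : Vec (Fin j) (arity s)) → Normal 2 (λ ts → fm (litP b s) (mapⱽ (lookup ts) is))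
  atN b s is = resp (λ ts → ¬¬-elim) (negN (negN (normal (at b s is) (λ ts → ≈-refl))))

  -- Unnesting of terms

  lookups-↑ˡ : ∀ {k j} (zs : Vec (Term L) k) (us : Vec (Term L) j) → mapⱽ (lookup (zs ++ⱽ us)) (tabulate (_↑ˡ j)) ≡ zs
  lookups-↑ˡ zs us = trans (map-tabulate (λ i → i ↑ˡ _)) (trans (tabulate-cong (λ i → lookup-++ˡ zs us i)) (tabulate∘lookup zs))
    where
    map-tabulate : ∀ {k m} {A : Set} {f : Fin m → A} (g : Fin k → Fin m) → mapⱽ f (tabulate g) ≡ tabulate (f ∘ g)
    map-tabulate {zero} g = refl
    map-tabulate {suc k} g = cong (_ ∷_) (map-tabulate (g ∘ fs))

  -- Unnests one application: the formula becomes `∃ x (x = f zs ∧ χ x)`. Only an existential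
  -- quantifier and a conjunction are added, so the level stays 2 however deeply the terms are
  -- nested.
  plug-fun : ∀ {j} f → Nf 2 (suc j) → Nf 2 (funArity L f + j)
  plug-fun {j} f χ = ex (and-nf (nf (atN true (funˢ f) (fz ∷ tabulate (λ i → fs (i ↑ˡ j))))) (ren (liftᶠ (funArity L f ↑ʳ_)) χ))

  pull-↑ʳ : ∀ {k j} (zs : Vec (Term L) k) (us : Vec (Term L) j) → pull (k ↑ʳ_) (zs ++ⱽ us) ≡ us
  pull-↑ʳ zs us = trans (tabulate-cong (λ i → lookup-++ʳ zs us i)) (tabulate∘lookup us)

  plug-fun-≈ : ∀ {j} f (χ : Nf 2 (suc j)) zs us → fm ⟦ plug-fun f χ ⟧ (zs ++ⱽ us) ≈ fm ⟦ χ ⟧ (fun f zs ∷ us)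
  plug-fun-≈ {j} f χ zs us = equiv
    (λ d → exE R {zs ++ⱽ us} d (λ x h → ≐-subst ⟦ χ ⟧ (∧E₁ (to (body x) h)) (∧E₂ (to (body x) h))))
    (λ d → exI R {zs ++ⱽ us} (fun f zs) (from (body (fun f zs)) (∧I (≐refl _) d)))
    where
    A = atN true (funˢ f) (fz ∷ tabulate (λ i → fs (i ↑ˡ j)))
    R = ⟦ and-nf (nf A) (ren (liftᶠ (funArity L f ↑ʳ_)) χ) ⟧
    args : ∀ x → mapⱽ (lookup (x ∷ (zs ++ⱽ us))) (tabulate (λ i → fs (i ↑ˡ j))) ≡ zs
    args x = trans (go (λ i → i ↑ˡ j)) (lookups-↑ˡ zs us)
      where
      go : ∀ {k} (g : Fin k → Fin (funArity L f + j)) → mapⱽ (lookup (x ∷ (zs ++ⱽ us))) (tabulate (fs ∘ g)) ≡ mapⱽ (lookup (zs ++ⱽ us)) (tabulate g)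
      go {zero} g = refl
      go {suc k} g = cong (_ ∷_) (go (g ∘ fs))
    body : ∀ x → fm R (x ∷ (zs ++ⱽ us)) ≈ (x ≐ fun f zs) ∧' fm ⟦ χ ⟧ (x ∷ us)
    body x = ≈-trans (and-nf-≈ (nf A) (ren (liftᶠ (funArity L f ↑ʳ_)) χ) (x ∷ (zs ++ⱽ us))) (∧-cong
      (≈-trans (nf≈ A (x ∷ (zs ++ⱽ us))) (≡⇒≈ (cong (λ v → x ≐ fun f v) (args x))))
      (≡⇒≈ (trans (ren-fm (liftᶠ (funArity L f ↑ʳ_)) χ (x ∷ (zs ++ⱽ us))) (cong (λ v → fm ⟦ χ ⟧ (x ∷ v)) (pull-↑ʳ zs us)))))

  at-env : ∀ {j} → (ℕ → Fin j) → Vec (Term L) j → ℕ → Term L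
  at-env ρ us i = lookup us (ρ i)

  mutual
    plugT : ∀ {j} t (ρ : ℕ → Fin j) (χ : Nf 2 (suc j)) → Normal 2 (λ us → fm ⟦ χ ⟧ (substT (at-env ρ us) t ∷ us))
    plugT (var i) ρ χ = resp (λ us → ≡⇒≈ (cong (λ v → fm ⟦ χ ⟧ (lookup us (ρ i) ∷ v)) (tabulate∘lookup us)))
      (renN (λ { fz → ρ i ; (fs k) → k }) (normal χ (λ ts → ≈-refl)))
    plugT (fun f ts) ρ χ = resp (λ us → plug-fun-≈ f χ (substTs (at-env ρ us) ts) us) (plugTs ts ρ (plug-fun f χ))

    -- The terms are plugged in one after another. While the first is treated, `k` placeholders for
    -- the rest stand in front of the scope, hence the offset `k ↑ʳ ρ i`.
    plugTs : ∀ {k j} (ts : Vec (Term L) k) (ρ : ℕ → Fin j) (χ : Nf 2 (k + j)) → Normal 2 (λ us → fm ⟦ χ ⟧ (substTs (at-env ρ us) ts ++ⱽ us))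
    plugTs [] ρ χ = normal χ (λ _ → ≈-refl)
    plugTs {suc k} (t ∷ ts) ρ χ with plugT t (λ i → k ↑ʳ ρ i) χ
    ... | normal χ₁ h = resp (λ us → ≈-trans (h (substTs (at-env ρ us) ts ++ⱽ us))
            (≡⇒≈ (cong (λ t' → fm ⟦ χ ⟧ (t' ∷ (substTs (at-env ρ us) ts ++ⱽ us)))
              (substT-cong t (λ i _ → lookup-++ʳ (substTs (at-env ρ us) ts) us (ρ i))))))
            (plugTs ts ρ χ₁)

  literal : ∀ {j} b s (ts : Vec (Term L) (arity s)) (ρ : ℕ → Fin j) → Normal 2 (λ us → fm (litP b s) (substTs (at-env ρ us) ts))
  literal {j} b s ts ρ with atN b s (tabulate (_↑ˡ j))
  ... | normal χ h = resp (λ us → ≈-trans (h _) (≡⇒≈ (cong (fm (litP b s)) (lookups-↑ˡ (substTs (at-env ρ us) ts) us)))) (plugTs ts ρ χ)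

  ⊤N : ∀ {n j} → Normal (suc n) {j} (λ _ → ¬' ⊥')
  ⊤N = normal (cj []) (λ _ → ≈-refl)

  ⊥N : ∀ {n j} → Normal (suc (suc n)) {j} (λ _ → ⊥')
  ⊥N = resp (λ _ → ¬¬-elim) (negN ⊤N)

  -- The general negation costs a level. Building both polarities at once pushes negation down to
  -- the literals by De Morgan's laws and keeps the two at level 2.
  qf-normal : ∀ {j φ} (ρ : ℕ → Fin j) → QF φ → Normal 2 (λ us → substF (at-env ρ us) φ) × Normal 2 (λ us → ¬' (substF (at-env ρ us) φ))
  qf-normal ρ qf⊥ = ⊥N , ⊤N
  qf-normal ρ (qfrel r ts) = literal true (relˢ r) ts ρ , literal false (relˢ r) ts ρ
  qf-normal ρ (qfeq s t) = literal true eqˢ (s ∷ t ∷ []) ρ , literal false eqˢ (s ∷ t ∷ []) ρ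
  qf-normal ρ (qf¬ q) with qf-normal ρ q
  ... | p , n = n , resp (λ _ → ≈-sym ¬¬-elim) p
  qf-normal ρ (qf∧ q r) with qf-normal ρ q | qf-normal ρ r
  ... | p , n | p' , n' = andN p p' , resp (λ _ → ≈-sym ¬∧-≈) (orN n n')
  qf-normal ρ (qf∨ q r) with qf-normal ρ q | qf-normal ρ r
  ... | p , n | p' , n' = orN p p' , resp (λ _ → ≈-sym ¬∨-≈) (andN n n')
  qf-normal ρ (qf⇒ q r) with qf-normal ρ q | qf-normal ρ r
  ... | p , n | p' , n' = resp (λ _ → ≈-sym ⇒-≈) (orN n p') , resp (λ _ → ≈-sym ¬⇒-≈) (andN p n')

  extendρ : ∀ {j} → (ℕ → Fin j) → ℕ → Fin (suc j)
  extendρ ρ zero = fz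
  extendρ ρ (suc i) = fs (ρ i)

  at-env-extend : ∀ {j} (ρ : ℕ → Fin j) φ ts t → substF (at-env (extendρ ρ) (t ∷ ts)) φ ≡ substF (liftσ (at-env ρ ts)) φ [ t ]
  at-env-extend ρ φ ts t = sym (trans (substF-comp (sub0 t) (liftσ (at-env ρ ts)) φ) (substF-ext φ e))
    where
    e : ∀ i → substT (sub0 t) (liftσ (at-env ρ ts) i) ≡ at-env (extendρ ρ) (t ∷ ts) i
    e zero = refl
    e (suc i) = sub0-↑ t (lookup ts (ρ i))

  mutual
    -- Π formulas enter through their negations, so existential blocks are the only normal form
    -- needed and the two recursions mirror each other. The two extra levels come from `qf-normal`.
    sig-normal : ∀ {n j φ} (ρ : ℕ → Fin j) → Sig* n φ → Normal (suc (suc n)) (λ us → substF (at-env ρ us) φ)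
    sig-normal ρ (qf q) = proj₁ (qf-normal ρ q)
    sig-normal ρ (pi p) = resp (λ _ → ¬¬-elim) (negN (pi-normal ρ p))
    sig-normal ρ (and p q) = andN (sig-normal ρ p) (sig-normal ρ q)
    sig-normal ρ (or p q) = orN (sig-normal ρ p) (sig-normal ρ q)
    sig-normal ρ (ex {φ = φ} p) = exN (λ ts → substF (liftσ (at-env ρ ts)) φ) (at-env-extend ρ φ) (sig-normal (extendρ ρ) p)
    sig-normal ρ (neg p) = pi-normal ρ p
    sig-normal ρ (imp p q) = resp (λ _ → ≈-sym ⇒-≈) (orN (pi-normal ρ p) (sig-normal ρ q))

    pi-normal : ∀ {n j φ} (ρ : ℕ → Fin j) → Pi* n φ → Normal (suc (suc n)) (λ us → ¬' (substF (at-env ρ us) φ))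
    pi-normal ρ (qf q) = proj₂ (qf-normal ρ q)
    pi-normal ρ (sig p) = negN (sig-normal ρ p)
    pi-normal ρ (and p q) = resp (λ _ → ≈-sym ¬∧-≈) (orN (pi-normal ρ p) (pi-normal ρ q))
    pi-normal ρ (or p q) = resp (λ _ → ≈-sym ¬∨-≈) (andN (pi-normal ρ p) (pi-normal ρ q))
    pi-normal ρ (all {φ = φ} p) = resp (λ _ → ≈-sym ¬∀-≈)
      (exN (λ ts → ¬' (substF (liftσ (at-env ρ ts)) φ)) (λ ts t → cong ¬' (at-env-extend ρ φ ts t)) (pi-normal (extendρ ρ) p))
    pi-normal ρ (neg p) = resp (λ _ → ≈-sym ¬¬-elim) (sig-normal ρ p)
    pi-normal ρ (imp p q) = resp (λ _ → ≈-sym ¬⇒-≈) (andN (sig-normal ρ p) (pi-normal ρ q))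

  -- A map `ρ` from all variables requires an inhabited scope, so the sentence is normalized in
  -- scope 1 with every variable sent to the single slot. The dummy variable is then quantified
  -- away.
  sentence-normal : ∀ {n φ} → Sentence φ → Sig* n φ → Σ (Nf (suc (suc n)) 0) λ χ → fm ⟦ χ ⟧ [] ≈ φ
  sentence-normal {n} {φ} s p = ex (nf N) , equiv
    (λ d → exE ⟦ nf N ⟧ {[]} d (λ t h → to (≡⇒≈ (sentence-subst _ s)) (to (nf≈ N (t ∷ [])) h)))
    (λ d → exI ⟦ nf N ⟧ {[]} someTerm (from (nf≈ N (someTerm ∷ [])) (from (≡⇒≈ (sentence-subst _ s)) d)))
    where
    N : Normal (suc (suc n)) {1} (λ us → substF (at-env (λ _ → fz) us) φ)
    N = sig-normal (λ _ → fz) p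

-- Partial satisfaction and truth predicates.

module Truth {L : Lang} (D : SeqData {L}) where
  open SeqAx D
  open Arith D
  open Sequences D
  open Prenex L
  open Coding L

  -- Abstract, because the formulas are large and their shape is irrelevant.
  abstract
    Rep¹ : ∀ {f} → PR¹ f → Pred {L} 2
    Rep¹ q = repP (proj₁ q)

    Rep² : ∀ {f} → PR² f → Pred {L} 3
    Rep² q = repP (proj₁ q)

    rep-out : ∀ {Γ f} {{b : Base Γ}} (q : PR¹ f) n {x y} → Γ ⊢ num n x → Γ ⊢ fm (Rep¹ q) (y ∷ x ∷ []) → Γ ⊢ num (f n) y
    rep-out q n h d = subst (λ k → _ ⊢ num k _) (proj₂ q n) (rep-sound (proj₁ q) (h ∷ []) d)

    rep-in : ∀ {Γ f} {{b : Base Γ}} (q : PR¹ f) n {x y} → Γ ⊢ num n x → Γ ⊢ num (f n) y → Γ ⊢ fm (Rep¹ q) (y ∷ x ∷ [])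
    rep-in q n h d = rep-complete (proj₁ q) (h ∷ []) (subst (λ k → _ ⊢ num k _) (sym (proj₂ q n)) d)

    rep-out² : ∀ {Γ f} {{b : Base Γ}} (q : PR² f) n m {x y z} → Γ ⊢ num n x → Γ ⊢ num m y → Γ ⊢ fm (Rep² q) (z ∷ x ∷ y ∷ []) → Γ ⊢ num (f n m) z
    rep-out² q n m h k d = subst (λ k → _ ⊢ num k _) (proj₂ q n m) (rep-sound (proj₁ q) (h ∷ k ∷ []) d)

    rep-in² : ∀ {Γ f} {{b : Base Γ}} (q : PR² f) n m {x y z} → Γ ⊢ num n x → Γ ⊢ num m y → Γ ⊢ num (f n m) z → Γ ⊢ fm (Rep² q) (z ∷ x ∷ y ∷ [])
    rep-in² q n m h k d = rep-complete (proj₁ q) (h ∷ k ∷ []) (subst (λ k → _ ⊢ num k _) (sym (proj₂ q n m)) d)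

  num-≡ : ∀ {Γ n m x} → n ≡ m → Γ ⊢ num n x → Γ ⊢ num m x
  num-≡ refl d = d

  -- Partial assignments and their agreement

  AgreeB : Pred {L} 5
  AgreeB = at1 NP f1 ∧ᴾ at2 LtP f1 f2 ⇒ᴾ (at3 BP f0 f1 f3 ⇔ᴾ at3 BP f0 f1 f4)

  FunB : Pred {L} 6
  FunB = at1 NP f1 ∧ᴾ at2 EP f3 f1 ⇒ᴾ (at3 BP f0 f1 f5 ⇔ᴾ eqᴾ f0 f2)

  FunI : Pred {L} 3
  FunI = NN ∧ᴾ at2 LtP f0 f1 ⇒ᴾ ∃ᴾ (∀ᴾ (∀ᴾ FunB))

  EntryX : ℕ → Pred {L} 2
  EntryX n = at2 (EntryP n) f1 f0

  abstract
    AgreeP : Pred {L} 3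
    AgreeP = ∀ᴾ (∀ᴾ AgreeB)

    -- Exactly one entry at every index below b, independently of the representative of the index.
    FunP : Pred {L} 2
    FunP = ∀ᴾ FunI

    agree-at : ∀ {Γ j w w'} → Γ ⊢ fm AgreeP (j ∷ w ∷ w' ∷ []) → ∀ i y → Γ ⊢ N[ i ] → Γ ⊢ Lt i j → Γ ⊢ B[ y , i , w ] ⇔' B[ y , i , w' ]
    agree-at {j = j} {w} {w'} d i y ni l = ⇒E (allE AgreeB {i ∷ j ∷ w ∷ w' ∷ []} (allE (∀ᴾ AgreeB) {j ∷ w ∷ w' ∷ []} d i) y) (∧I ni l)

    agreeI : ∀ {Γ j w w'} → (∀ i y → N[ i ] ∧' Lt i j ∷ Γ ⊢ N[ i ] ∧' Lt i j → N[ i ] ∧' Lt i j ∷ Γ ⊢ B[ y , i , w ] ⇔' B[ y , i , w' ])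
           → Γ ⊢ fm AgreeP (j ∷ w ∷ w' ∷ [])
    agreeI {j = j} {w} {w'} k = allI (∀ᴾ AgreeB) {j ∷ w ∷ w' ∷ []} (λ i → allI AgreeB {i ∷ j ∷ w ∷ w' ∷ []} (λ y → impI (k i y)))

    fun-entry : ∀ {Γ} {{b : Base Γ}} n m {x w} → m < n → Γ ⊢ num n x → Γ ⊢ fm FunP (x ∷ w ∷ []) → Γ ⊢ fm (∃ᴾ (EntryX m)) (w ∷ [])
    fun-entry n m {x} {w} p dx d = numeralE m (λ i di →
      exE (∀ᴾ (∀ᴾ FunB)) {i ∷ x ∷ w ∷ []} (⇒E (allE FunI {x ∷ w ∷ []} (w1 d) i) (∧I (num-N m di) (lt-num p di (w1 dx)))) (λ y h →
        exI (EntryX m) {w ∷ []} y (entryI m (λ i' y' di' →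
          ⇒E (allE FunB {i' ∷ y ∷ i ∷ x ∷ w ∷ []} (allE (∀ᴾ FunB) {y ∷ i ∷ x ∷ w ∷ []} (w1 h) i') y')
             (∧I (num-N m di') (num-uniq m (w2 di) di'))))))

    funI : ∀ {Γ} {{b : Base Γ}} n {x w} → Γ ⊢ num n x → (∀ m → m < n → Γ ⊢ fm (∃ᴾ (EntryX m)) (w ∷ [])) → Γ ⊢ fm FunP (x ∷ w ∷ [])
    funI n {x} {w} dx d = allI FunI {x ∷ w ∷ []} (λ i → impI (λ h →
      belowE n (lt-below n (∧E₁ h) (∧E₂ h) (w1 dx)) (λ m p di →
        exE (EntryX m) {w ∷ []} (w2 (d m p)) (λ y e →
          exI (∀ᴾ (∀ᴾ FunB)) {i ∷ x ∷ w ∷ []} y (allI (∀ᴾ FunB) {y ∷ i ∷ x ∷ w ∷ []} (λ i' → allI FunB {i' ∷ y ∷ i ∷ x ∷ w ∷ []} (λ y' → impI (λ g →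
            entry-at m y' (w1 e) (num-cong m (w2 di) (∧E₁ g) (∧E₂ g))))))))))

  ⇔-refl : ∀ {Γ φ} → Γ ⊢ φ ⇔' φ
  ⇔-refl = ∧I (impI id) (impI id)

  ⇔-trans : ∀ {Γ φ ψ χ} → Γ ⊢ φ ⇔' ψ → Γ ⊢ ψ ⇔' χ → Γ ⊢ φ ⇔' χ
  ⇔-trans d e = ∧I (impI (λ h → ⇒E (∧E₁ (w1 e)) (⇒E (∧E₁ (w1 d)) h))) (impI (λ h → ⇒E (∧E₂ (w1 d)) (⇒E (∧E₂ (w1 e)) h)))

  ⇔-sym : ∀ {Γ φ ψ} → Γ ⊢ φ ⇔' ψ → Γ ⊢ ψ ⇔' φ
  ⇔-sym d = ∧I (∧E₂ d) (∧E₁ d)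

  agree-refl : ∀ {Γ} j w → Γ ⊢ fm AgreeP (j ∷ w ∷ w ∷ [])
  agree-refl j w = agreeI (λ i y _ → ⇔-refl)

  entry-agree : ∀ {Γ} {{b : Base Γ}} n m {j w w' z} → m < n → Γ ⊢ num n j → Γ ⊢ fm AgreeP (j ∷ w ∷ w' ∷ []) → Γ ⊢ entry m w z → Γ ⊢ entry m w' z
  entry-agree n m p dj d e = entryI m (λ i y h →
    ⇔-trans (⇔-sym (agree-at (w1 d) i y (num-N m h) (lt-num p h (w1 dj)))) (entry-at m y (w1 e) h))

  ext-agree : ∀ {Γ} {{b : Base Γ}} {w' k x w} → Γ ⊢ N[ k ] → Γ ⊢ ext w' k x w → Γ ⊢ fm AgreeP (k ∷ w ∷ w' ∷ [])
  ext-agree {w' = w'} {k} {x} {w} nk d = agreeI (λ i y h →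
    let q = ⇒E (ext-at (w1 d) i y) (∧I (w1 nk) (∧E₁ (∧E₂ h))) in
    ∧I (impI (λ g → ⇒E (∧E₂ (w1 q)) (∨I₁ (∧I (w1 (∧E₂ h)) g))))
       (impI (λ g → orE (⇒E (∧E₁ (w1 q)) g) ∧E₂ (λ l → ⊥E (¬E (∧E₂ (∧E₂ (w2 h))) (∧E₁ l))))))

  -- The variable with index i in scope j is the entry at position j - 1 - i of the assignment.

  pos : ∀ {j} → Fin j → ℕ
  pos {suc j} fz = j
  pos {suc j} (fs i) = pos i

  -- Positions count binders from the outside, so passing under a quantifier writes the new entry
  -- `j` and leaves all earlier entries in place.
  Holds : ∀ {j} → List (Fm L) → Term L → Vec (Term L) j → Set
  Holds Γ w [] = ⊤
  Holds {suc j} Γ w (t ∷ ts) = (Γ ⊢ entry j w t) × Holds Γ w ts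

  holds-wk : ∀ {j Γ Δ w} (ts : Vec (Term L) j) → Γ ⊆ᶜ Δ → Holds Γ w ts → Holds Δ w ts
  holds-wk [] s h = tt
  holds-wk (t ∷ ts) s (d , h) = wk s d , holds-wk ts s h

  holds-lookup : ∀ {j Γ w} (ts : Vec (Term L) j) → Holds Γ w ts → ∀ i → Γ ⊢ entry (pos i) w (lookup ts i)
  holds-lookup (t ∷ ts) (d , h) fz = d
  holds-lookup (t ∷ ts) (d , h) (fs i) = holds-lookup ts h i

  holds-entry : ∀ {j Γ w} (ts : Vec (Term L) j) → Holds Γ w ts → ∀ m → m < j → Γ ⊢ fm (∃ᴾ (EntryX m)) (w ∷ [])
  holds-entry {suc j} {w = w} (t ∷ ts) (d , h) m p with m ≟ j
  ... | yes refl = exI (EntryX m) {w ∷ []} t d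
  ... | no q = holds-entry ts h m (≤∧≢⇒< (≤-pred p) q)

  holds-agree : ∀ {i Γ} {{b : Base Γ}} n {x w w'} (ts : Vec (Term L) i) → i ≤ n → Γ ⊢ num n x → Γ ⊢ fm AgreeP (x ∷ w ∷ w' ∷ []) → Holds Γ w ts → Holds Γ w' ts
  holds-agree n [] p dx d h = tt
  holds-agree {suc i} n (t ∷ ts) p dx d (e , h) = entry-agree n i p dx d e , holds-agree n ts (<⇒≤ p) dx d h

  symTag symArg : Sym → ℕ
  symTag eqˢ = 0
  symTag (relˢ r) = 1
  symTag (funˢ f) = 2
  symArg eqˢ = 0
  symArg (relˢ r) = toℕ r
  symArg (funˢ f) = toℕ f

  symCode : Sym → ℕ
  symCode s = symTag s ▹ symArg s

  litCode : Bool → Sym → ℕ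
  litCode b s = (if b then 0 else 1) ▹ symCode s

  symCode-inj : ∀ s s' → symCode s ≡ symCode s' → s ≡ s'
  symCode-inj s s' e = go s s' (proj₁ (pair-inj e)) (proj₂ (pair-inj e))
    where
    go : ∀ s s' → symTag s ≡ symTag s' → symArg s ≡ symArg s' → s ≡ s'
    go eqˢ eqˢ refl h = refl
    go (relˢ r) (relˢ r') refl h = cong relˢ (toℕ-injective h)
    go (funˢ f) (funˢ f') refl h = cong funˢ (toℕ-injective h)

  litCode-inj : ∀ b s b' s' → litCode b s ≡ litCode b' s' → (b , s) ≡ (b' , s')
  litCode-inj b s b' s' e with pair-inj {if b then 0 else 1} {symCode s} {if b' then 0 else 1} e
  litCode-inj false s false s' e | _ , h = cong (false ,_) (symCode-inj s s' h)
  litCode-inj true s true s' e | _ , h = cong (true ,_) (symCode-inj s s' h)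

  syms : List Sym
  syms = eqˢ ∷ map relˢ (allFin (nRel L)) ++ map funˢ (allFin (nFun L))

  lits : List (Bool × Sym)
  lits = map (true ,_) syms ++ map (false ,_) syms

  ∈-syms : ∀ s → s ∈ syms
  ∈-syms eqˢ = here refl
  ∈-syms (relˢ r) = there (∈-++⁺ˡ (∈-map⁺ relˢ (∈-allFin r)))
  ∈-syms (funˢ f) = there (∈-++⁺ʳ (map relˢ (allFin (nRel L))) (∈-map⁺ funˢ (∈-allFin f)))

  ∈-lits : ∀ b s → (b , s) ∈ lits
  ∈-lits true s = ∈-++⁺ˡ (∈-map⁺ (true ,_) (∈-syms s))
  ∈-lits false s = ∈-++⁺ʳ (map (true ,_) syms) (∈-map⁺ (false ,_) (∈-syms s))

  -- `j` is the scope before an existential block, `b` the scope after it, and `l` lists the codes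
  -- of the negated conjuncts. A block of any length is thus recorded by two numbers, and one
  -- extended sequence can answer it.
  blockCode : ℕ → ℕ → List ℕ → ℕ
  blockCode j b l = j ▹ b ▹ length l ▹ codeL l

  mutual
    codeN : ∀ {n j} → Nf n j → ℕ
    codeN {zero} (at b s is) = litCode b s ▹ codeL (positions is)
    codeN {suc n} {j} χ = blockCode j (bound χ) (items χ)

    items : ∀ {n j} → Nf (suc n) j → List ℕ
    items (cj l) = codesN l
    items (ex χ) = items χ

    codesN : ∀ {n j} → List (Nf n j) → List ℕ
    codesN [] = []
    codesN (χ ∷ l) = codeN χ ∷ codesN l

    bound : ∀ {n j} → Nf (suc n) j → ℕ
    bound {j = j} (cj l) = j
    bound (ex χ) = bound χ

    positions : ∀ {j k} → Vec (Fin j) k → List ℕ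
    positions [] = []
    positions (i ∷ is) = pos i ∷ positions is

  ≤-bound : ∀ {n j} (χ : Nf (suc n) j) → j ≤ bound χ
  ≤-bound (cj l) = ≤-refl
  ≤-bound (ex χ) = <⇒≤ (≤-bound χ)

  boundᶜ countᶜ : ℕ → ℕ
  boundᶜ c = unpair₁ (unpair₂ c)
  countᶜ c = unpair₁ (unpair₂ (unpair₂ c))

  itemᶜ argᶜ : ℕ → ℕ → ℕ
  itemᶜ c i = nthᶜ (unpair₂ (unpair₂ (unpair₂ c))) i
  argᶜ l c = nthᶜ (unpair₂ c) l

  boundᴿ : PR¹ boundᶜ
  boundᴿ = toPR¹ (app¹ unpair₁ᴿ (app¹ unpair₂ᴿ (argᴿ fz)))

  countᴿ : PR¹ countᶜ
  countᴿ = toPR¹ (app¹ unpair₁ᴿ (app¹ unpair₂ᴿ (app¹ unpair₂ᴿ (argᴿ fz))))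

  itemᴿ : PR² itemᶜ
  itemᴿ = toPR² (app² nthᴿ (app¹ unpair₂ᴿ (app¹ unpair₂ᴿ (app¹ unpair₂ᴿ (argᴿ fz)))) (argᴿ (fs fz)))

  argcᴿ : ∀ l → PR¹ (argᶜ l)
  argcᴿ l = toPR¹ (app² nthᴿ (app¹ unpair₂ᴿ (argᴿ fz)) (constᴿ l))

  boundᶜ-block : ∀ j b l → boundᶜ (blockCode j b l) ≡ b
  boundᶜ-block j b l = trans (cong unpair₁ (unpair₂-pair j _)) (unpair₁-pair b _)

  unpair₂₂-block : ∀ j b l → unpair₂ (unpair₂ (blockCode j b l)) ≡ length l ▹ codeL l
  unpair₂₂-block j b l = trans (cong unpair₂ (unpair₂-pair j _)) (unpair₂-pair b _)

  countᶜ-block : ∀ j b l → countᶜ (blockCode j b l) ≡ length l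
  countᶜ-block j b l = trans (cong unpair₁ (unpair₂₂-block j b l)) (unpair₁-pair (length l) _)

  itemᶜ-block : ∀ j b l i → itemᶜ (blockCode j b l) i ≡ lookupᴸ l i
  itemᶜ-block j b l i = trans (cong (λ c → nthᶜ (unpair₂ c) i) (unpair₂₂-block j b l))
    (trans (cong (λ c → nthᶜ c i) (unpair₂-pair (length l) _)) (nthᶜ-codeL l i))

  argᶜ-lit : ∀ b s l i → argᶜ i (litCode b s ▹ codeL l) ≡ lookupᴸ l i
  argᶜ-lit b s l i = trans (cong (λ c → nthᶜ c i) (unpair₂-pair (litCode b s) _)) (nthᶜ-codeL l i)

  ArgC : ℕ → Pred {L} 4
  ArgC l = at2 (Rep¹ (argcᴿ l)) f0 f2 ∧ᴾ at3 BP f1 f0 f3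

  argVars : ∀ k → Vec (Term L) (suc (k + 2)) → Vec (Term L) 3
  argVars k (y ∷ us) = y ∷ dropⱽ k us

  argVars-nat : ∀ k τ us → substTs τ (argVars k us) ≡ argVars k (substTs τ us)
  argVars-nat k τ (y ∷ us) = cong (substT τ y ∷_) (subst-dropⱽ k τ us)

  ArgB : ℕ → ∀ k → Pred {L} (suc (k + 2))
  ArgB l k = sub (∃ᴾ (ArgC l)) (argVars k) (argVars-nat k)

  -- No term denotes an entry of a sequence, so the arguments of a literal are fetched by
  -- existential quantifiers; their number is the arity and hence standard.
  ArgsP : ∀ k → ℕ → Pred {L} (k + 2) → Pred {L} 2
  ArgsP zero l K = K
  ArgsP (suc k) l K = ArgsP k (suc l) (∃ᴾ (ArgB l k ∧ᴾ K))

  ArgsOK : ∀ {k} → List (Fm L) → ℕ → Term L → ℕ → Vec (Term L) k → Set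
  ArgsOK Γ ĉ w l [] = ⊤
  ArgsOK Γ ĉ w l (u ∷ us) = (Γ ⊢ entry (argᶜ l ĉ) w u) × ArgsOK Γ ĉ w (suc l) us

  args-sound : ∀ {k Γ} {{b : Base Γ}} ĉ l (K : Pred {L} (k + 2)) {c w} (us : Vec (Term L) k) {χ} → Γ ⊢ num ĉ c → ArgsOK Γ ĉ w l us
             → Γ ⊢ fm (ArgsP k l K) (c ∷ w ∷ []) → (∀ {Δ} → Γ ⊆ᶜ Δ → Δ ⊢ fm K (us ++ⱽ (c ∷ w ∷ [])) → Δ ⊢ χ) → Γ ⊢ χ
  args-sound ĉ l K [] dc ok d k = k id d
  args-sound {suc n} {{b}} ĉ l K {c} {w} (u ∷ us) dc (e , ok) d k =
    args-sound ĉ (suc l) (∃ᴾ (ArgB l n ∧ᴾ K)) us dc ok d (λ {Δ} s h →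
      exE (ArgB l n ∧ᴾ K) {us ++ⱽ (c ∷ w ∷ [])} h (λ y g →
        exE (ArgC l) {y ∷ c ∷ w ∷ []} (fm-≡ (∃ᴾ (ArgC l)) (cong (y ∷_) (dropⱽ-++ us (c ∷ w ∷ []))) (∧E₁ g)) (λ i f →
          k (there ∘ there ∘ s) (≐-subst K {us ++ⱽ (c ∷ w ∷ [])}
            (entry-out (argᶜ l ĉ) (wk (there ∘ there ∘ s) e)
              (rep-out {{Base-wk (there ∘ there ∘ s) b}} (argcᴿ l) ĉ (wk (there ∘ there ∘ s) dc) (∧E₁ f)) (∧E₂ f))
            (w1 (∧E₂ g))))))

  args-complete : ∀ {k Γ} {{b : Base Γ}} ĉ l (K : Pred {L} (k + 2)) {c w} (us : Vec (Term L) k) → Γ ⊢ num ĉ c → ArgsOK Γ ĉ w l us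
                → Γ ⊢ fm K (us ++ⱽ (c ∷ w ∷ [])) → Γ ⊢ fm (ArgsP k l K) (c ∷ w ∷ [])
  args-complete ĉ l K [] dc ok d = d
  args-complete {suc n} ĉ l K {c} {w} (u ∷ us) dc (e , ok) d =
    args-complete ĉ (suc l) (∃ᴾ (ArgB l n ∧ᴾ K)) us dc ok (exI (ArgB l n ∧ᴾ K) {us ++ⱽ (c ∷ w ∷ [])} u
      (∧I (fm-≡ (∃ᴾ (ArgC l)) (cong (u ∷_) (sym (dropⱽ-++ us (c ∷ w ∷ []))))
            (numeralE (argᶜ l ĉ) (λ i di → exI (ArgC l) {u ∷ c ∷ w ∷ []} i (∧I (rep-in (argcᴿ l) ĉ (w1 dc) di) (entry-in (argᶜ l ĉ) (w1 e) di)))))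
          d))

  SymB : Bool → Sym → Pred {L} 3
  SymB b s = at2 (Rep¹ unpair₁ᴿ) f0 f1 ∧ᴾ at1 (Num (litCode b s)) f0

  LitK : ∀ b s → Pred {L} (arity s + 2)
  LitK b s = sub (litP b s) (takeⱽ (arity s)) (subst-takeⱽ (arity s))

  SatLit : Bool × Sym → Pred {L} 2
  SatLit (b , s) = ∃ᴾ (SymB b s) ∧ᴾ ArgsP (arity s) 0 (LitK b s)

  SatLits : List (Bool × Sym) → Pred {L} 2
  SatLits [] = ⊥ᴾ
  SatLits (x ∷ l) = SatLit x ∨ᴾ SatLits l

  -- Satisfaction of formulas of level n

  module Level (S : Pred {L} 2) where
    JB : Pred {L} 4
    JB = at2 (Rep¹ unpair₁ᴿ) f0 f2 ∧ᴾ at3 AgreeP f0 f3 f1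

    BB : Pred {L} 4
    BB = at2 (Rep¹ boundᴿ) f0 f2 ∧ᴾ at2 FunP f0 f1

    CountD : Pred {L} 6
    CountD = at3 (Rep² itemᴿ) f0 f4 f1 ∧ᴾ ¬ᴾ (at2 S f0 f3)

    CountI : Pred {L} 5
    CountI = NN ∧ᴾ at2 LtP f0 f1 ⇒ᴾ ∃ᴾ CountD

    CountB : Pred {L} 4
    CountB = at2 (Rep¹ countᴿ) f0 f2 ∧ᴾ ∀ᴾ CountI

    -- `JB` keeps the old values below the scope, `BB` makes `w'` a proper assignment for the whole
    -- block, and `CountB` lets satisfaction of the lower level fail at every item.
    SatB : Pred {L} 3
    SatB = ∃ᴾ JB ∧ᴾ ∃ᴾ BB ∧ᴾ ∃ᴾ CountB

    ItemD : ℕ → Pred {L} 2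
    ItemD x = at1 (Num x) f0 ∧ᴾ ¬ᴾ (at2 S f0 f1)

    Items : List ℕ → Pred {L} 1
    Items [] = ¬ᴾ ⊥ᴾ
    Items (x ∷ l) = ∃ᴾ (ItemD x) ∧ᴾ Items l

    CoreJ CoreBd : ℕ → Pred {L} 3
    CoreJ j = at1 (Num j) f0 ∧ᴾ at3 AgreeP f0 f2 f1
    CoreBd b = at1 (Num b) f0 ∧ᴾ at2 FunP f0 f1

    -- The meaning of SatB at a standard code.
    Core : ℕ → ℕ → List ℕ → Pred {L} 2
    Core j b l = ∃ᴾ (CoreJ j) ∧ᴾ ∃ᴾ (CoreBd b) ∧ᴾ at1 (Items l) f0

    itemsI : ∀ {Γ} l {w} → (∀ m → m < length l → Γ ⊢ fm (∃ᴾ (ItemD (lookupᴸ l m))) (w ∷ [])) → Γ ⊢ fm (Items l) (w ∷ [])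
    itemsI [] d = ⊤-intro
    itemsI (x ∷ l) d = ∧I (d 0 (s≤s z≤n)) (itemsI l (λ m p → d (suc m) (s≤s p)))

    itemsE : ∀ {Γ} l {w} → Γ ⊢ fm (Items l) (w ∷ []) → ∀ m → m < length l → Γ ⊢ fm (∃ᴾ (ItemD (lookupᴸ l m))) (w ∷ [])
    itemsE (x ∷ l) d zero p = ∧E₁ d
    itemsE (x ∷ l) d (suc m) (s≤s p) = itemsE l (∧E₂ d) m p

    core-sound : ∀ {Γ} {{b : Base Γ}} j b l {c w w'} → Γ ⊢ num (blockCode j b l) c → Γ ⊢ fm SatB (w' ∷ c ∷ w ∷ []) → Γ ⊢ fm (Core j b l) (w' ∷ w ∷ [])
    core-sound j b l {c} {w} {w'} dc d = ∧I
      (exE JB {w' ∷ c ∷ w ∷ []} (∧E₁ d) (λ x h → exI (CoreJ j) {w' ∷ w ∷ []} x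
        (∧I (num-≡ (unpair₁-pair j _) (rep-out unpair₁ᴿ (blockCode j b l) (w1 dc) (∧E₁ h))) (∧E₂ h))))
      (∧I
      (exE BB {w' ∷ c ∷ w ∷ []} (∧E₁ (∧E₂ d)) (λ x h → exI (CoreBd b) {w' ∷ w ∷ []} x
        (∧I (num-≡ (boundᶜ-block j b l) (rep-out boundᴿ (blockCode j b l) (w1 dc) (∧E₁ h))) (∧E₂ h))))
      (exE CountB {w' ∷ c ∷ w ∷ []} (∧E₂ (∧E₂ d)) (λ x h → itemsI l (λ m p → numeralE m (λ i di →
        exE CountD {i ∷ x ∷ w' ∷ c ∷ w ∷ []}
          (⇒E (allE CountI {x ∷ w' ∷ c ∷ w ∷ []} (w1 (∧E₂ h)) i)
              (∧I (num-N m di) (lt-num p di (num-≡ (countᶜ-block j b l) (rep-out countᴿ (blockCode j b l) (w2 dc) (w1 (∧E₁ h)))))))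
          (λ y g → exI (ItemD (lookupᴸ l m)) {w' ∷ []} y
            (∧I (num-≡ (itemᶜ-block j b l m) (rep-out² itemᴿ (blockCode j b l) m (w3 dc) (w1 di) (∧E₁ g))) (∧E₂ g))))))))

    core-complete : ∀ {Γ} {{b : Base Γ}} j b l {c w w'} → Γ ⊢ num (blockCode j b l) c → Γ ⊢ fm (Core j b l) (w' ∷ w ∷ []) → Γ ⊢ fm SatB (w' ∷ c ∷ w ∷ [])
    core-complete j b l {c} {w} {w'} dc d = ∧I
      (exE (CoreJ j) {w' ∷ w ∷ []} (∧E₁ d) (λ x h → exI JB {w' ∷ c ∷ w ∷ []} x
        (∧I (rep-in unpair₁ᴿ (blockCode j b l) (w1 dc) (num-≡ (sym (unpair₁-pair j _)) (∧E₁ h))) (∧E₂ h))))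
      (∧I
      (exE (CoreBd b) {w' ∷ w ∷ []} (∧E₁ (∧E₂ d)) (λ x h → exI BB {w' ∷ c ∷ w ∷ []} x
        (∧I (rep-in boundᴿ (blockCode j b l) (w1 dc) (num-≡ (sym (boundᶜ-block j b l)) (∧E₁ h))) (∧E₂ h))))
      (numeralE (length l) (λ x dx → exI CountB {w' ∷ c ∷ w ∷ []} x (∧I
        (rep-in countᴿ (blockCode j b l) (w1 dc) (num-≡ (sym (countᶜ-block j b l)) dx))
        (allI CountI {x ∷ w' ∷ c ∷ w ∷ []} (λ i → impI (λ h →
          belowE (length l) (lt-below (length l) (∧E₁ h) (∧E₂ h) (w1 dx)) (λ m p di →
            exE (ItemD (lookupᴸ l m)) {w' ∷ []} (itemsE l (w3 (∧E₂ (∧E₂ d))) m p) (λ y g →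
              exI CountD {i ∷ x ∷ w' ∷ c ∷ w ∷ []} y
                (∧I (rep-in² itemᴿ (blockCode j b l) m (w4 dc) (w1 di) (num-≡ (sym (itemᶜ-block j b l m)) (∧E₁ g))) (∧E₂ g)))))))))))

  -- The recursion on the level takes place outside the theory and gives a separate formula for each
  -- `n`; this is where a uniform bound on the alternations in `A` matters.
  Sat : ℕ → Pred {L} 2
  Sat zero = SatLits lits
  Sat (suc n) = ∃ᴾ (Level.SatB (Sat n))

  satlits-intro : ∀ {Γ} l x {c w} → x ∈ l → Γ ⊢ fm (SatLit x) (c ∷ w ∷ []) → Γ ⊢ fm (SatLits l) (c ∷ w ∷ [])
  satlits-intro (x ∷ l) .x (here refl) d = ∨I₁ d
  satlits-intro (y ∷ l) x (there p) d = ∨I₂ (satlits-intro l x p d)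

  -- Only the disjunct of the symbol recorded in the code can hold.
  satlits-elim : ∀ {Γ} {{b : Base Γ}} l b s k {c w} → Γ ⊢ num (litCode b s ▹ k) c → Γ ⊢ fm (SatLits l) (c ∷ w ∷ []) → Γ ⊢ fm (SatLit (b , s)) (c ∷ w ∷ [])
  satlits-elim [] b s k dc d = ⊥E d
  satlits-elim {Γ} ((b' , s') ∷ l) b s k {c} {w} dc d = orE d (first (litCode b' s' ≟ litCode b s)) (λ h → satlits-elim l b s k (w1 dc) h)
    where
    φ : Fm L
    φ = fm (SatLit (b' , s')) (c ∷ w ∷ [])
    first : Dec (litCode b' s' ≡ litCode b s) → φ ∷ Γ ⊢ φ → φ ∷ Γ ⊢ fm (SatLit (b , s)) (c ∷ w ∷ [])
    first (yes e) h = subst (λ x → φ ∷ Γ ⊢ fm (SatLit x) (c ∷ w ∷ [])) (litCode-inj b' s' b s e) h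
    first (no n) h = exE (SymB b' s') {c ∷ w ∷ []} (∧E₁ h) (λ o g → ⊥E (num-disj (litCode b' s') (litCode b s) n (∧E₂ g)
            (num-≡ (unpair₁-pair (litCode b s) k) (rep-out unpair₁ᴿ (litCode b s ▹ k) (w2 dc) (∧E₁ g)))))

  args-ok : ∀ {j k Γ w} ĉ l (ts : Vec (Term L) j) (is : Vec (Fin j) k) → Holds Γ w ts → (∀ i → i < k → argᶜ (i + l) ĉ ≡ lookupᴸ (positions is) i)
          → ArgsOK Γ ĉ w l (mapⱽ (lookup ts) is)
  args-ok ĉ l ts [] h e = tt
  args-ok {w = w} ĉ l ts (i ∷ is) h e = subst (λ p → _ ⊢ entry p w _) (sym (e 0 (s≤s z≤n))) (holds-lookup ts h i)
    , args-ok ĉ (suc l) ts is h (λ m p → trans (cong (λ q → argᶜ q ĉ) (+-suc m l)) (e (suc m) (s≤s p)))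

  module _ where
    open Level

    mutual
      -- The two directions are mutual because conjuncts are negated: soundness for a block uses
      -- completeness one level down, and conversely. The recursion is on the standard normal form
      -- `χ`.
      sat-sound : ∀ {n j Γ} {{b : Base Γ}} (χ : Nf n j) {c w} (ts : Vec (Term L) j) → Γ ⊢ num (codeN χ) c → Holds Γ w ts
                → Γ ⊢ fm (Sat n) (c ∷ w ∷ []) → Γ ⊢ fm ⟦ χ ⟧ ts
      sat-sound (at b s is) {c} {w} ts dc h d = args-sound (litCode b s ▹ codeL (positions is)) 0 (LitK b s) us dc ok
        (∧E₂ (satlits-elim lits b s (codeL (positions is)) dc d)) (λ _ g → fm-≡ (litP b s) (takeⱽ-++ us (c ∷ w ∷ [])) g)
        where
        us = mapⱽ (lookup ts) is
        ok = args-ok (litCode b s ▹ codeL (positions is)) 0 ts is h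
          (λ i _ → trans (cong (λ q → argᶜ q (litCode b s ▹ codeL (positions is))) (+-identityʳ i)) (argᶜ-lit b s (positions is) i))
      sat-sound {suc n} {j} χ {c} {w} ts dc h d = exE (SatB (Sat n)) {c ∷ w ∷ []} d (λ w' g →
        block-sound χ ts (holds-wk ts there h) (core-sound (Sat n) j (bound χ) (items χ) {c} {w} {w'} (w1 dc) g))

      block-sound : ∀ {n j Γ} {{b : Base Γ}} (χ : Nf (suc n) j) {w w'} (ts : Vec (Term L) j) → Holds Γ w ts
                  → Γ ⊢ fm (Core (Sat n) j (bound χ) (items χ)) (w' ∷ w ∷ []) → Γ ⊢ fm ⟦ χ ⟧ ts
      block-sound {n} {j} (cj l) {w} {w'} ts h d = exE (CoreJ (Sat n) j) {w' ∷ w ∷ []} (∧E₁ d) (λ x g →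
        conj-sound l ts (holds-agree j ts ≤-refl (∧E₁ g) (∧E₂ g) (holds-wk ts there h)) (w1 (∧E₂ (∧E₂ d))))
      block-sound {n} {j} (ex χ) {w} {w'} ts h d =
        exE (CoreBd (Sat n) (bound χ)) {w' ∷ w ∷ []} (∧E₁ (∧E₂ d)) (λ x g →
          exE (EntryX j) {w' ∷ []} (fun-entry (bound χ) j (≤-bound χ) (∧E₁ g) (∧E₂ g)) (λ t e →
            exE (CoreJ (Sat n) j) {w' ∷ w ∷ []} (w2 (∧E₁ d)) (λ y f →
              -- `w'` already carries the values of the whole block, so the remaining quantifiers
              -- are read off it with `w'` as its own extension.
              exI ⟦ χ ⟧ {ts} t (block-sound χ {w'} {w'} (t ∷ ts)
                (w1 e , holds-agree j ts ≤-refl (∧E₁ f) (∧E₂ f) (holds-wk ts (there ∘ there ∘ there) h))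
                (∧I (numeralE (suc j) (λ z dz → exI (CoreJ (Sat n) (suc j)) {w' ∷ w' ∷ []} z (∧I dz (agree-refl z w'))))
                    (w3 (∧E₂ d)))))))

      conj-sound : ∀ {n j Γ} {{b : Base Γ}} (l : List (Nf n j)) {w} (ts : Vec (Term L) j) → Holds Γ w ts
                 → Γ ⊢ fm (Items (Sat n) (codesN l)) (w ∷ []) → Γ ⊢ fm (⋀¬ l) ts
      conj-sound [] ts h d = ⊤-intro
      conj-sound {n} (χ ∷ l) {w} ts h d = ∧I
        (exE (ItemD (Sat n) (codeN χ)) {w ∷ []} (∧E₁ d) (λ x g →
          negI (λ f → ¬E (∧E₂ (w1 g)) (sat-complete χ ts (w1 (∧E₁ g)) (holds-wk ts (there ∘ there) h) f))))
        (conj-sound l ts h (∧E₂ d))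

      sat-complete : ∀ {n j Γ} {{b : Base Γ}} (χ : Nf n j) {c w} (ts : Vec (Term L) j) → Γ ⊢ num (codeN χ) c → Holds Γ w ts
                   → Γ ⊢ fm ⟦ χ ⟧ ts → Γ ⊢ fm (Sat n) (c ∷ w ∷ [])
      sat-complete (at b s is) {c} {w} ts dc h d = satlits-intro lits (b , s) (∈-lits b s) (∧I
        (numeralE (litCode b s) (λ o k → exI (SymB b s) {c ∷ w ∷ []} o
          (∧I (rep-in unpair₁ᴿ ĉ (w1 dc) (num-≡ (sym (unpair₁-pair (litCode b s) (codeL (positions is)))) k)) k)))
        (args-complete ĉ 0 (LitK b s) us dc ok (fm-≡ (litP b s) (sym (takeⱽ-++ us (c ∷ w ∷ []))) d)))
        where
        ĉ = litCode b s ▹ codeL (positions is)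
        us = mapⱽ (lookup ts) is
        ok = args-ok ĉ 0 ts is h (λ i _ → trans (cong (λ q → argᶜ q ĉ) (+-identityʳ i)) (argᶜ-lit b s (positions is) i))
      sat-complete {suc n} {j} χ {c} {w} ts dc h d =
        exE (Core (Sat n) j (bound χ) (items χ)) {w ∷ []} (block-complete χ ts h d) (λ w' g →
          exI (SatB (Sat n)) {c ∷ w ∷ []} w' (core-complete (Sat n) j (bound χ) (items χ) {c} {w} {w'} (w1 dc) g))

      -- Witnesses are written one at a time: `u` extends `w` by `t` at index `j`, and the recursion
      -- extends `u` to one `w'` for the rest of the block. Agreement of `w'` with `w` below `j`
      -- passes through `u`.
      block-complete : ∀ {n j Γ} {{b : Base Γ}} (χ : Nf (suc n) j) {w} (ts : Vec (Term L) j) → Holds Γ w ts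
                     → Γ ⊢ fm ⟦ χ ⟧ ts → Γ ⊢ fm (∃ᴾ (Core (Sat n) j (bound χ) (items χ))) (w ∷ [])
      block-complete {n} {j} (cj l) {w} ts h d = exI (Core (Sat n) j j (codesN l)) {w ∷ []} w (∧I
        (numeralE j (λ x dx → exI (CoreJ (Sat n) j) {w ∷ w ∷ []} x (∧I dx (agree-refl x w))))
        (∧I (numeralE j (λ x dx → exI (CoreBd (Sat n) j) {w ∷ w ∷ []} x (∧I dx (funI j dx (λ m p → w1 (holds-entry ts h m p))))))
            (conj-complete l ts h d)))
      block-complete {n} {j} (ex χ) {w} ts h d = exE ⟦ χ ⟧ {ts} d (λ t g →
        numeralE j (λ k dk → extE w t k (λ u e →
          let agr = ext-agree (w1 (num-N j dk)) e in
          exE (Core (Sat n) (suc j) (bound χ) (items χ)) {u ∷ []}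
            (block-complete χ {u} (t ∷ ts) (ext-new j (w1 dk) e , holds-agree j ts ≤-refl (w1 dk) agr (holds-wk ts (there ∘ there ∘ there) h)) (w2 g))
            (λ w' f → exI (Core (Sat n) j (bound χ) (items χ)) {w ∷ []} w'
              (∧I (exE (CoreJ (Sat n) (suc j)) {w' ∷ u ∷ []} (∧E₁ f) (λ x a →
                    exI (CoreJ (Sat n) j) {w' ∷ w ∷ []} k (∧I (w3 dk) (agreeI (λ i y q →
                      belowE j (lt-below j (∧E₁ q) (∧E₂ q) (w4 dk)) (λ m p di →
                        ⇔-trans (agree-at (w4 agr) i y (w1 (∧E₁ q)) (w1 (∧E₂ q)))
                                (agree-at (w2 (∧E₂ a)) i y (w1 (∧E₁ q)) (lt-num (m<n⇒m<1+n p) di (w2 (∧E₁ a))))))))))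
                  (∧E₂ f))))))

      conj-complete : ∀ {n j Γ} {{b : Base Γ}} (l : List (Nf n j)) {w} (ts : Vec (Term L) j) → Holds Γ w ts
                    → Γ ⊢ fm (⋀¬ l) ts → Γ ⊢ fm (Items (Sat n) (codesN l)) (w ∷ [])
      conj-complete [] ts h d = ⊤-intro
      conj-complete {n} (χ ∷ l) {w} ts h d = ∧I
        (numeralE (codeN χ) (λ x dx → exI (ItemD (Sat n) (codeN χ)) {w ∷ []} x (∧I dx
          (negI (λ f → ¬E (w2 (∧E₁ d)) (sat-sound χ ts (w1 dx) (holds-wk ts (there ∘ there) h) f))))))
        (conj-complete l ts h (∧E₂ d))

  -- A truth predicate for sentences in normal form

  TrueB : ℕ → Pred {L} 2
  TrueB n = at2 (Sat n) f1 f0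

  True : ℕ → Pred {L} 1
  True n = ∃ᴾ (TrueB n)

  true-sound : ∀ {n Γ} {{b : Base Γ}} (χ : Nf n 0) {c} → Γ ⊢ num (codeN χ) c → Γ ⊢ fm (True n) (c ∷ []) → Γ ⊢ fm ⟦ χ ⟧ []
  true-sound {n} χ {c} dc d = exE (TrueB n) {c ∷ []} d (λ w h → sat-sound χ [] (w1 dc) tt h)

  true-complete : ∀ {n Γ} {{b : Base Γ}} (χ : Nf n 0) {c} → Γ ⊢ num (codeN χ) c → Γ ⊢ fm ⟦ χ ⟧ [] → Γ ⊢ fm (True n) (c ∷ [])
  -- In scope 0 no entry is constrained, so any term is an assignment; `c` is at hand.
  true-complete {n} χ {c} dc d = exI (TrueB n) {c ∷ []} c (sat-complete χ {w = c} [] dc tt d)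

-- Recognizing sentences and merging finite contexts.

module _ {L : Lang} where

  -- Closed formulas: a formula unchanged by shifting is a sentence.

  boundAfter : (ℕ → ℕ) → ℕ → ℕ
  boundAfter r zero = 0
  boundAfter r (suc i) = suc (r i)

  Mono : (ℕ → ℕ) → Set
  Mono r = ∀ {i j} → i ≤ j → r i ≤ r j

  boundAfter-mono : ∀ {r} → Mono r → Mono (boundAfter r)
  boundAfter-mono m z≤n = z≤n
  boundAfter-mono m (s≤s p) = s≤s (m p)

  boundAfter-⊔ : ∀ {r} → Mono r → ∀ a b → boundAfter r (a ⊔ b) ≡ boundAfter r a ⊔ boundAfter r b
  boundAfter-⊔ {r} m = mono-≤-distrib-⊔ {boundAfter r} (boundAfter-mono {r} m)

  liftʳ : (ℕ → ℕ) → ℕ → ℕ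
  liftʳ r zero = 0
  liftʳ r (suc i) = suc (r i)

  liftʳ-mono : ∀ {r} → Mono r → Mono (liftʳ r)
  liftʳ-mono m z≤n = z≤n
  liftʳ-mono m (s≤s p) = s≤s (m p)

  boundAfter-lift : ∀ r x → boundAfter (liftʳ r) x ∸ 1 ≡ boundAfter r (x ∸ 1)
  boundAfter-lift r zero = refl
  boundAfter-lift r (suc zero) = refl
  boundAfter-lift r (suc (suc i)) = refl

  Renames : (ℕ → Term L) → (ℕ → ℕ) → Set
  Renames σ r = ∀ i → σ i ≡ var (r i)

  lift-renames : ∀ {σ r} → Renames σ r → Renames (liftσ σ) (liftʳ r)
  lift-renames e zero = refl
  lift-renames e (suc i) = cong ↑ (e i)

  mutual
    fvT-rename : ∀ {σ r} → Renames σ r → Mono r → ∀ t → fvT (substT σ t) ≡ boundAfter r (fvT t)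
    fvT-rename e m (var i) = cong fvT (e i)
    fvT-rename e m (fun f ts) = fvTs-rename e m ts

    fvTs-rename : ∀ {σ r k} → Renames σ r → Mono r → ∀ (ts : Vec (Term L) k) → fvTs (substTs σ ts) ≡ boundAfter r (fvTs ts)
    fvTs-rename e m [] = refl
    fvTs-rename {r = r} e m (t ∷ ts) = trans (cong₂ _⊔_ (fvT-rename {r = r} e m t) (fvTs-rename {r = r} e m ts)) (sym (boundAfter-⊔ {r} m (fvT t) _))

  -- `fv` records only the largest free variable; monotonicity sends it to the largest free variable
  -- of the image.
  fv-rename : ∀ {σ r} → Renames σ r → Mono r → ∀ φ → fv (substF σ φ) ≡ boundAfter r (fv φ)
  fv-rename e m ⊥' = refl
  fv-rename {r = r} e m (rel s ts) = fvTs-rename {r = r} e m ts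
  fv-rename {r = r} e m (s ≐ t) = trans (cong₂ _⊔_ (fvT-rename {r = r} e m s) (fvT-rename {r = r} e m t)) (sym (boundAfter-⊔ {r} m (fvT s) _))
  fv-rename {r = r} e m (¬' φ) = fv-rename {r = r} e m φ
  fv-rename {r = r} e m (φ ∧' ψ) = trans (cong₂ _⊔_ (fv-rename {r = r} e m φ) (fv-rename {r = r} e m ψ)) (sym (boundAfter-⊔ {r} m (fv φ) _))
  fv-rename {r = r} e m (φ ∨' ψ) = trans (cong₂ _⊔_ (fv-rename {r = r} e m φ) (fv-rename {r = r} e m ψ)) (sym (boundAfter-⊔ {r} m (fv φ) _))
  fv-rename {r = r} e m (φ ⇒' ψ) = trans (cong₂ _⊔_ (fv-rename {r = r} e m φ) (fv-rename {r = r} e m ψ)) (sym (boundAfter-⊔ {r} m (fv φ) _))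
  fv-rename {r = r} e m (∀' φ) = trans (cong (_∸ 1) (fv-rename {r = liftʳ r} (lift-renames e) (liftʳ-mono {r} m) φ)) (boundAfter-lift r (fv φ))
  fv-rename {r = r} e m (∃' φ) = trans (cong (_∸ 1) (fv-rename {r = liftʳ r} (lift-renames e) (liftʳ-mono {r} m) φ)) (boundAfter-lift r (fv φ))

  -- Without arguments, `nat` says that shifting fixes the formula, whereas shifting raises a
  -- nonzero `fv` by one.
  closed-sentence : ∀ (P : Pred {L} 0) → Sentence (fm P [])
  closed-sentence P = go (fv (fm P [])) (trans (sym (fv-rename {r = suc} (λ _ → refl) s≤s (fm P []))) (cong fv (nat P (λ i → var (suc i)) [])))
    where
    go : ∀ n → boundAfter suc n ≡ n → n ≡ 0
    go zero e = refl
    go (suc n) ()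

  cut-all : ∀ {Γ Δ} {φ : Fm L} → (∀ {ψ} → ψ ∈ Γ → Δ ⊢ ψ) → Γ ⊢ φ → Δ ⊢ φ
  cut-all {[]} h d = wk (λ ()) d
  cut-all {ψ ∷ Γ} h d = ⇒E (cut-all {Γ} (λ p → h (there p)) (⇒I d)) (h (here refl))

  collect : ∀ {Th : Fm L → Set} {φs} → All (Th ⊩_) φs → Σ (List (Fm L)) λ Γ → All Th Γ × All (Γ ⊢_) φs
  collect [] = [] , [] , []
  collect ((Γ , h , d) ∷ ds) with collect ds
  ... | Δ , h' , ds' = Γ ++ Δ , ++⁺ h h' , wk ∈-++⁺ˡ d ∷ All.map (wk (∈-++⁺ʳ Γ)) ds'

  -- Deciding `P` below `n` leaves finitely many derivations, so that one finite context can serve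
  -- all rival proofs.
  collect< : ∀ {Th : Fm L → Set} (φ : ℕ → Fm L) (P : ℕ → Set) n → (∀ m → Dec (P m)) → (∀ m → P m → Th ⊩ φ m)
           → Σ (List (Fm L)) λ Γ → All Th Γ × (∀ m → m < n → P m → Γ ⊢ φ m)
  collect< φ P zero P? d = [] , [] , λ m ()
  collect< {Th} φ P (suc n) P? d with collect< {Th} φ P n P? d | P? n
  ... | Γ , h , f | no ¬p = Γ , h , λ m q p → f m (≤∧≢⇒< (≤-pred q) (λ { refl → ¬p p })) p
  ... | Γ , h , f | yes p with d n p
  ...   | Δ , h' , e = Δ ++ Γ , ++⁺ h' h , g
    where
    g : ∀ m → m < suc n → P m → Δ ++ Γ ⊢ φ m
    g m q r with m ≟ n
    ... | yes refl = wk ∈-++⁺ˡ e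
    ... | no m≢n = wk (∈-++⁺ʳ Δ) (f m (≤∧≢⇒< (≤-pred q) m≢n) r)

-- The Rosser sentence of `T ∪ A`.

module Rosser {L : Lang} (T A : Fm L → Set) (T-ce : CETheory T) (D : SeqData {L})
              (Γ₀ : List (Fm L)) (Γ₀⊆T : All T Γ₀) (base : Arith.Base D Γ₀)
              (A-sentence : ∀ φ → A φ → Sentence φ) (n : ℕ) (A⊆Sig : ∀ φ → A φ → Sig* n φ) where
  open SeqAx D
  open Arith D
  open Sequences D
  open Prenex L
  open Coding L
  open Truth D
  open Provability L

  U : Fm L → Set
  U = T ∪ A

  level : ℕ
  level = suc (suc n)

  Tr : Pred {L} 1
  Tr = True level

  TrueAtB : ℕ → Pred {L} 1
  TrueAtB c = Num c ∧ᴾ Tr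

  TrueAt : ℕ → Fm L
  TrueAt c = fm (∃ᴾ (TrueAtB c)) []

  -- Follows the code of `Num` at `var 0`. The recursion closes up because under the quantifier of
  -- `Num (suc x)` the predecessor is again `var 0`.
  codeNum : ℕ → ℕ
  codeNum zero = codeᶠ (num 0 (var 0))
  codeNum (suc x) = 4 ▹ codeᶠ N[ var 0 ] ▹ 8 ▹ 4 ▹ codeNum x ▹ codeᶠ S[ var 0 , var 1 ]

  codeNum-num : ∀ x → codeNum x ≡ codeᶠ (num x (var 0))
  codeNum-num zero = refl
  codeNum-num (suc x) = cong (λ c → 4 ▹ codeᶠ N[ var 0 ] ▹ 8 ▹ 4 ▹ c ▹ codeᶠ S[ var 0 , var 1 ]) (codeNum-num x)

  -- Diagonalization with numerals that are not terms: if `x` codes a formula θ of `var 0`, then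
  -- `codePos x` codes `∃ v (v is the numeral x ∧ θ v)`. At `e`, the code of `RosserP`, this is the
  -- code of `ψ`, while `RosserP` itself speaks of `codePos` and `codeNeg` of its argument.
  codeTrue codePos codeNeg : ℕ → ℕ
  codeTrue c = 8 ▹ 4 ▹ codeNum c ▹ codeᶠ (fm Tr (var 0 ∷ []))
  codePos x = 8 ▹ 4 ▹ codeNum x ▹ x
  codeNeg x = 3 ▹ codePos x

  codeNumᴿ : PR¹ codeNum
  codeNumᴿ = toPR¹ (recᴿ (λ { x [] → codeNum x }) (constᴿ _)
    (app² pairᴿ (constᴿ 4) (app² pairᴿ (constᴿ _) (app² pairᴿ (constᴿ 8) (app² pairᴿ (constᴿ 4) (app² pairᴿ (argᴿ f1) (constᴿ _))))))
    (λ { [] → refl }) (λ { x [] → refl }))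

  codePosᴿ : PR¹ codePos
  codePosᴿ = toPR¹ (app² pairᴿ (constᴿ 8) (app² pairᴿ (constᴿ 4) (app² pairᴿ (app¹ codeNumᴿ (argᴿ f0)) (argᴿ f0))))

  codeTrueᴿ : PR¹ codeTrue
  codeTrueᴿ = toPR¹ (app² pairᴿ (constᴿ 8) (app² pairᴿ (constᴿ 4) (app² pairᴿ (app¹ codeNumᴿ (argᴿ f0)) (constᴿ _))))

  codeNegᴿ : PR¹ codeNeg
  codeNegᴿ = toPR¹ (app² pairᴿ (constᴿ 3) (app¹ codePosᴿ (argᴿ fz)))

  codeTrue-TrueAt : ∀ c → codeTrue c ≡ codeᶠ (TrueAt c)
  codeTrue-TrueAt c = cong (λ k → 8 ▹ 4 ▹ k ▹ codeᶠ (fm Tr (var 0 ∷ []))) (codeNum-num c)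

  abstract
    -- p = c ▹ i is a proof of g(x) if the i-th stage contains the theorem "TrueAt c implies g(x)".
    proofOf : (ℕ → ℕ) → ℕ → ℕ → ℕ
    proofOf g p x = derivedBy T T-ce (unpair₂ p) (codeA (Th T T-ce (6 ▹ codeTrue (unpair₁ p) ▹ g x)))

    proofOfᴿ : ∀ {g} → PR¹ g → PR² (proofOf g)
    proofOfᴿ gᴿ = toPR² (app² (derivedByᴿ T T-ce) (app¹ unpair₂ᴿ (argᴿ fz)) (app² pairᴿ (constᴿ 9) (app² pairᴿ
      (app² pairᴿ (constᴿ 6) (app² pairᴿ (app¹ codeTrueᴿ (app¹ unpair₁ᴿ (argᴿ fz))) (app¹ gᴿ (argᴿ (fs fz)))))
      (app² pairᴿ (constᴿ 0) (app² pairᴿ (constᴿ 0) (constᴿ 0))))))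

    proof-sound : ∀ g θ x → g x ≡ codeᶠ θ → ∀ p → proofOf g p x ≡ 0 → T ⊩ (TrueAt (unpair₁ p) ⇒' θ)
    proof-sound g θ x h p d = Th-sound T T-ce (derivedBy-sound T T-ce (unpair₂ p) (Th T T-ce (6 ▹ codeᶠ (TrueAt (unpair₁ p)) ▹ codeᶠ θ))
      (subst (λ k → derivedBy T T-ce (unpair₂ p) (codeA (Th T T-ce k)) ≡ 0) (cong₂ (λ a b → 6 ▹ a ▹ b) (codeTrue-TrueAt (unpair₁ p)) h) d))

    proof-complete : ∀ g θ x → g x ≡ codeᶠ θ → ∀ c → T ⊩ (TrueAt c ⇒' θ) → Σ ℕ λ p → unpair₁ p ≡ c × proofOf g p x ≡ 0
    proof-complete g θ x h c d = finish (derivedBy-complete T T-ce (Th-complete T T-ce d))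
      where
      stages : ℕ → ℕ → ℕ
      stages i a = derivedBy T T-ce i (codeA (Th T T-ce a))
      eq : ∀ i → 6 ▹ codeTrue (unpair₁ (c ▹ i)) ▹ g x ≡ codeᶠ (TrueAt c ⇒' θ)
      eq i = cong₂ (λ a b → 6 ▹ a ▹ b) (trans (cong codeTrue (unpair₁-pair c i)) (codeTrue-TrueAt c)) h
      finish : (∃ λ i → stages i (codeᶠ (TrueAt c ⇒' θ)) ≡ 0) → Σ ℕ λ p → unpair₁ p ≡ c × proofOf g p x ≡ 0
      finish (i , k) = c ▹ i , unpair₁-pair c i , trans (cong₂ stages (unpair₂-pair c i) (eq i)) k

  TrueB' : Pred {L} 3
  TrueB' = at2 (Rep¹ unpair₁ᴿ) f0 f1 ∧ᴾ at1 Tr f0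

  FlagB : ∀ {f} → PR² f → Pred {L} 3
  FlagB q = at3 (Rep² q) f0 f1 f2 ∧ᴾ at1 (Num 0) f0

  Proves : ∀ {f} → PR² f → Pred {L} 2
  Proves q = ∃ᴾ TrueB' ∧ᴾ ∃ᴾ (FlagB q)

  posᴿ : PR² (proofOf codePos)
  posᴿ = proofOfᴿ codePosᴿ

  negᴿ : PR² (proofOf codeNeg)
  negᴿ = proofOfᴿ codeNegᴿ

  -- The order is non-strict, as in `le-total`; accordingly the rivals compared with a proof `p` are
  -- the numbers below `suc p`.
  EarlierB : Pred {L} 3
  EarlierB = NN ∧ᴾ at2 LeP f0 f1 ∧ᴾ at2 (Proves negᴿ) f0 f2

  RosserB : Pred {L} 2
  RosserB = NN ∧ᴾ at2 (Proves posᴿ) f0 f1 ⇒ᴾ ∃ᴾ EarlierB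

  abstract
    RosserP : Pred {L} 1
    RosserP = ∀ᴾ RosserB

    rosserE : ∀ {Γ x} → Γ ⊢ fm RosserP (x ∷ []) → ∀ y → Γ ⊢ fm RosserB (y ∷ x ∷ [])
    rosserE {x = x} d = allE RosserB {x ∷ []} d

    rosserI : ∀ {Γ x} → (∀ y → Γ ⊢ fm RosserB (y ∷ x ∷ [])) → Γ ⊢ fm RosserP (x ∷ [])
    rosserI {x = x} d = allI RosserB {x ∷ []} d

    e : ℕ
    e = codeᶠ (fm RosserP (var 0 ∷ []))

    e-def : e ≡ codeᶠ (fm RosserP (var 0 ∷ []))
    e-def = refl

  ψB : Pred {L} 1
  ψB = Num e ∧ᴾ RosserP

  ψ : Fm L
  ψ = fm (∃ᴾ ψB) []

  proofPos proofNeg : ℕ → ℕ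
  proofPos p = proofOf codePos p e
  proofNeg p = proofOf codeNeg p e

  codePos-ψ : codePos e ≡ codeᶠ ψ
  codePos-ψ = cong₂ (λ c d → 8 ▹ 4 ▹ c ▹ d) (codeNum-num e) e-def

  codeNeg-ψ : codeNeg e ≡ codeᶠ (¬' ψ)
  codeNeg-ψ = cong (3 ▹_) codePos-ψ

  -- Provability from T ∪ A reduces to provability from T and one true sentence of bounded complexity.

  record Split (Γ : List (Fm L)) : Set where
    field
      axiomNf   : Nf level 0
      ΓT   : List (Fm L)
      inT  : All T ΓT
      inU  : U ⊩ fm ⟦ axiomNf ⟧ []
      covers : ∀ {Δ} → ΓT ⊆ᶜ Δ → Δ ⊢ fm ⟦ axiomNf ⟧ [] → ∀ {φ} → φ ∈ Γ → Δ ⊢ φ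

  -- `and-nf` merges the normal forms of the axioms of `A` into one of the same level; the merge
  -- starts from `cj []`, a tautology.
  split : ∀ {Γ} → All U Γ → Split Γ
  split [] = record { axiomNf = cj [] ; ΓT = [] ; inT = [] ; inU = [] , [] , ⊤-intro ; covers = λ _ _ () }
  split {φ ∷ Γ} (inj₁ t ∷ us) = record
    { axiomNf = axiomNf ; ΓT = φ ∷ ΓT ; inT = t ∷ inT ; inU = inU
    ; covers = λ { s d (here refl) → hyp (s (here refl)) ; s d (there p) → covers (s ∘ there) d p } }
    where open Split (split us)
  split {φ ∷ Γ} (inj₂ a ∷ us) with sentence-normal (A-sentence φ a) (A⊆Sig φ a)
  ... | χ , eq = record
    { axiomNf = and-nf χ (Split.axiomNf S) ; ΓT = Split.ΓT S ; inT = Split.inT S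
    ; inU = φ ∷ proj₁ (Split.inU S) , inj₂ a ∷ proj₁ (proj₂ (Split.inU S)) , from both (∧I (from eq hyp0) (w1 (proj₂ (proj₂ (Split.inU S)))))
    ; covers = λ { s d (here refl) → to eq (∧E₁ (to both d)) ; s d (there p) → Split.covers S s (∧E₂ (to both d)) p } }
    where
    S = split us
    both = and-nf-≈ χ (Split.axiomNf S) []

  trueAt-sound : ∀ {Γ} {{b : Base Γ}} (χ : Nf level 0) → Γ ⊢ TrueAt (codeN χ) → Γ ⊢ fm ⟦ χ ⟧ []
  trueAt-sound χ d = exE (TrueAtB (codeN χ)) {[]} d (λ c h → true-sound χ (∧E₁ h) (∧E₂ h))

  trueAt-complete : ∀ {Γ} {{b : Base Γ}} (χ : Nf level 0) → Γ ⊢ fm ⟦ χ ⟧ [] → Γ ⊢ TrueAt (codeN χ)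
  trueAt-complete χ d = numeralE (codeN χ) (λ c h → exI (TrueAtB (codeN χ)) {[]} c (∧I h (true-complete χ h (w1 d))))

  reduce : ∀ {φ} → U ⊩ φ → Σ ℕ λ c → (U ⊩ TrueAt c) × (T ⊩ (TrueAt c ⇒' φ))
  reduce {φ} (Γ , us , d) = codeN axiomNf
    , (proj₁ inU ++ Γ₀ , ++⁺ (proj₁ (proj₂ inU)) (All.map inj₁ Γ₀⊆T)
      , trueAt-complete {{Base-wk (∈-++⁺ʳ (proj₁ inU)) base}} axiomNf (wk ∈-++⁺ˡ (proj₂ (proj₂ inU))))
    , (ΓT ++ Γ₀ , ++⁺ inT Γ₀⊆T
      , impI (λ h → cut-all (covers (there ∘ ∈-++⁺ˡ) (trueAt-sound {{Base-wk (there ∘ ∈-++⁺ʳ ΓT) base}} axiomNf h)) d))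
    where open Split (split us)

  proves-true : ∀ {Γ f} {{b : Base Γ}} (q : PR² f) m {p x} → Γ ⊢ num m p → Γ ⊢ fm (Proves q) (p ∷ x ∷ []) → Γ ⊢ TrueAt (unpair₁ m)
  proves-true q m {p} {x} dp d = exE TrueB' {p ∷ x ∷ []} (∧E₁ d) (λ c h →
    exI (TrueAtB (unpair₁ m)) {[]} c (∧I (rep-out unpair₁ᴿ m (w1 dp) (∧E₁ h)) (∧E₂ h)))

  proves-zero : ∀ {Γ f} {{b : Base Γ}} (q : PR² f) m k {p x} → ¬ f m k ≡ 0 → Γ ⊢ num m p → Γ ⊢ num k x → Γ ⊢ fm (Proves q) (p ∷ x ∷ []) → Γ ⊢ ⊥'
  proves-zero {f = f} q m k {p} {x} ne dp dx d = exE (FlagB q) {p ∷ x ∷ []} (∧E₂ d) (λ o h →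
    num-disj (f m k) 0 ne (rep-out² q m k (w1 dp) (w1 dx) (∧E₁ h)) (∧E₂ h))

  provesI : ∀ {Γ f} {{b : Base Γ}} (q : PR² f) m k {p x} → f m k ≡ 0 → Γ ⊢ num m p → Γ ⊢ num k x → Γ ⊢ TrueAt (unpair₁ m) → Γ ⊢ fm (Proves q) (p ∷ x ∷ [])
  provesI q m k {p} {x} h dp dx d = ∧I
    (exE (TrueAtB (unpair₁ m)) {[]} d (λ c g → exI TrueB' {p ∷ x ∷ []} c (∧I (rep-in unpair₁ᴿ m (w1 dp) (∧E₁ g)) (∧E₂ g))))
    (numeralE 0 (λ o g → exI (FlagB q) {p ∷ x ∷ []} o (∧I (rep-in² q m k (w1 dp) (w1 dx) (num-≡ (sym h) g)) g)))

  byCases : ∀ {P R : Set} → Dec P → (P → R) → (¬ P → R) → R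
  byCases (yes p) f g = f p
  byCases (no ¬p) f g = g ¬p

  -- Under `ψ` the proof `p` has an earlier refutation `q`, which represents a standard `m`. If `m`
  -- fails the primitive recursive test, the theory refutes that test. Otherwise the truth of the
  -- code in `m`, which is part of what is assumed about `q`, yields `¬ ψ` by `refs`.
  refute-ψ : ∀ {Γ} {{b : Base Γ}} p → proofPos p ≡ 0 → Γ ⊢ TrueAt (unpair₁ p)
           → (∀ m → m < suc p → proofNeg m ≡ 0 → Γ ⊢ TrueAt (unpair₁ m) ⇒' ¬' ψ) → Γ ⊢ ψ → Γ ⊢ ⊥'
  refute-ψ {Γ} p h tr refs d = exE ψB {[]} d (λ z g → numeralE p (λ y dy →
    exE EarlierB {y ∷ z ∷ []}
      (⇒E (rosserE (w1 (∧E₂ g)) y) (∧I (num-N p dy) (provesI posᴿ p e h dy (w1 (∧E₁ g)) (w2 tr))))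
      (λ q f → belowE (suc p) (le-below p {q} {y} (∧E₁ f) (∧E₁ (∧E₂ f)) (w1 dy)) (λ m lt dq →
        byCases (proofNeg m ≟ 0)
          (λ k → ¬E (⇒E (w4 (refs m lt k)) (proves-true negᴿ m {q} {z} dq (w1 (∧E₂ (∧E₂ f))))) (w4 d))
          (λ k → proves-zero negᴿ m e k dq (w3 (∧E₁ g)) (w1 (∧E₂ (∧E₂ f))))))))

  -- `ψ` is derived from `¬ ψ`: an arbitrary proof `y` is compared with `p`. Above `p`, the number
  -- `p` itself is the earlier refutation. Up to `p`, `y` is standard and either fails the test or
  -- gives `ψ` by `prfs`, against `¬ ψ`.
  refute-¬ψ : ∀ {Γ} {{b : Base Γ}} p → proofNeg p ≡ 0 → Γ ⊢ TrueAt (unpair₁ p)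
            → (∀ m → m < suc p → proofPos m ≡ 0 → Γ ⊢ TrueAt (unpair₁ m) ⇒' ψ) → Γ ⊢ ¬' ψ → Γ ⊢ ⊥'
  refute-¬ψ {Γ} p h tr prfs d = ¬E d (numeralE e (λ z dz → exI ψB {[]} z (∧I dz
    (rosserI (λ y → impI (λ g → numeralE p (λ u du → orE (le-total p {y} {u} (w1 (∧E₁ g)) du)
      (λ l → belowE (suc p) (le-below p {y} {u} (w2 (∧E₁ g)) l (w1 du)) (λ m lt dy →
        byCases (proofPos m ≟ 0)
          (λ k → ⊥E (¬E (w5 d) (⇒E (w5 (prfs m lt k)) (proves-true posᴿ m {y} {z} dy (w3 (∧E₂ g))))))
          (λ k → ⊥E (proves-zero posᴿ m e k dy (w4 dz) (w3 (∧E₂ g))))))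
      (λ l → exI EarlierB {y ∷ z ∷ []} u (∧I (w1 (num-N p du)) (∧I l
        (provesI negᴿ p e h (w1 du) (w3 dz) (w4 tr))))))))))))

  -- The two halves of the theorem differ by exchanging `codePos` and `codeNeg`. `reduce` turns a
  -- derivation of `θ` into a provably true code and a proof `p`; the rivals up to `p` that pass the
  -- test are finitely many theorems of `T`, each conditional on the truth of its code, so a finite
  -- part of `T ∪ A` carries all that `refute` needs.
  contradiction-by : ∀ {g g' θ θ'} → g e ≡ codeᶠ θ → g' e ≡ codeᶠ θ'
    → (∀ {Γ} {{b : Base Γ}} p → proofOf g p e ≡ 0 → Γ ⊢ TrueAt (unpair₁ p)
         → (∀ m → m < suc p → proofOf g' m e ≡ 0 → Γ ⊢ TrueAt (unpair₁ m) ⇒' θ') → Γ ⊢ θ → Γ ⊢ ⊥')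
    → Consistent U → ¬ (U ⊩ θ)
  contradiction-by {g} {g'} {θ} {θ'} code-θ code-θ' refute con (Γ , hΓ , d) =
    contradict (proj₁ found) (proj₂ (proj₂ found)) (subst (λ c → U ⊩ TrueAt c) (sym (proj₁ (proj₂ found))) (proj₁ (proj₂ reduced)))
      (rivals (proj₁ found))
    where
    reduced : Σ ℕ λ c → (U ⊩ TrueAt c) × (T ⊩ (TrueAt c ⇒' θ))
    reduced = reduce (Γ , hΓ , d)
    found : Σ ℕ λ p → unpair₁ p ≡ proj₁ reduced × proofOf g p e ≡ 0
    found = proof-complete g θ e code-θ (proj₁ reduced) (proj₂ (proj₂ reduced))
    Rivals : ℕ → Set
    Rivals p = Σ (List (Fm L)) λ Θ → All T Θ × (∀ m → m < suc p → proofOf g' m e ≡ 0 → Θ ⊢ TrueAt (unpair₁ m) ⇒' θ')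
    rivals : ∀ p → Rivals p
    rivals p = collect< (λ m → TrueAt (unpair₁ m) ⇒' θ') (λ m → proofOf g' m e ≡ 0) (suc p) (λ m → proofOf g' m e ≟ 0)
                 (proof-sound g' θ' e code-θ')
    contradict : ∀ p → proofOf g p e ≡ 0 → U ⊩ TrueAt (unpair₁ p) → Rivals p → ⊥
    contradict p h (Δ , hΔ , t) (Θ , hΘ , rs) = con (Γ ++ Δ ++ Θ ++ Γ₀ , ++⁺ hΓ (++⁺ hΔ (++⁺ (All.map inj₁ hΘ) (All.map inj₁ Γ₀⊆T)))
      , refute {{Base-wk (∈-++⁺ʳ Γ ∘ ∈-++⁺ʳ Δ ∘ ∈-++⁺ʳ Θ) base}} p h (wk (∈-++⁺ʳ Γ ∘ ∈-++⁺ˡ) t)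
          (λ m lt k → wk (∈-++⁺ʳ Γ ∘ ∈-++⁺ʳ Δ ∘ ∈-++⁺ˡ) (rs m lt k)) (wk ∈-++⁺ˡ d))

  unprovable : Consistent U → ¬ (U ⊩ ψ)
  unprovable = contradiction-by codePos-ψ codeNeg-ψ refute-ψ

  irrefutable : Consistent U → ¬ (U ⊩ ¬' ψ)
  irrefutable = contradiction-by codeNeg-ψ codePos-ψ refute-¬ψ

  incomplete : Consistent U → Incomplete U
  incomplete con = ψ , closed-sentence (∃ᴾ ψB) , unprovable con , irrefutable con

mainTheorem2 : (L : Lang) (T A : Fm L → Set)
    → (∀ φ → T φ → Sentence φ)
    → (∀ φ → A φ → Sentence φ)
    → CETheory T
    → Sequential T
    → Σ ℕ (λ n → ∀ φ → A φ → Sig* n φ)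
    → Consistent (T ∪ A)
    → Incomplete (T ∪ A)
mainTheorem2 L T A _ A-sentence ce (D , wellDef , robinson , sequence) (n , A⊆Sig) con
  with collect wellDef | collect robinson | collect (sequence ∷ [])
... | Γ₁ , h₁ , d₁ | Γ₂ , h₂ , d₂ | Γ₃ , h₃ , d₃ ∷ [] =
  Rosser.incomplete T A ce D (Γ₁ ++ Γ₂ ++ Γ₃) (++⁺ h₁ (++⁺ h₂ h₃))
    (record { wellDef = All.map (wk ∈-++⁺ˡ) d₁
            ; robinson = All.map (wk (∈-++⁺ʳ Γ₁ ∘ ∈-++⁺ˡ)) d₂
            ; sequence = wk (∈-++⁺ʳ Γ₁ ∘ ∈-++⁺ʳ Γ₂) d₃ })
    A-sentence n A⊆Sig con
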